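{- Let $B=50000$. Every odd composite integer $n$ passes the Random Quadratic Frobenius Test with probability less than $\frac{1}{7710}$.
   Context: Fix a positive integer $B$ (the trial-division bound). Let $n>1$ be odd and let $b,c$ be integers with Jacobi symbols $\left(\frac{b^2+4c}{n}\right)=-1$ and $\left(\frac{ -c}{n}\right)=1$. The Quadratic Frobenius Test (QFT) with parameters $(b,c)$ on $n$ consists of the following steps, where computations "mod $(n,x^2-bx-c)$" take place in the ring $R=(\mathbb{Z}/n\mathbb{Z})[x]/(x^2-bx-c)$. (1) If $n$ is divisible by a prime $\le \min\{B,\sqrt n\}$, declare $n$ composite and stop. (2) If $\sqrt n\in\mathbb{Z}$, declare $n$ composite and stop. (3) Compute $x^{(n+1)/2}$ in $R$; if it does not lie in $\mathbb{Z}/n\mathbb{Z}$ (i.e. its reduced form $ux+v$ has $u\neq 0$), declare $n$ composite and stop. (4) If $x^{n+1}\neq -c$ in $R$, declare $n$ composite and stop. (5) Write $n^2-1=2^rs$ with $s$ odd; if $x^s\neq 1$ in $R$ and $x^{2^js}\neq -1$ in $R$ for all $0\le j\le r-2$, declare $n$ composite and stop. If $n$ is not declared composite in steps (1)–(5), $n$ is declared a probable prime, and we say $n$ passes the QFT with parameters $(b,c)$. Let $M(n)$ be the number of pairs $(b,c)$ of residues modulo $n$ such that either $\left(\frac{b^2+4c}{n}\right)=-1$ and $\left(\frac{ -c}{n}\right)=1$, or $1<\gcd(b^2+4c,n)<n$, or $1<\gcd(c,n)<n$. We say $n$ passes the Random Quadratic Frobenius Test (RQFT) with probability $\alpha$ if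 the number of pairs $(b,c)$ of residues modulo $n$ such that $n$ passes the QFT with parameters $(b,c)$ equals $\alpha M(n)$. -}

module Defs where

open import Data.Bool using (Bool; true; false; if_then_else_; _∧_; _∨_; not)
open import Data.Nat using (ℕ; zero; suc; _+_; _*_; _∸_; _^_; _≡ᵇ_; _<ᵇ_; _≤ᵇ_; _%_; _/_)
open import Data.Nat.GCD using (gcd)
open import Data.Nat.Primality using (prime?)
open import Data.Integer using (ℤ; +_; -[1+_]) renaming (_*_ to _*ℤ_; _≟_ to _≟ℤ_)
open import Data.Bool.ListAction using (any)
open import Data.List using (List; []; _∷_; upTo; length; filter; cartesianProduct)
open import Data.Product using (_×_; _,_; proj₁; proj₂)
open import Relation.Nullary using (does)
open import Relation.Nullary.Decidable using (T?)

-- Basic modular arithmetic on ℕ (the modulus 0 case is never used;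
-- it is only there to avoid NonZero instance arguments).

_mod_ : ℕ → ℕ → ℕ
a mod zero    = a
a mod (suc k) = a % suc k

_div_ : ℕ → ℕ → ℕ
a div zero    = a
a div (suc k) = a / suc k

_divides?_ : ℕ → ℕ → Bool
d divides? a = (a mod d) ≡ᵇ 0

legendre : ℕ → ℕ → ℤ
legendre a p =
  if (a mod p) ≡ᵇ 0 then + 0
  else if any (λ y → ((y * y) mod p) ≡ᵇ (a mod p)) (upTo p) then + 1
  else -[1+ 0 ]

firstDivisor : ℕ → List ℕ → ℕ
firstDivisor n []       = n
firstDivisor n (d ∷ ds) = if d divides? n then d else firstDivisor n ds

spf : ℕ → ℕ
spf n = firstDivisor n (Data.List.map (λ d → 2 + d) (upTo n))

-- Jacobi symbol (a/n) = ∏ over the prime factorisation n = ∏ pᵢ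
-- (with multiplicity) of the Legendre symbols (a/pᵢ).
-- Computed by peeling off the smallest prime factor; the fuel
-- argument (set to n) bounds the number of prime factors.
jacobiAux : ℕ → ℕ → ℕ → ℤ
jacobiAux zero     a n = + 1
jacobiAux (suc f) a n =
  if n ≤ᵇ 1 then + 1
  else legendre a (spf n) *ℤ jacobiAux f a (n div spf n)

jacobi : ℕ → ℕ → ℤ
jacobi a n = jacobiAux n a n

-- The ring R = (ℤ/nℤ)[x]/(x² - b x - c).
-- An element is a pair (u , v) of residues mod n standing for u x + v.

R : Set
R = ℕ × ℕ

module Ring (n b c : ℕ) where

  red : R → R
  red (u , v) = (u mod n , v mod n)

  -- (u₁x+v₁)(u₂x+v₂) = u₁u₂x² + (u₁v₂+u₂v₁)x + v₁v₂,  x² = b x + c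
  mulR : R → R → R
  mulR (u₁ , v₁) (u₂ , v₂) =
    ( (u₁ * u₂ * b + u₁ * v₂ + u₂ * v₁) mod n
    , (u₁ * u₂ * c + v₁ * v₂) mod n )

  oneR : R
  oneR = (0 , 1 mod n)

  xR : R
  xR = (1 mod n , 0)

  powR : R → ℕ → R
  powR e zero    = oneR
  powR e (suc k) = mulR e (powR e k)

  _≟R_ : R → R → Bool
  p ≟R q = (proj₁ (red p) ≡ᵇ proj₁ (red q)) ∧ (proj₂ (red p) ≡ᵇ proj₂ (red q))

  negC : R
  negC = (0 , (n ∸ (c mod n)) mod n)

  negOne : R
  negOne = (0 , (n ∸ 1) mod n)

split2Aux : ℕ → ℕ → ℕ × ℕ
split2Aux zero    m = (0 , m)
split2Aux (suc f) m =
  if (0 <ᵇ m) ∧ (2 divides? m)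
  then (let rs = split2Aux f (m div 2) in (suc (proj₁ rs) , proj₂ rs))
  else (0 , m)

split2 : ℕ → ℕ × ℕ
split2 m = split2Aux m m

step1Composite : ℕ → ℕ → Bool
step1Composite B n =
  any (λ p → does (prime? p) ∧ ((p * p) ≤ᵇ n) ∧ (p divides? n)) (upTo (suc B))

step2Composite : ℕ → Bool
step2Composite n = any (λ m → (m * m) ≡ᵇ n) (upTo (suc n))

qftParams : ℕ → ℕ → ℕ → Bool
qftParams n b c =
  does (jacobi ((b * b + 4 * c) mod n) n ≟ℤ -[1+ 0 ])
  ∧ does (jacobi ((n ∸ (c mod n)) mod n) n ≟ℤ + 1)

passesQFT : ℕ → ℕ → ℕ → ℕ → Bool
passesQFT B n b c =
  qftParams n b c
  ∧ not (step1Composite B n)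
  ∧ not (step2Composite n)
  ∧ step3 ∧ step4 ∧ step5
  where
  open Ring n b c
  r = proj₁ (split2 (n * n ∸ 1))
  s = proj₂ (split2 (n * n ∸ 1))
  -- (3) x^((n+1)/2) ∈ ℤ/nℤ, i.e. its x-coefficient is 0
  step3 = proj₁ (powR xR ((n + 1) div 2)) ≡ᵇ 0
  step4 = powR xR (n + 1) ≟R negC
  step5 = (powR xR s ≟R oneR)
          ∨ any (λ j → powR xR (2 ^ j * s) ≟R negOne) (upTo (r ∸ 1))

residuePairs : ℕ → List (ℕ × ℕ)
residuePairs n = cartesianProduct (upTo n) (upTo n)

passCount : ℕ → ℕ → ℕ
passCount B n =
  length (filter (λ bc → T? (passesQFT B n (proj₁ bc) (proj₂ bc))) (residuePairs n))

nontrivGcd : ℕ → ℕ → Bool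
nontrivGcd a n = (1 <ᵇ gcd a n) ∧ (gcd a n <ᵇ n)

M : ℕ → ℕ
M n = length (filter (λ bc → T? (countedPair (proj₁ bc) (proj₂ bc))) (residuePairs n))
  where
  countedPair : ℕ → ℕ → Bool
  countedPair b c = qftParams n b c
                    ∨ nontrivGcd (b * b + 4 * c) n
                    ∨ nontrivGcd c n

-- n passes the RQFT with probability α = passCount B n / M n.
-- "α < 1/7710" ⇔ 7710 · passCount B n < M n   (M n > 0 for composite n).

-- If some p² divides n, the scalings x ↦ (1 + v n/p) x permute the admissible parameters, and every orbit
-- contains at most one passing pair.  If n is squarefree with k prime factors, Δ = b² + 4c splits these into
-- primes with (Δ/p) = 1 and primes with (Δ/p) = -1.  At a prime of the first kind a passing x has the roots α and
-- α^n mod p, which leaves at most p/2 of the p² parameters, and p > 50000 by trial division.  As (Δ/n) = -1, there is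
-- such a prime if k is even, and there are none or at least two if k is odd.  If there is none, x lies in the
-- fields 𝔽ₚ² and x^n is its Frobenius conjugate.  For k = 3 this makes the order of x divide gcd(p² - 1, n/p - 1),
-- and these three gcds cannot all be large.  For k ≥ 5 counting the 2-parts of x allowed by steps (3)-(5) gives the
-- main term (2^k + 2) / 2^(4k) of all parameters.  Finally M(n) is at least a quarter of all parameters, because
-- (Δ/n) and (-c/n) are equidistributed up to pairs that M(n) counts anyway.

module Submission where

open import Defs
open import Algebra.Bundles using (CommutativeRing)
open import Algebra.Structures using (IsCommutativeRing)
open import Data.Bool using (true; false; if_then_else_; _∧_; _∨_; not; T)
open import Data.Bool.ListAction using (any)
import Data.Bool.Properties as Boolₚ
open import Data.Empty using (⊥; ⊥-elim)
open import Data.Integer as ℤ using (ℤ; +_; -[1+_])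
import Data.Integer.DivMod as ℤ
open import Data.Integer.Divisibility.Signed as ℤˢ using (divides)
import Data.Integer.Properties as ℤₚ
open import Data.Integer.Tactic.RingSolver using (solve-∀)
open import Data.List using (List; []; _∷_; length; filter; map; upTo; applyUpTo; cartesianProduct; _++_)
open import Data.List.Membership.Propositional using (_∈_; lose; find)
import Data.List.Membership.Propositional.Properties as ∈ₚ
import Data.List.Properties as Listₚ
open import Data.List.Relation.Unary.All as All using (All; []; _∷_)
import Data.List.Relation.Unary.All.Properties as Allₚ
open import Data.List.Relation.Unary.AllPairs as AllPairs using (AllPairs; []; _∷_)
import Data.List.Relation.Unary.AllPairs.Properties as AllPairsₚ
open import Data.List.Relation.Unary.Any as Any using (here; there)
import Data.List.Relation.Unary.Any.Properties as Anyₚ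
open import Data.List.Relation.Unary.Unique.Propositional using (Unique)
import Data.List.Relation.Unary.Unique.Propositional.Properties as Uniqueₚ
open import Data.Nat using (ℕ; zero; suc; pred; _+_; _*_; _∸_; _^_; _⊔_; _%_; _/_; _!; _≤_; _<_; z≤n; s≤s; z<s; _≟_; _≤?_; _<?_; _≡ᵇ_; _≤ᵇ_; _<ᵇ_)
open import Data.Nat using (NonZero; >-nonZero; >-nonZero⁻¹; ≢-nonZero; ≢-nonZero⁻¹; nonTrivial⇒n>1; n>1⇒nonTrivial)
import Data.Nat.Combinatorics as Comb
open import Data.Nat.Coprimality as Coprime using (Coprime)
import Data.Nat.DivMod as ℕ
open import Data.Nat.Divisibility as ℕ using (_∣_; _∤_; _∣?_)
open import Data.Nat.GCD as GCD using (gcd)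
open import Data.Nat.ListAction using (product)
import Data.Nat.ListAction.Properties as ListActionₚ
open import Data.Nat.Primality as ℕ using (Prime; Composite; prime?)
import Data.Nat.Properties as ℕₚ
import Data.Nat.Tactic.RingSolver as ℕ-Solver
open import Data.Product using (_×_; _,_; proj₁; proj₂; ∃; ∃₂)
open import Data.Product.Properties using (≡-dec)
open import Data.Sum using (_⊎_; inj₁; inj₂; [_,_]′)
open import Data.Unit using (tt)
open import Data.Vec using (Vec; []; _∷_; replicate)
open import Function using (_∘_; id; case_of_; Equivalence)
open import Level using (0ℓ)
open import Relation.Binary.Definitions using (DecidableEquality)
open import Relation.Binary.PropositionalEquality using (_≡_; _≢_; refl; sym; trans; cong; cong₂; subst; subst₂; module ≡-Reasoning)
open import Relation.Nullary using (¬_; Dec; yes; no; does; contradiction)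
open import Relation.Nullary.Decidable using (T?; _×-dec_; _⊎-dec_; ¬?; map′; toSum; decidable-stable)

-- Finite sums and double counting

-- The constant comes from k = 5. At a prime p of the second kind with p² - 1 divisible by 8 but not
-- by 16, requiring x^s = 1 leaves a share of at most 2^-4: a factor 2^-3 because x must have odd
-- order, and 2^-1 because two conjugate roots share one parameter pair. A value -1 at exponent 2^j
-- s multiplies this by 2^j. Summing over j = 0, 1 and using the quarter in M(n) gives 4 (2^5 + 2) /
-- 2^20 = 17 / 2^17, just below 1 / 7710. Of 32^4 only 32^4 - 4 * 7710 * 34 = 16 is left over. It
-- has to cover the pairs with two primes of the first kind, a share of at most 1 / B², hence B² ≥
-- 2^16 * 4 * 7710, that is B ≥ 44957, the strongest condition put on B. Step (3) removes the
-- exponent j = 2, whose term would dominate: it makes the norm a square modulo p, so that x^((p² -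
-- 1) / 2) = 1. For k = 3 the 2-parts alone would give only 4 (2^3 + 2) / 2^12, about 1 / 102, which
-- is why the full orders are bounded there.

private variable
  A B : Set

∑ : List A → (A → ℕ) → ℕ
∑ []       f = 0
∑ (x ∷ xs) f = f x + ∑ xs f

ind : {P : Set} → Dec P → ℕ
ind d = if does d then 1 else 0

ind-true : {P : Set} (d : Dec P) → P → ind d ≡ 1
ind-true (yes _) _ = refl
ind-true (no ¬p) p = contradiction p ¬p

ind-false : {P : Set} (d : Dec P) → ¬ P → ind d ≡ 0
ind-false (yes p) ¬p = contradiction p ¬p
ind-false (no _)  _  = refl

ind-bound : {P : Set} (d : Dec P) {k : ℕ} → (P → 1 ≤ k) → ind d ≤ k
ind-bound (yes p) f = f p
ind-bound (no _)  f = z≤n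

*-ind-bound : {P : Set} (k : ℕ) (d : Dec P) {m : ℕ} → (P → k ≤ m) → k * ind d ≤ m
*-ind-bound k (yes p) f = ℕₚ.≤-trans (ℕₚ.≤-reflexive (ℕₚ.*-identityʳ k)) (f p)
*-ind-bound k (no _)  f = ℕₚ.≤-trans (ℕₚ.≤-reflexive (ℕₚ.*-zeroʳ k)) z≤n

ind-pos : {P : Set} (d : Dec P) → 1 ≤ ind d → P
ind-pos (yes p) _ = p

ind-mono : {P Q : Set} (d : Dec P) (e : Dec Q) → (P → Q) → ind d ≤ ind e
ind-mono d e f = ind-bound d (λ p → ℕₚ.≤-reflexive (sym (ind-true e (f p))))

ind-cong : {P Q : Set} (d : Dec P) (e : Dec Q) → (P → Q) → (Q → P) → ind d ≡ ind e
ind-cong d e f g = ℕₚ.≤-antisym (ind-mono d e f) (ind-mono e d g)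

ind-× : {P Q : Set} (d : Dec P) (e : Dec Q) → ind (d ×-dec e) ≡ ind d * ind e
ind-× (yes _) (yes _) = refl
ind-× (yes _) (no _)  = refl
ind-× (no _)  _       = refl

∑-cong : (xs : List A) {f g : A → ℕ} → (∀ {x} → x ∈ xs → f x ≡ g x) → ∑ xs f ≡ ∑ xs g
∑-cong []       h = refl
∑-cong (x ∷ xs) h = cong₂ _+_ (h (here refl)) (∑-cong xs (h ∘ there))

∑-mono : (xs : List A) {f g : A → ℕ} → (∀ {x} → x ∈ xs → f x ≤ g x) → ∑ xs f ≤ ∑ xs g
∑-mono []       h = z≤n
∑-mono (x ∷ xs) h = ℕₚ.+-mono-≤ (h (here refl)) (∑-mono xs (h ∘ there))

∑-+ : (xs : List A) (f g : A → ℕ) → ∑ xs (λ x → f x + g x) ≡ ∑ xs f + ∑ xs g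
∑-+ []       f g = refl
∑-+ (x ∷ xs) f g rewrite ∑-+ xs f g = solve (f x) (g x) (∑ xs f) (∑ xs g)
  where
  solve : ∀ a b c d → (a + b) + (c + d) ≡ (a + c) + (b + d)
  solve = ℕ-Solver.solve-∀

∑-*ˡ : (xs : List A) (k : ℕ) (f : A → ℕ) → ∑ xs (λ x → k * f x) ≡ k * ∑ xs f
∑-*ˡ []       k f = sym (ℕₚ.*-zeroʳ k)
∑-*ˡ (x ∷ xs) k f rewrite ∑-*ˡ xs k f = sym (ℕₚ.*-distribˡ-+ k (f x) (∑ xs f))

∑-*ʳ : (xs : List A) (k : ℕ) (f : A → ℕ) → ∑ xs (λ x → f x * k) ≡ ∑ xs f * k
∑-*ʳ []       k f = refl
∑-*ʳ (x ∷ xs) k f rewrite ∑-*ʳ xs k f = sym (ℕₚ.*-distribʳ-+ k (f x) (∑ xs f))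

∑-const : (xs : List A) (k : ℕ) → ∑ xs (λ _ → k) ≡ length xs * k
∑-const []       k = refl
∑-const (x ∷ xs) k = cong (λ z → k + z) (∑-const xs k)

∑-swap : (xs : List A) (ys : List B) (f : A → B → ℕ) →
         ∑ xs (λ x → ∑ ys (f x)) ≡ ∑ ys (λ y → ∑ xs (λ x → f x y))
∑-swap []       ys f = sym (trans (∑-const ys 0) (ℕₚ.*-zeroʳ (length ys)))
∑-swap (x ∷ xs) ys f = trans (cong (λ z → ∑ ys (f x) + z) (∑-swap xs ys f))
                             (sym (∑-+ ys (f x) (λ y → ∑ xs (λ x′ → f x′ y))))

∑-++ : (xs ys : List A) (f : A → ℕ) → ∑ (xs ++ ys) f ≡ ∑ xs f + ∑ ys f
∑-++ []       ys f = refl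
∑-++ (x ∷ xs) ys f = trans (cong (λ z → f x + z) (∑-++ xs ys f)) (sym (ℕₚ.+-assoc (f x) _ _))

∑-map : (xs : List A) (g : A → B) (f : B → ℕ) → ∑ (map g xs) f ≡ ∑ xs (f ∘ g)
∑-map []       g f = refl
∑-map (x ∷ xs) g f = cong (λ z → f (g x) + z) (∑-map xs g f)

∑-cartesian : (xs : List A) (ys : List B) (f : A × B → ℕ) →
              ∑ (cartesianProduct xs ys) f ≡ ∑ xs (λ x → ∑ ys (λ y → f (x , y)))
∑-cartesian []       ys f = refl
∑-cartesian (x ∷ xs) ys f = begin
  ∑ (map (x ,_) ys ++ cartesianProduct xs ys) f       ≡⟨ ∑-++ (map (x ,_) ys) _ f ⟩
  ∑ (map (x ,_) ys) f + ∑ (cartesianProduct xs ys) f  ≡⟨ cong₂ _+_ (∑-map ys (x ,_) f) (∑-cartesian xs ys f) ⟩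
  ∑ ys (λ y → f (x , y)) + ∑ xs (λ x′ → ∑ ys (λ y → f (x′ , y))) ∎
  where open ≡-Reasoning

length-cartesianProduct : (xs : List A) (ys : List B) → length (cartesianProduct xs ys) ≡ length xs * length ys
length-cartesianProduct xs ys = begin
  length (cartesianProduct xs ys)           ≡⟨ ℕₚ.*-identityʳ _ ⟨
  length (cartesianProduct xs ys) * 1       ≡⟨ ∑-const (cartesianProduct xs ys) 1 ⟨
  ∑ (cartesianProduct xs ys) (λ _ → 1)      ≡⟨ ∑-cartesian xs ys _ ⟩
  ∑ xs (λ _ → ∑ ys (λ _ → 1))               ≡⟨ ∑-const xs _ ⟩
  length xs * ∑ ys (λ _ → 1)                ≡⟨ cong (length xs *_) (trans (∑-const ys 1) (ℕₚ.*-identityʳ _)) ⟩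
  length xs * length ys                     ∎
  where open ≡-Reasoning

length-filter-∑ : {P : A → Set} (P? : ∀ x → Dec (P x)) (xs : List A) →
                  length (filter P? xs) ≡ ∑ xs (ind ∘ P?)
length-filter-∑ P? []       = refl
length-filter-∑ P? (x ∷ xs) with P? x
... | yes _ = cong suc (length-filter-∑ P? xs)
... | no  _ = length-filter-∑ P? xs

∑≡0 : (xs : List A) {f : A → ℕ} → (∀ {x} → x ∈ xs → f x ≡ 0) → ∑ xs f ≡ 0
∑≡0 []       h = refl
∑≡0 (x ∷ xs) h rewrite h (here refl) = ∑≡0 xs (h ∘ there)

∈⇒≤∑ : {xs : List A} {x : A} (f : A → ℕ) → x ∈ xs → f x ≤ ∑ xs f
∈⇒≤∑ f (here refl)                  = ℕₚ.m≤m+n _ _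
∈⇒≤∑ {xs = y ∷ _} f (there x∈xs) = ℕₚ.≤-trans (∈⇒≤∑ f x∈xs) (ℕₚ.m≤n+m _ (f y))

∈∈⇒+≤∑ : {xs : List A} {x y : A} (f : A → ℕ) → x ∈ xs → y ∈ xs → x ≢ y → f x + f y ≤ ∑ xs f
∈∈⇒+≤∑ f (here refl) (here refl) x≢y = contradiction refl x≢y
∈∈⇒+≤∑ f (here refl) (there q) x≢y = ℕₚ.+-monoʳ-≤ _ (∈⇒≤∑ f q)
∈∈⇒+≤∑ {x = x} {y} f (there p) (here refl) x≢y =
  ℕₚ.≤-trans (ℕₚ.≤-reflexive (ℕₚ.+-comm (f x) (f y))) (ℕₚ.+-monoʳ-≤ (f y) (∈⇒≤∑ f p))
∈∈⇒+≤∑ {xs = z ∷ _} f (there p) (there q) x≢y = ℕₚ.≤-trans (∈∈⇒+≤∑ f p q x≢y) (ℕₚ.m≤n+m _ (f z))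

∑-witness : (xs : List A) (f : A → ℕ) → 1 ≤ ∑ xs f → ∃ λ x → x ∈ xs × 1 ≤ f x
∑-witness (x ∷ xs) f h with f x in eq
... | suc _ = x , here refl , subst (1 ≤_) (sym eq) (s≤s z≤n)
... | zero  = let y , y∈xs , 1≤fy = ∑-witness xs f h in y , there y∈xs , 1≤fy

-- If no summand is positive the sum is 0, so the bound may be proved in the presence of one
-- positive summand. Its index then supplies data, for instance a nonresidue from which a field is
-- built.
∑-bound-by-witness : (xs : List A) (f : A → ℕ) {k : ℕ} →
                     (∀ {x} → x ∈ xs → 1 ≤ f x → ∑ xs f ≤ k) → ∑ xs f ≤ k
∑-bound-by-witness xs f h with 1 ≤? ∑ xs f
... | yes 1≤∑ = let x , x∈xs , 1≤fx = ∑-witness xs f 1≤∑ in h x∈xs 1≤fx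
... | no  1≰∑ rewrite ℕₚ.n<1⇒n≡0 (ℕₚ.≰⇒> 1≰∑) = z≤n

∑-ind≤1 : {P : A → Set} (P? : ∀ x → Dec (P x)) (xs : List A) → Unique xs →
          (∀ {x y} → x ∈ xs → y ∈ xs → P x → P y → x ≡ y) → ∑ xs (ind ∘ P?) ≤ 1
∑-ind≤1 P? []       _            h = z≤n
∑-ind≤1 P? (x ∷ xs) (x∉xs ∷ xs!) h with P? x
... | no  _  = ∑-ind≤1 P? xs xs! (λ p q → h (there p) (there q))
... | yes px = ℕₚ.≤-reflexive (cong suc (∑≡0 xs λ {y} y∈xs →
  ind-false (P? y) (λ py → All.lookup x∉xs y∈xs (h (here refl) (there y∈xs) px py))))

∑-ind≡1 : {P : A → Set} (P? : ∀ x → Dec (P x)) (xs : List A) → Unique xs →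
          (∀ {x y} → x ∈ xs → y ∈ xs → P x → P y → x ≡ y) →
          {x : A} → x ∈ xs → P x → ∑ xs (ind ∘ P?) ≡ 1
∑-ind≡1 P? xs xs! h {x} x∈xs px = ℕₚ.≤-antisym (∑-ind≤1 P? xs xs! h)
  (ℕₚ.≤-trans (ℕₚ.≤-reflexive (sym (ind-true (P? x) px))) (∈⇒≤∑ (ind ∘ P?) x∈xs))

-- `r x y` is the weight of an incidence between x and y. The factor `k` later records that one
-- parameter pair has two roots.
double-count-≤ : (xs : List A) (ys : List B) (r : A → B → ℕ) (k : ℕ) {f : A → ℕ} {g : B → ℕ} →
                 (∀ {x} → x ∈ xs → k * f x ≤ ∑ ys (r x)) →
                 (∀ {y} → y ∈ ys → ∑ xs (λ x → r x y) ≤ g y) →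
                 k * ∑ xs f ≤ ∑ ys g
double-count-≤ xs ys r k {f} {g} h h′ = begin
  k * ∑ xs f                    ≡⟨ ∑-*ˡ xs k f ⟨
  ∑ xs (λ x → k * f x)          ≤⟨ ∑-mono xs h ⟩
  ∑ xs (λ x → ∑ ys (r x))       ≡⟨ ∑-swap xs ys r ⟩
  ∑ ys (λ y → ∑ xs (λ x → r x y)) ≤⟨ ∑-mono ys h′ ⟩
  ∑ ys g                        ∎
  where open ℕₚ.≤-Reasoning

double-count-≡ : (xs : List A) (ys : List B) (r : A → B → ℕ) {f : A → ℕ} {g : B → ℕ} →
                 (∀ {x} → x ∈ xs → ∑ ys (r x) ≡ f x) →
                 (∀ {y} → y ∈ ys → ∑ xs (λ x → r x y) ≡ g y) →
                 ∑ xs f ≡ ∑ ys g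
double-count-≡ xs ys r h h′ =
  trans (sym (∑-cong xs h)) (trans (∑-swap xs ys r) (∑-cong ys h′))

-- The slack of the total is the sum of the slacks 1 - f y, so it vanishes only if each of them
-- does.
∑-tight : (ys : List A) {f : A → ℕ} → (∀ {y} → y ∈ ys → f y ≤ 1) →
          length ys ≤ ∑ ys f → ∀ {y} → y ∈ ys → f y ≡ 1
∑-tight (y ∷ ys) {f} h le y∈ = go y∈
  where
  ∑≤ : ∑ ys f ≤ length ys
  ∑≤ = ℕₚ.≤-trans (∑-mono ys (h ∘ there)) (ℕₚ.≤-reflexive (trans (∑-const ys 1) (ℕₚ.*-identityʳ _)))
  go : ∀ {z} → z ∈ y ∷ ys → f z ≡ 1
  go (here refl) = ℕₚ.≤-antisym (h (here refl)) (ℕₚ.+-cancelʳ-≤ (length ys) 1 (f y)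
    (ℕₚ.≤-trans le (ℕₚ.+-monoʳ-≤ (f y) ∑≤)))
  go (there z∈)  = ∑-tight ys (h ∘ there) (ℕₚ.+-cancelˡ-≤ 1 _ _
    (ℕₚ.≤-trans le (ℕₚ.+-monoˡ-≤ (∑ ys f) (h (here refl))))) z∈

∑-pick : (_≟′_ : DecidableEquality A) (ys : List A) → Unique ys → (g : A → ℕ) {z : A} → z ∈ ys →
         ∑ ys (λ y → ind (z ≟′ y) * g y) ≡ g z
∑-pick _≟′_ ys ys! g {z} z∈ys = begin
  ∑ ys (λ y → ind (z ≟′ y) * g y) ≡⟨ ∑-cong ys (λ {y} _ → same y) ⟩
  ∑ ys (λ y → ind (z ≟′ y) * g z) ≡⟨ ∑-*ʳ ys (g z) _ ⟩
  ∑ ys (λ y → ind (z ≟′ y)) * g z ≡⟨ cong (_* g z) (∑-ind≡1 (z ≟′_) ys ys! (λ _ _ p q → trans (sym p) q) z∈ys refl) ⟩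
  1 * g z                         ≡⟨ ℕₚ.*-identityˡ (g z) ⟩
  g z                             ∎
  where
  open ≡-Reasoning
  same : ∀ y → ind (z ≟′ y) * g y ≡ ind (z ≟′ y) * g z
  same y with z ≟′ y
  ... | yes refl = refl
  ... | no _     = refl

-- An injection between lists of equal length is onto: its fibres have at most one element each and
-- `length ys` elements together, so `∑-tight` makes each of them a singleton. Bijections are thus
-- obtained without constructing inverses.
∑-reindex : (_≟′_ : DecidableEquality B) {xs : List A} {ys : List B} → Unique xs → Unique ys →
            length xs ≡ length ys → (π : A → B) → (∀ {x} → x ∈ xs → π x ∈ ys) →
            (∀ {x x′} → x ∈ xs → x′ ∈ xs → π x ≡ π x′ → x ≡ x′) →
            (g : B → ℕ) → ∑ xs (g ∘ π) ≡ ∑ ys g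
∑-reindex {A = A} _≟′_ {xs} {ys} xs! ys! len π into inj g =
  double-count-≡ xs ys (λ x y → ind (π x ≟′ y) * g y)
    (λ x∈ → ∑-pick _≟′_ ys ys! g (into x∈))
    (λ {y} y∈ → trans (∑-*ʳ xs (g y) _) (trans (cong (_* g y) (hit y∈)) (ℕₚ.*-identityˡ (g y))))
  where
  open ≡-Reasoning
  total : ∑ ys (λ y → ∑ xs (λ x → ind (π x ≟′ y))) ≡ length ys
  total = begin
    ∑ ys (λ y → ∑ xs (λ x → ind (π x ≟′ y))) ≡⟨ ∑-swap xs ys _ ⟨
    ∑ xs (λ x → ∑ ys (λ y → ind (π x ≟′ y))) ≡⟨ ∑-cong xs (λ {x} x∈ → ∑-ind≡1 (π x ≟′_) ys ys! (λ _ _ p q → trans (sym p) q) (into x∈) refl) ⟩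
    ∑ xs (λ _ → 1)                           ≡⟨ ∑-const xs 1 ⟩
    length xs * 1                            ≡⟨ ℕₚ.*-identityʳ _ ⟩
    length xs                                ≡⟨ len ⟩
    length ys                                ∎
  hit : ∀ {y} → y ∈ ys → ∑ xs (λ x → ind (π x ≟′ y)) ≡ 1
  hit = ∑-tight ys (λ {y} _ → ∑-ind≤1 (λ x → π x ≟′ y) xs xs! (λ p q e e′ → inj p q (trans e (sym e′))))
                (ℕₚ.≤-reflexive (sym total))

upTo! : ∀ n → Unique (upTo n)
upTo! = Uniqueₚ.upTo⁺

∈-upTo : ∀ {n i} → i < n → i ∈ upTo n
∈-upTo = ∈ₚ.∈-upTo⁺

∈-upTo⇒< : ∀ {n i} → i ∈ upTo n → i < n
∈-upTo⇒< = ∈ₚ.∈-upTo⁻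

residuePairs! : ∀ n → Unique (residuePairs n)
residuePairs! n = Uniqueₚ.cartesianProduct⁺ (upTo! n) (upTo! n)

∈-residuePairs : ∀ {n b c} → b < n → c < n → (b , c) ∈ residuePairs n
∈-residuePairs b<n c<n = ∈ₚ.∈-cartesianProduct⁺ (∈-upTo b<n) (∈-upTo c<n)

∈-residuePairs⇒< : ∀ {n b c} → (b , c) ∈ residuePairs n → b < n × c < n
∈-residuePairs⇒< {n} bc∈ = let p , q = ∈ₚ.∈-cartesianProduct⁻ (upTo n) (upTo n) bc∈ in ∈-upTo⇒< p , ∈-upTo⇒< q

∑-upTo-const : ∀ n k → ∑ (upTo n) (λ _ → k) ≡ n * k
∑-upTo-const n k = trans (∑-const (upTo n) k) (cong (_* k) (Listₚ.length-upTo n))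

-- Congruences of integers

infix 4 _≈_[_]

-- As a record it lets unification recover `a`, `b` and `m`, which are lost once `m ∣ ℤ.∣ a ℤ.- b ∣`
-- has been formed.
record _≈_[_] (a b : ℤ) (m : ℕ) : Set where
  constructor congruent
  field
    quot  : ℤ
    split : a ≡ b ℤ.+ quot ℤ.* + m

module _ {m : ℕ} where

  ≈-refl : ∀ {a} → a ≈ a [ m ]
  ≈-refl {a} = congruent (+ 0) (lemma a (+ m))
    where
    lemma : ∀ a m → a ≡ a ℤ.+ + 0 ℤ.* m
    lemma = solve-∀

  ≈-reflexive : ∀ {a b} → a ≡ b → a ≈ b [ m ]
  ≈-reflexive refl = ≈-refl

  ≈-sym : ∀ {a b} → a ≈ b [ m ] → b ≈ a [ m ]
  ≈-sym {a} {b} (congruent k refl) = congruent (ℤ.- k) (lemma b k (+ m))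
    where
    lemma : ∀ b k m → b ≡ b ℤ.+ k ℤ.* m ℤ.+ ℤ.- k ℤ.* m
    lemma = solve-∀

  ≈-trans : ∀ {a b c} → a ≈ b [ m ] → b ≈ c [ m ] → a ≈ c [ m ]
  ≈-trans {c = c} (congruent k refl) (congruent l refl) = congruent (l ℤ.+ k) (lemma c k l (+ m))
    where
    lemma : ∀ c k l m → c ℤ.+ l ℤ.* m ℤ.+ k ℤ.* m ≡ c ℤ.+ (l ℤ.+ k) ℤ.* m
    lemma = solve-∀

  ≈-+ : ∀ {a b c d} → a ≈ b [ m ] → c ≈ d [ m ] → a ℤ.+ c ≈ b ℤ.+ d [ m ]
  ≈-+ {b = b} {d = d} (congruent k refl) (congruent l refl) = congruent (k ℤ.+ l) (lemma b d k l (+ m))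
    where
    lemma : ∀ b d k l m → (b ℤ.+ k ℤ.* m) ℤ.+ (d ℤ.+ l ℤ.* m) ≡ (b ℤ.+ d) ℤ.+ (k ℤ.+ l) ℤ.* m
    lemma = solve-∀

  ≈-neg : ∀ {a b} → a ≈ b [ m ] → ℤ.- a ≈ ℤ.- b [ m ]
  ≈-neg {b = b} (congruent k refl) = congruent (ℤ.- k) (lemma b k (+ m))
    where
    lemma : ∀ b k m → ℤ.- (b ℤ.+ k ℤ.* m) ≡ ℤ.- b ℤ.+ ℤ.- k ℤ.* m
    lemma = solve-∀

  ≈-* : ∀ {a b c d} → a ≈ b [ m ] → c ≈ d [ m ] → a ℤ.* c ≈ b ℤ.* d [ m ]
  ≈-* {b = b} {d = d} (congruent k refl) (congruent l refl) =
    congruent (b ℤ.* l ℤ.+ k ℤ.* d ℤ.+ k ℤ.* l ℤ.* + m) (lemma b d k l (+ m))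
    where
    lemma : ∀ b d k l m → (b ℤ.+ k ℤ.* m) ℤ.* (d ℤ.+ l ℤ.* m) ≡
                          b ℤ.* d ℤ.+ (b ℤ.* l ℤ.+ k ℤ.* d ℤ.+ k ℤ.* l ℤ.* m) ℤ.* m
    lemma = solve-∀

  ≈-- : ∀ {a b c d} → a ≈ b [ m ] → c ≈ d [ m ] → a ℤ.- c ≈ b ℤ.- d [ m ]
  ≈-- p q = ≈-+ p (≈-neg q)

  ≈-*ˡ : ∀ k {a b} → a ≈ b [ m ] → k ℤ.* a ≈ k ℤ.* b [ m ]
  ≈-*ˡ k = ≈-* {a = k} ≈-refl

  ≈-*ʳ : ∀ k {a b} → a ≈ b [ m ] → a ℤ.* k ≈ b ℤ.* k [ m ]
  ≈-*ʳ k p = ≈-* {c = k} p ≈-refl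

  ≈⇒∣ : ∀ {a b} → a ≈ b [ m ] → m ∣ ℤ.∣ a ℤ.- b ∣
  ≈⇒∣ {b = b} (congruent k refl) = ℤˢ.∣⇒∣ᵤ (divides k (lemma b k (+ m)))
    where
    lemma : ∀ b k m → b ℤ.+ k ℤ.* m ℤ.- b ≡ k ℤ.* m
    lemma = solve-∀

  ∣⇒≈ : ∀ {a b} → m ∣ ℤ.∣ a ℤ.- b ∣ → a ≈ b [ m ]
  ∣⇒≈ {a} {b} m∣ with ℤˢ.∣ᵤ⇒∣ {+ m} {a ℤ.- b} m∣
  ... | divides k eq = congruent k (trans (lemma a b) (cong (λ z → b ℤ.+ z) eq))
    where
    lemma : ∀ a b → a ≡ b ℤ.+ (a ℤ.- b)
    lemma = solve-∀

  ≈0⇒∣ : ∀ {a} → a ≈ + 0 [ m ] → m ∣ ℤ.∣ a ∣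
  ≈0⇒∣ {a} p = subst (λ z → m ∣ ℤ.∣ z ∣) (ℤₚ.+-identityʳ a) (≈⇒∣ p)

  ∣⇒≈0 : ∀ {a} → m ∣ ℤ.∣ a ∣ → a ≈ + 0 [ m ]
  ∣⇒≈0 {a} p = ∣⇒≈ (subst (λ z → m ∣ ℤ.∣ z ∣) (sym (ℤₚ.+-identityʳ a)) p)

  ≈⇒-≈0 : ∀ {a b} → a ≈ b [ m ] → a ℤ.- b ≈ + 0 [ m ]
  ≈⇒-≈0 {b = b} p = ≈-trans (≈-- p ≈-refl) (≈-reflexive (ℤₚ.+-inverseʳ b))

  -≈0⇒≈ : ∀ {a b} → a ℤ.- b ≈ + 0 [ m ] → a ≈ b [ m ]
  -≈0⇒≈ p = ∣⇒≈ (≈0⇒∣ p)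

  infix 4 _≈?_

  _≈?_ : ∀ a b → Dec (a ≈ b [ m ])
  a ≈? b = map′ ∣⇒≈ ≈⇒∣ (m ∣? ℤ.∣ a ℤ.- b ∣)

≈-weaken : ∀ {d m a b} → d ∣ m → a ≈ b [ m ] → a ≈ b [ d ]
≈-weaken d∣m p = ∣⇒≈ (ℕ.∣-trans d∣m (≈⇒∣ p))

%-≈ : ∀ a m .{{_ : NonZero m}} → + (a % m) ≈ + a [ m ]
%-≈ a m = ≈-sym (congruent (+ (a / m)) (trans (cong +_ (ℕ.m≡m%n+[m/n]*n a m))
  (trans (ℤₚ.pos-+ (a % m) _) (cong (λ z → + (a % m) ℤ.+ z) (ℤₚ.pos-* (a / m) m)))))

residue : ∀ m .{{_ : NonZero m}} → ℤ → ℕ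
residue m a = a ℤ.%ℕ m

residue< : ∀ m .{{_ : NonZero m}} a → residue m a < m
residue< m a = ℤ.n%ℕd<d a m

residue≈ : ∀ m .{{_ : NonZero m}} a → + residue m a ≈ a [ m ]
residue≈ m a = ≈-sym (congruent (a ℤ./ℕ m) (ℤ.a≡a%ℕn+[a/ℕn]*n a m))

∣∧<⇒≡0 : ∀ {m k} → m ∣ k → k < m → k ≡ 0
∣∧<⇒≡0 {k = zero}  _ _ = refl
∣∧<⇒≡0 {k = suc k} m∣k k<m = contradiction (ℕ.∣⇒≤ m∣k) (ℕₚ.<⇒≱ k<m)

residue-unique : ∀ {m i j} → i < m → j < m → + i ≈ + j [ m ] → i ≡ j
residue-unique {m} {i} {j} i<m j<m p = ℤₚ.+-injective (ℤₚ.i-j≡0⇒i≡j (+ i) (+ j)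
  (ℤₚ.∣i∣≡0⇒i≡0 (∣∧<⇒≡0 (≈⇒∣ p) (ℕₚ.≤-<-trans bound (ℕₚ.⊔-lub i<m j<m)))))
  where
  bound : ℤ.∣ + i ℤ.- + j ∣ ≤ i ⊔ j
  bound = subst (λ z → ℤ.∣ z ∣ ≤ i ⊔ j) (sym (ℤₚ.m-n≡m⊖n i j)) (ℤₚ.∣m⊝n∣≤m⊔n i j)

≈-prime : ∀ {p a b} → Prime p → a ℤ.* b ≈ + 0 [ p ] → a ≈ + 0 [ p ] ⊎ b ≈ + 0 [ p ]
≈-prime {p} {a} {b} pp ab≈0 with ℕ.euclidsLemma ℤ.∣ a ∣ ℤ.∣ b ∣ pp (subst (p ∣_) (ℤₚ.abs-* a b) (≈0⇒∣ ab≈0))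
... | inj₁ p∣a = inj₁ (∣⇒≈0 p∣a)
... | inj₂ p∣b = inj₂ (∣⇒≈0 p∣b)

∣i∣≡+i⊎-i : ∀ i → (+ ℤ.∣ i ∣ ≡ i) ⊎ (+ ℤ.∣ i ∣ ≡ ℤ.- i)
∣i∣≡+i⊎-i (+ n)      = inj₁ refl
∣i∣≡+i⊎-i (-[1+ n ]) = inj₂ refl

coprime-inverse : ∀ {a m} → Coprime a m → ∃ λ i → + a ℤ.* i ≈ + 1 [ m ]
coprime-inverse {a} {m} cop with Coprime.coprime-Bézout cop
... | GCD.Bézout.+- x y eq = + x , congruent (+ y) (begin
  + a ℤ.* + x            ≡⟨ ℤₚ.*-comm (+ a) (+ x) ⟩
  + x ℤ.* + a            ≡⟨ ℤₚ.pos-* x a ⟨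
  + (x * a)              ≡⟨ cong +_ eq ⟨
  + (1 + y * m)          ≡⟨ cong (λ z → + 1 ℤ.+ z) (ℤₚ.pos-* y m) ⟩
  + 1 ℤ.+ + y ℤ.* + m    ∎)
  where open ≡-Reasoning
... | GCD.Bézout.-+ x y eq = ℤ.- + x , congruent (ℤ.- + y) (begin
  + a ℤ.* ℤ.- + x                               ≡⟨ lemma (+ a) (+ x) ⟩
  + 1 ℤ.+ ℤ.- (+ 1 ℤ.+ + x ℤ.* + a)             ≡⟨ cong (λ z → + 1 ℤ.+ ℤ.- (+ 1 ℤ.+ z)) (ℤₚ.pos-* x a) ⟨
  + 1 ℤ.+ ℤ.- (+ (1 + x * a))                   ≡⟨ cong (λ z → + 1 ℤ.+ ℤ.- + z) eq ⟩
  + 1 ℤ.+ ℤ.- + (y * m)                         ≡⟨ cong (λ z → + 1 ℤ.+ ℤ.- z) (ℤₚ.pos-* y m) ⟩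
  + 1 ℤ.+ ℤ.- (+ y ℤ.* + m)                     ≡⟨ cong (λ z → + 1 ℤ.+ z) (ℤₚ.neg-distribˡ-* (+ y) (+ m)) ⟩
  + 1 ℤ.+ ℤ.- + y ℤ.* + m                       ∎)
  where
  open ≡-Reasoning
  lemma : ∀ a x → a ℤ.* ℤ.- x ≡ + 1 ℤ.+ ℤ.- (+ 1 ℤ.+ x ℤ.* a)
  lemma = solve-∀

prime∤⇒coprime : ∀ {p k} → Prime p → p ∤ k → Coprime k p
prime∤⇒coprime pp p∤k (d∣k , d∣p) with ℕ.prime⇒irreducible pp d∣p
... | inj₁ d≡1 = d≡1
... | inj₂ refl = contradiction d∣k p∤k

≈-inverse : ∀ {p a} → Prime p → ¬ a ≈ + 0 [ p ] → ∃ λ i → a ℤ.* i ≈ + 1 [ p ]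
≈-inverse {p} {a} pp a≉0 with coprime-inverse (prime∤⇒coprime pp (a≉0 ∘ ∣⇒≈0)) | ∣i∣≡+i⊎-i a
... | i , eq | inj₁ e = i , subst (λ z → z ℤ.* i ≈ + 1 [ p ]) e eq
... | i , eq | inj₂ e = ℤ.- i , ≈-trans (≈-reflexive (lemma a i)) (subst (λ z → z ℤ.* i ≈ + 1 [ p ]) e eq)
  where
  lemma : ∀ a i → a ℤ.* ℤ.- i ≡ ℤ.- a ℤ.* i
  lemma = solve-∀

≈-cancelˡ : ∀ {p} a {b c} → Prime p → ¬ a ≈ + 0 [ p ] → a ℤ.* b ≈ a ℤ.* c [ p ] → b ≈ c [ p ]
≈-cancelˡ a {b} {c} pp a≉0 eq with ≈-prime {a = a} {b ℤ.- c} pp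
    (≈-trans (≈-reflexive (lemma a b c)) (≈⇒-≈0 eq))
  where
  lemma : ∀ a b c → a ℤ.* (b ℤ.- c) ≡ a ℤ.* b ℤ.- a ℤ.* c
  lemma = solve-∀
... | inj₁ a≈0 = contradiction a≈0 a≉0
... | inj₂ p   = -≈0⇒≈ p

coprime-*-∣ : ∀ {p m k} → Coprime p m → p ∣ k → m ∣ k → p * m ∣ k
coprime-*-∣ {p} {m} cop (ℕ.divides q refl) m∣qp =
  subst (_∣ q * p) (ℕₚ.*-comm m p) (ℕ.*-monoˡ-∣ p (Coprime.coprime-divisor (Coprime.sym cop)
    (subst (m ∣_) (ℕₚ.*-comm q p) m∣qp)))

≈-crt : ∀ {p m a b} → Coprime p m → a ≈ b [ p ] → a ≈ b [ m ] → a ≈ b [ p * m ]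
≈-crt cop p q = ∣⇒≈ (coprime-*-∣ cop (≈⇒∣ p) (≈⇒∣ q))

-- Powers, the freshman's dream and roots in commutative rings

p∤! : ∀ {p} → Prime p → ∀ k → k < p → p ∤ k !
p∤! pp zero    _   p∣1 = ℕ.¬prime[1] (subst Prime (ℕ.∣1⇒≡1 p∣1) pp)
p∤! pp (suc k) k<p p∣k! with ℕ.euclidsLemma (suc k) (k !) pp p∣k!
... | inj₁ p∣k = ℕₚ.<⇒≱ k<p (ℕ.∣⇒≤ p∣k)
... | inj₂ p∣! = p∤! pp k (ℕₚ.<-trans (ℕₚ.n<1+n k) k<p) p∣!

-- The prime p divides p! = C(p, k) k! (p - k)! but neither of the two factorials on the right.
prime∣C : ∀ {p} → Prime p → ∀ k → 0 < k → k < p → p ∣ (p Comb.C k)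
prime∣C {p@(suc p-1)} pp k 0<k k<p = [ id , (λ p∣ → ⊥-elim
    ([ p∤! pp k k<p , p∤! pp (p ∸ k) (ℕₚ.∸-monoʳ-< 0<k (ℕₚ.<⇒≤ k<p)) ]′ (ℕ.euclidsLemma _ _ pp p∣))) ]′
  (ℕ.euclidsLemma (p Comb.C k) (k ! * (p ∸ k) !) pp (subst (p ∣_) (sym eq) (ℕ.m∣m*n (p-1 !))))
  where
  instance _ = k ℕₚ.!* (p ∸ k) !≢0
  eq : (p Comb.C k) * (k ! * (p ∸ k) !) ≡ p !
  eq = trans (cong (_* (k ! * (p ∸ k) !)) (Comb.nCk≡n!/k![n-k]! (ℕₚ.<⇒≤ k<p)))
             (ℕ.m/n*n≡m (Comb.k![n∸k]!∣n! (ℕₚ.<⇒≤ k<p)))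

module CommutativeRingPowers {c ℓ} (A : CommutativeRing c ℓ) where
  open CommutativeRing A renaming (Carrier to X; _*_ to _·_; _+_ to _⊹_; refl to ≈-rfl; sym to ≈-symm; trans to ≈-transitive)
  open import Algebra.Properties.Semiring.Exp semiring public using (^-congˡ; ^-homo-*; ^-assocʳ) renaming (_^_ to _↑_)
  open import Algebra.Properties.CommutativeSemiring.Exp commutativeSemiring public using (^-distrib-*)
  open import Algebra.Properties.Semiring.Mult semiring public using () renaming (_×_ to _⋆_)
  open import Algebra.Properties.Semiring.Mult semiring using (×-homo-1; ×-assocˡ)
  open import Algebra.Properties.Monoid.Sum +-monoid using (sum; sum-cong-≋; sum-replicate-zero; sum-init-last)
  open import Algebra.Properties.CommutativeSemiring.Binomial commutativeSemiring as Binomial using (binomialTerm)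
  open import Algebra.Properties.Group +-group using () renaming (x∙y⁻¹≈ε⇒x≈y to x-y≈0⇒x≈y)
  open import Relation.Binary.Reasoning.Setoid setoid
  open import Data.Fin as Fin using (Fin)
  import Data.Fin.Properties as Finₚ
  open import Data.Maybe using (nothing)
  open import Tactic.RingSolver.Core.AlmostCommutativeRing using (fromCommutativeRing)
  open import Tactic.RingSolver.NonReflective (fromCommutativeRing A (λ _ → nothing))
    using (solve; _⊕_; _⊗_; Κ; _⊜_)

  1↑ : ∀ n → 1# ↑ n ≈ 1#
  1↑ zero    = ≈-rfl
  1↑ (suc n) = ≈-transitive (*-identityˡ _) (1↑ n)

  0↑ : ∀ n → 0# ↑ suc n ≈ 0#
  0↑ n = zeroˡ _

  ↑≈1⇒↑*≈1 : ∀ x m k → x ↑ m ≈ 1# → x ↑ (m * k) ≈ 1#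
  ↑≈1⇒↑*≈1 x m k e = ≈-transitive (≈-symm (^-assocʳ x m k)) (≈-transitive (^-congˡ k e) (1↑ k))

  ↑≈1⇒↑multiple≈1 : ∀ x {m n} → m ∣ n → x ↑ m ≈ 1# → x ↑ n ≈ 1#
  ↑≈1⇒↑multiple≈1 x {m} (ℕ.divides q refl) e rewrite ℕₚ.*-comm q m = ↑≈1⇒↑*≈1 x m q e

  -- Bézout's identity is used in the form gcd + j n = i m (or with m and n exchanged), which has no
  -- negative exponents.
  ↑gcd≈1 : ∀ x m n → x ↑ m ≈ 1# → x ↑ n ≈ 1# → x ↑ gcd m n ≈ 1#
  ↑gcd≈1 x m n em en with GCD.Bézout.identity (GCD.gcd-GCD m n)
  ... | GCD.Bézout.+- i j eq = begin
    x ↑ gcd m n                    ≈⟨ *-identityʳ _ ⟨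
    x ↑ gcd m n · 1#               ≈⟨ *-congˡ (↑≈1⇒↑multiple≈1 x (ℕ.n∣m*n j) en) ⟨
    x ↑ gcd m n · x ↑ (j * n)      ≈⟨ ^-homo-* x (gcd m n) (j * n) ⟨
    x ↑ (gcd m n + j * n)          ≡⟨ cong (x ↑_) eq ⟩
    x ↑ (i * m)                    ≈⟨ ↑≈1⇒↑multiple≈1 x (ℕ.n∣m*n i) em ⟩
    1#                             ∎
  ... | GCD.Bézout.-+ i j eq = begin
    x ↑ gcd m n                    ≈⟨ *-identityʳ _ ⟨
    x ↑ gcd m n · 1#               ≈⟨ *-congˡ (↑≈1⇒↑multiple≈1 x (ℕ.n∣m*n i) em) ⟨
    x ↑ gcd m n · x ↑ (i * m)      ≈⟨ ^-homo-* x (gcd m n) (i * m) ⟨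
    x ↑ (gcd m n + i * m)          ≡⟨ cong (x ↑_) eq ⟩
    x ↑ (j * n)                    ≈⟨ ↑≈1⇒↑multiple≈1 x (ℕ.n∣m*n j) en ⟩
    1#                             ∎

  freshman : ∀ {p} → Prime p → (∀ x → p ⋆ x ≈ 0#) → ∀ x y → (x ⊹ y) ↑ p ≈ x ↑ p ⊹ y ↑ p
  freshman {zero} pp char x y = ⊥-elim (ℕ.¬prime[0] pp)
  freshman {p@(suc p-1)} pp char x y = begin
    (x ⊹ y) ↑ p                                           ≈⟨ Binomial.theorem p x y ⟩
    term Fin.zero ⊹ sum (term ∘ Fin.suc)                  ≈⟨ +-congˡ (sum-init-last (term ∘ Fin.suc)) ⟩
    term Fin.zero ⊹ (sum middle ⊹ term (Fin.suc (Fin.fromℕ p-1))) ≈⟨ +-cong head (+-cong middle≈0 last≈) ⟩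
    y ↑ p ⊹ (0# ⊹ x ↑ p)                                  ≈⟨ +-congˡ (+-identityˡ _) ⟩
    y ↑ p ⊹ x ↑ p                                         ≈⟨ +-comm _ _ ⟩
    x ↑ p ⊹ y ↑ p                                         ∎
    where
    term = binomialTerm x y p
    middle : Fin p-1 → X
    middle i = term (Fin.suc (Fin.inject₁ i))
    head : term Fin.zero ≈ y ↑ p
    head = ≈-transitive (×-homo-1 _) (*-identityˡ _)
    last≈ : term (Fin.suc (Fin.fromℕ p-1)) ≈ x ↑ p
    last≈ rewrite Finₚ.toℕ-fromℕ p-1 | Comb.nCn≡1 p | ℕₚ.n∸n≡0 p-1 =
      ≈-transitive (×-homo-1 _) (*-identityʳ _)
    divisible : ∀ {k} z → p ∣ k → k ⋆ z ≈ 0#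
    divisible {k} z (ℕ.divides q refl) = begin
      (q * p) ⋆ z ≡⟨ cong (_⋆ z) (ℕₚ.*-comm q p) ⟩
      (p * q) ⋆ z ≈⟨ ×-assocˡ z p q ⟨
      p ⋆ (q ⋆ z) ≈⟨ char (q ⋆ z) ⟩
      0#          ∎
    middle≈0 : sum middle ≈ 0#
    middle≈0 = ≈-transitive (sum-cong-≋ {p-1} {middle} {λ _ → 0#} (λ i → divisible _
      (prime∣C pp (suc (Fin.toℕ (Fin.inject₁ i))) z<s
        (s≤s (subst (_< p-1) (sym (Finₚ.toℕ-inject₁ i)) (Finₚ.toℕ<n i))))))
      (sum-replicate-zero p-1)

  module _ (no-zero-divisors : ∀ x y → x · y ≈ 0# → (x ≈ 0#) ⊎ (y ≈ 0#)) (1≉0 : ¬ 1# ≈ 0#) where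

    -- The coefficients are those below the leading term 1, constant term first.
    ⟦_⟧ : ∀ {d} → Vec X d → X → X
    ⟦ [] ⟧     x = 1#
    ⟦ a ∷ as ⟧ x = a ⊹ x · ⟦ as ⟧ x

    -- Synthetic division by X - r. For f = a + X g the quotient (f - f(r)) / (X - r) is g(r) + X ·
    -- (g - g(r)) / (X - r).
    quotient : ∀ {d} → Vec X (suc d) → X → Vec X d
    quotient {zero}  (a ∷ [])     r = []
    quotient {suc d} (a ∷ b ∷ as) r = ⟦ b ∷ as ⟧ r ∷ quotient (b ∷ as) r

    -- Evaluating at r + y turns the factor X - r into y, so the identity contains no subtraction.
    quotient-eq : ∀ {d} (as : Vec X (suc d)) r y → ⟦ as ⟧ (r ⊹ y) ≈ ⟦ as ⟧ r ⊹ y · ⟦ quotient as r ⟧ (r ⊹ y)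
    quotient-eq {zero} (a ∷ []) r y = solve 3
      (λ a r y → (a ⊕ (r ⊕ y) ⊗ Κ 1#) ⊜ (a ⊕ r ⊗ Κ 1# ⊕ y ⊗ Κ 1#)) ≈-rfl a r y
    quotient-eq {suc d} (a ∷ bs@(b ∷ as)) r y = begin
      a ⊹ (r ⊹ y) · ⟦ bs ⟧ (r ⊹ y)      ≈⟨ +-congˡ (*-congˡ (quotient-eq bs r y)) ⟩
      a ⊹ (r ⊹ y) · (g ⊹ y · q)         ≈⟨ solve 5 (λ a r y g q →
        (a ⊕ (r ⊕ y) ⊗ (g ⊕ y ⊗ q)) ⊜ (a ⊕ r ⊗ g ⊕ y ⊗ (g ⊕ (r ⊕ y) ⊗ q))) ≈-rfl a r y g q ⟩
      a ⊹ r · g ⊹ y · (g ⊹ (r ⊹ y) · q) ∎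
      where
      g = ⟦ bs ⟧ r
      q = ⟦ quotient bs r ⟧ (r ⊹ y)

    ⟦⟧-cong : ∀ {d} (as : Vec X d) {x y} → x ≈ y → ⟦ as ⟧ x ≈ ⟦ as ⟧ y
    ⟦⟧-cong []       e = ≈-rfl
    ⟦⟧-cong (a ∷ as) e = +-congˡ (*-cong e (⟦⟧-cong as e))

    roots-bound : ∀ {d} (as : Vec X d) (xs : List X) → AllPairs (λ x y → ¬ x ≈ y) xs →
                  All (λ x → ⟦ as ⟧ x ≈ 0#) xs → length xs ≤ d
    roots-bound as []       _ _ = z≤n
    roots-bound {zero}  []  (x ∷ xs) _ (r ∷ _) = contradiction r 1≉0
    roots-bound {suc d} as  (x ∷ xs) (x≉ ∷ xs≉) (fx ∷ fxs) =
      s≤s (roots-bound (quotient as x) xs xs≉ (All.zipWith root (x≉ , fxs)))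
      where
      root : ∀ {y} → (¬ x ≈ y) × (⟦ as ⟧ y ≈ 0#) → ⟦ quotient as x ⟧ y ≈ 0#
      root {y} (x≉y , fy) with no-zero-divisors (y - x) (⟦ quotient as x ⟧ y) (begin
        (y - x) · ⟦ quotient as x ⟧ y               ≈⟨ +-identityˡ _ ⟨
        0# ⊹ (y - x) · ⟦ quotient as x ⟧ y          ≈⟨ +-cong fx (*-congˡ (⟦⟧-cong (quotient as x) x+[y-x]≈y)) ⟨
        ⟦ as ⟧ x ⊹ (y - x) · ⟦ quotient as x ⟧ (x ⊹ (y - x)) ≈⟨ quotient-eq as x (y - x) ⟨
        ⟦ as ⟧ (x ⊹ (y - x))                        ≈⟨ ⟦⟧-cong as x+[y-x]≈y ⟩
        ⟦ as ⟧ y                                    ≈⟨ fy ⟩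
        0#                                          ∎)
        where
        x+[y-x]≈y : x ⊹ (y - x) ≈ y
        x+[y-x]≈y = begin
          x ⊹ (y ⊹ - x) ≈⟨ +-comm x _ ⟩
          y ⊹ - x ⊹ x   ≈⟨ +-assoc y (- x) x ⟩
          y ⊹ (- x ⊹ x) ≈⟨ +-congˡ (-‿inverseˡ x) ⟩
          y ⊹ 0#        ≈⟨ +-identityʳ y ⟩
          y             ∎
      ... | inj₁ y-x≈0 = contradiction (≈-symm (x-y≈0⇒x≈y y x y-x≈0)) x≉y
      ... | inj₂ q≈0   = q≈0

    X^d : ∀ d → Vec X d
    X^d d = replicate d 0#

    ⟦X^d⟧ : ∀ d x → ⟦ X^d d ⟧ x ≈ x ↑ d
    ⟦X^d⟧ zero    x = ≈-rfl
    ⟦X^d⟧ (suc d) x = ≈-transitive (+-identityˡ _) (*-congˡ (⟦X^d⟧ d x))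

    power-roots-bound : ∀ d .{{_ : NonZero d}} a (xs : List X) → AllPairs (λ x y → ¬ x ≈ y) xs →
                        All (λ x → x ↑ d ≈ a) xs → length xs ≤ d
    power-roots-bound (suc d) a xs xs≉ h = roots-bound (- a ∷ X^d d) xs xs≉ (All.map root h)
      where
      root : ∀ {x} → x ↑ suc d ≈ a → - a ⊹ x · ⟦ X^d d ⟧ x ≈ 0#
      root {x} e = begin
        - a ⊹ x · ⟦ X^d d ⟧ x ≈⟨ +-congˡ (*-congˡ (⟦X^d⟧ d x)) ⟩
        - a ⊹ x ↑ suc d       ≈⟨ +-congˡ e ⟩
        - a ⊹ a               ≈⟨ -‿inverseˡ a ⟩
        0#                    ∎

-- The rings ℤ[x]/(x² - bx - c) modulo m

module _ {m : ℕ} where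

  -- A certificate format: a congruence follows from others as soon as x - y is a combination of
  -- their differences, and `solve-∀` checks that identity over ℤ. The multipliers `k`, `l`, `j`
  -- given in the later proofs are the coefficients of the combination.
  ≈-by₁ : ∀ k {a b x y} → a ≈ b [ m ] → x ≡ y ℤ.+ k ℤ.* (a ℤ.- b) → x ≈ y [ m ]
  ≈-by₁ k {a} {b} {x} {y} h refl = ≈-trans
    (≈-+ {a = y} ≈-refl (≈-*ˡ k (≈⇒-≈0 h)))
    (≈-reflexive (lemma y k))
    where
    lemma : ∀ y k → y ℤ.+ k ℤ.* + 0 ≡ y
    lemma = solve-∀

  ≈-by₂ : ∀ k {a b} l {c d x y} → a ≈ b [ m ] → c ≈ d [ m ] →
          x ≡ y ℤ.+ k ℤ.* (a ℤ.- b) ℤ.+ l ℤ.* (c ℤ.- d) → x ≈ y [ m ]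
  ≈-by₂ k l h h′ e = ≈-trans (≈-by₁ l h′ e) (≈-by₁ k h refl)

  ≈-by₃ : ∀ k {a b} l {c d} j {e f x y} → a ≈ b [ m ] → c ≈ d [ m ] → e ≈ f [ m ] →
          x ≡ y ℤ.+ k ℤ.* (a ℤ.- b) ℤ.+ l ℤ.* (c ℤ.- d) ℤ.+ j ℤ.* (e ℤ.- f) → x ≈ y [ m ]
  ≈-by₃ k l j h h′ h″ e = ≈-trans (≈-by₁ j h″ e) (≈-by₂ k l h h′ refl)

infix 4 _≋_[_]

record _≋_[_] (x y : ℤ × ℤ) (m : ℕ) : Set where
  constructor _∙_
  field
    x-part : proj₁ x ≈ proj₁ y [ m ]
    1-part : proj₂ x ≈ proj₂ y [ m ]

open _≋_[_] using (x-part; 1-part)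

≋-reflexive : ∀ {m x y} → proj₁ x ≡ proj₁ y → proj₂ x ≡ proj₂ y → x ≋ y [ m ]
≋-reflexive p q = ≈-reflexive p ∙ ≈-reflexive q

-- The pair (u , v) stands for u x + v with x² = b x + c.
opaque
  add : ℤ × ℤ → ℤ × ℤ → ℤ × ℤ
  add (u , v) (u′ , v′) = u ℤ.+ u′ , v ℤ.+ v′

  neg : ℤ × ℤ → ℤ × ℤ
  neg (u , v) = ℤ.- u , ℤ.- v

  mul : ℤ → ℤ → ℤ × ℤ → ℤ × ℤ → ℤ × ℤ
  mul b c (u , v) (u′ , v′) =
    u ℤ.* u′ ℤ.* b ℤ.+ u ℤ.* v′ ℤ.+ u′ ℤ.* v , u ℤ.* u′ ℤ.* c ℤ.+ v ℤ.* v′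

  -- Products stay opaque outside this block, so that powers do not unfold into polynomials in the
  -- coordinates. These two equations are the way back to coordinates.
  add-def : ∀ u v u′ v′ → add (u , v) (u′ , v′) ≡ (u ℤ.+ u′ , v ℤ.+ v′)
  add-def u v u′ v′ = refl

  mul-def : ∀ b c u v u′ v′ → mul b c (u , v) (u′ , v′) ≡
    (u ℤ.* u′ ℤ.* b ℤ.+ u ℤ.* v′ ℤ.+ u′ ℤ.* v , u ℤ.* u′ ℤ.* c ℤ.+ v ℤ.* v′)
  mul-def b c u v u′ v′ = refl

  Q-isCommutativeRing : ∀ m b c → IsCommutativeRing (λ x y → x ≋ y [ m ]) add (mul b c) neg (+ 0 , + 0) (+ 0 , + 1)
  Q-isCommutativeRing m b c = record
      { isRing = record
        { +-isAbelianGroup = record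
          { isGroup = record
            { isMonoid = record
              { isSemigroup = record
                { isMagma = record
                  { isEquivalence = record
                    { refl = ≈-refl ∙ ≈-refl
                    ; sym = λ (p ∙ q) → ≈-sym p ∙ ≈-sym q
                    ; trans = λ (p ∙ q) (p′ ∙ q′) → ≈-trans p p′ ∙ ≈-trans q q′ }
                  ; ∙-cong = λ (p ∙ q) (p′ ∙ q′) → ≈-+ p p′ ∙ ≈-+ q q′ }
                ; assoc = λ (u , v) (u′ , v′) (u″ , v″) →
                    ≋-reflexive (ℤₚ.+-assoc u u′ u″) (ℤₚ.+-assoc v v′ v″) }
              ; identity = (λ (u , v) → ≋-reflexive (ℤₚ.+-identityˡ u) (ℤₚ.+-identityˡ v))
                         , (λ (u , v) → ≋-reflexive (ℤₚ.+-identityʳ u) (ℤₚ.+-identityʳ v)) }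
            ; inverse = (λ (u , v) → ≋-reflexive (ℤₚ.+-inverseˡ u) (ℤₚ.+-inverseˡ v))
                      , (λ (u , v) → ≋-reflexive (ℤₚ.+-inverseʳ u) (ℤₚ.+-inverseʳ v))
            ; ⁻¹-cong = λ (p ∙ q) → ≈-neg p ∙ ≈-neg q }
          ; comm = λ (u , v) (u′ , v′) → ≋-reflexive (ℤₚ.+-comm u u′) (ℤₚ.+-comm v v′) }
        ; *-cong = λ {x} {y} {x′} {y′} (p ∙ q) (p′ ∙ q′) →
            ≈-+ {a = proj₁ x ℤ.* proj₁ x′ ℤ.* b ℤ.+ proj₁ x ℤ.* proj₂ x′}
                (≈-+ {a = proj₁ x ℤ.* proj₁ x′ ℤ.* b} (≈-*ʳ b (≈-* p p′)) (≈-* p q′)) (≈-* p′ q)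
          ∙ ≈-+ {a = proj₁ x ℤ.* proj₁ x′ ℤ.* c} (≈-*ʳ c (≈-* p p′)) (≈-* q q′)
        ; *-assoc = λ (u , v) (u′ , v′) (u″ , v″) →
            ≋-reflexive (assoc₁ b c u v u′ v′ u″ v″) (assoc₂ b c u v u′ v′ u″ v″)
        ; *-identity = (λ (u , v) → ≋-reflexive (idˡ₁ b u v) (idˡ₂ c u v))
                     , (λ (u , v) → ≋-reflexive (idʳ₁ b u v) (idʳ₂ c u v))
        ; distrib = (λ (u , v) (u′ , v′) (u″ , v″) →
                       ≋-reflexive (distribˡ₁ b u v u′ v′ u″ v″) (distribˡ₂ c u v u′ v′ u″ v″))
                  , (λ (u , v) (u′ , v′) (u″ , v″) →
                       ≋-reflexive (distribʳ₁ b u v u′ v′ u″ v″) (distribʳ₂ c u v u′ v′ u″ v″)) }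
      ; *-comm = λ (u , v) (u′ , v′) → ≋-reflexive (comm₁ b u v u′ v′) (comm₂ c u v u′ v′) }
    where
    assoc₁ : ∀ b c u v u′ v′ u″ v″ →
      let U = u ℤ.* u′ ℤ.* b ℤ.+ u ℤ.* v′ ℤ.+ u′ ℤ.* v; V = u ℤ.* u′ ℤ.* c ℤ.+ v ℤ.* v′
          U′ = u′ ℤ.* u″ ℤ.* b ℤ.+ u′ ℤ.* v″ ℤ.+ u″ ℤ.* v′; V′ = u′ ℤ.* u″ ℤ.* c ℤ.+ v′ ℤ.* v″
      in U ℤ.* u″ ℤ.* b ℤ.+ U ℤ.* v″ ℤ.+ u″ ℤ.* V ≡ u ℤ.* U′ ℤ.* b ℤ.+ u ℤ.* V′ ℤ.+ U′ ℤ.* v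
    assoc₁ = solve-∀
    assoc₂ : ∀ b c u v u′ v′ u″ v″ →
      let U = u ℤ.* u′ ℤ.* b ℤ.+ u ℤ.* v′ ℤ.+ u′ ℤ.* v; V = u ℤ.* u′ ℤ.* c ℤ.+ v ℤ.* v′
          U′ = u′ ℤ.* u″ ℤ.* b ℤ.+ u′ ℤ.* v″ ℤ.+ u″ ℤ.* v′; V′ = u′ ℤ.* u″ ℤ.* c ℤ.+ v′ ℤ.* v″
      in U ℤ.* u″ ℤ.* c ℤ.+ V ℤ.* v″ ≡ u ℤ.* U′ ℤ.* c ℤ.+ v ℤ.* V′
    assoc₂ = solve-∀
    idˡ₁ : ∀ b u v → + 0 ℤ.* u ℤ.* b ℤ.+ + 0 ℤ.* v ℤ.+ u ℤ.* + 1 ≡ u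
    idˡ₁ = solve-∀
    idˡ₂ : ∀ c u v → + 0 ℤ.* u ℤ.* c ℤ.+ + 1 ℤ.* v ≡ v
    idˡ₂ = solve-∀
    idʳ₁ : ∀ b u v → u ℤ.* + 0 ℤ.* b ℤ.+ u ℤ.* + 1 ℤ.+ + 0 ℤ.* v ≡ u
    idʳ₁ = solve-∀
    idʳ₂ : ∀ c u v → u ℤ.* + 0 ℤ.* c ℤ.+ v ℤ.* + 1 ≡ v
    idʳ₂ = solve-∀
    distribˡ₁ : ∀ b u v u′ v′ u″ v″ →
      u ℤ.* (u′ ℤ.+ u″) ℤ.* b ℤ.+ u ℤ.* (v′ ℤ.+ v″) ℤ.+ (u′ ℤ.+ u″) ℤ.* v
      ≡ (u ℤ.* u′ ℤ.* b ℤ.+ u ℤ.* v′ ℤ.+ u′ ℤ.* v) ℤ.+ (u ℤ.* u″ ℤ.* b ℤ.+ u ℤ.* v″ ℤ.+ u″ ℤ.* v)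
    distribˡ₁ = solve-∀
    distribˡ₂ : ∀ c u v u′ v′ u″ v″ →
      u ℤ.* (u′ ℤ.+ u″) ℤ.* c ℤ.+ v ℤ.* (v′ ℤ.+ v″)
      ≡ (u ℤ.* u′ ℤ.* c ℤ.+ v ℤ.* v′) ℤ.+ (u ℤ.* u″ ℤ.* c ℤ.+ v ℤ.* v″)
    distribˡ₂ = solve-∀
    distribʳ₁ : ∀ b u v u′ v′ u″ v″ →
      (u′ ℤ.+ u″) ℤ.* u ℤ.* b ℤ.+ (u′ ℤ.+ u″) ℤ.* v ℤ.+ u ℤ.* (v′ ℤ.+ v″)
      ≡ (u′ ℤ.* u ℤ.* b ℤ.+ u′ ℤ.* v ℤ.+ u ℤ.* v′) ℤ.+ (u″ ℤ.* u ℤ.* b ℤ.+ u″ ℤ.* v ℤ.+ u ℤ.* v″)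
    distribʳ₁ = solve-∀
    distribʳ₂ : ∀ c u v u′ v′ u″ v″ →
      (u′ ℤ.+ u″) ℤ.* u ℤ.* c ℤ.+ (v′ ℤ.+ v″) ℤ.* v
      ≡ (u′ ℤ.* u ℤ.* c ℤ.+ v′ ℤ.* v) ℤ.+ (u″ ℤ.* u ℤ.* c ℤ.+ v″ ℤ.* v)
    distribʳ₂ = solve-∀
    comm₁ : ∀ b u v u′ v′ → u ℤ.* u′ ℤ.* b ℤ.+ u ℤ.* v′ ℤ.+ u′ ℤ.* v ≡ u′ ℤ.* u ℤ.* b ℤ.+ u′ ℤ.* v ℤ.+ u ℤ.* v′
    comm₁ = solve-∀
    comm₂ : ∀ c u v u′ v′ → u ℤ.* u′ ℤ.* c ℤ.+ v ℤ.* v′ ≡ u′ ℤ.* u ℤ.* c ℤ.+ v′ ℤ.* v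
    comm₂ = solve-∀

Q : ℕ → ℤ → ℤ → CommutativeRing 0ℓ 0ℓ
Q m b c = record
  { Carrier = ℤ × ℤ
  ; _≈_ = λ x y → x ≋ y [ m ]
  ; _+_ = add
  ; _*_ = mul b c
  ; -_  = neg
  ; 0#  = + 0 , + 0
  ; 1#  = + 0 , + 1
  ; isCommutativeRing = Q-isCommutativeRing m b c }

module Quadratic (m : ℕ) (b c : ℤ) where
  open CommutativeRing (Q m b c) public using ()
    renaming (_*_ to _·_; _+_ to _⊹_; -_ to ⊝_; 0# to 𝟘; 1# to 𝟙; refl to ≋-refl; sym to ≋-sym; trans to ≋-trans; setoid to ≋-setoid;
              *-cong to ·-cong; *-comm to ·-comm; *-assoc to ·-assoc; +-cong to ⊹-cong; *-identityˡ to ·-identityˡ; *-identityʳ to ·-identityʳ)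
  open CommutativeRingPowers (Q m b c) public

  gen : ℤ × ℤ
  gen = + 1 , + 0

  const : ℤ → ℤ × ℤ
  const v = + 0 , v

  const-cong : ∀ {v w} → v ≈ w [ m ] → const v ≋ const w [ m ]
  const-cong p = ≈-refl ∙ p

  const-* : ∀ v w → const v · const w ≋ const (v ℤ.* w) [ m ]
  const-* v w rewrite mul-def b c (+ 0) v (+ 0) w = ≋-reflexive (lemma₁ b v w) (lemma₂ c v w)
    where
    lemma₁ : ∀ b v w → + 0 ℤ.* + 0 ℤ.* b ℤ.+ + 0 ℤ.* w ℤ.+ + 0 ℤ.* v ≡ + 0
    lemma₁ = solve-∀
    lemma₂ : ∀ c v w → + 0 ℤ.* + 0 ℤ.* c ℤ.+ v ℤ.* w ≡ v ℤ.* w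
    lemma₂ = solve-∀

  const-↑ : ∀ v k → const v ↑ k ≋ const (v ℤ.^ k) [ m ]
  const-↑ v zero    = ≋-refl
  const-↑ v (suc k) = ≋-trans (·-cong ≋-refl (const-↑ v k)) (const-* v (v ℤ.^ k))

-- The ring homomorphism x ↦ θ, defined because θ is a root of x² - bx - c in the target ring.
-- Depending on θ it reduces modulo a divisor (θ = x), replaces the parameters by congruent ones,
-- passes to the field of √D, evaluates at a root in ℤ/p (θ constant), or rescales the generator (θ
-- = μ x).
module Evaluation (m : ℕ) (b c : ℤ) (d : ℕ) (b′ c′ : ℤ) (d∣m : d ∣ m) (θ : ℤ × ℤ)
  (root : mul b′ c′ θ θ ≋ (b ℤ.* proj₁ θ , b ℤ.* proj₂ θ ℤ.+ c) [ d ]) where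

  private
    module S = Quadratic m b c
    module T = Quadratic d b′ c′
    t = proj₁ θ
    w = proj₂ θ
    root′ = subst (_≋ (b ℤ.* proj₁ θ , b ℤ.* proj₂ θ ℤ.+ c) [ d ]) (mul-def b′ c′ t w t w) root

  eval : ℤ × ℤ → ℤ × ℤ
  eval (u , v) = u ℤ.* t , u ℤ.* w ℤ.+ v

  eval-cong : ∀ {x y} → x ≋ y [ m ] → eval x ≋ eval y [ d ]
  eval-cong {x} {y} (p ∙ q) = ≈-*ʳ t (≈-weaken d∣m p)
    ∙ ≈-+ {a = proj₁ x ℤ.* w} (≈-*ʳ w (≈-weaken d∣m p)) (≈-weaken d∣m q)

  eval-const : ∀ v → eval (S.const v) ≋ T.const v [ d ]
  eval-const v = ≋-reflexive (lemma₁ t) (lemma₂ w v)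
    where
    lemma₁ : ∀ t → + 0 ℤ.* t ≡ + 0
    lemma₁ = solve-∀
    lemma₂ : ∀ w v → + 0 ℤ.* w ℤ.+ v ≡ v
    lemma₂ = solve-∀

  eval-gen : eval S.gen ≋ θ [ d ]
  eval-gen = ≋-reflexive (lemma₁ t) (lemma₂ w)
    where
    lemma₁ : ∀ t → + 1 ℤ.* t ≡ t
    lemma₁ = solve-∀
    lemma₂ : ∀ w → + 1 ℤ.* w ℤ.+ + 0 ≡ w
    lemma₂ = solve-∀

  eval-* : ∀ x y → eval (x S.· y) ≋ eval x T.· eval y [ d ]
  eval-* (u , v) (u′ , v′)
    rewrite mul-def b c u v u′ v′
          | mul-def b′ c′ (u ℤ.* t) (u ℤ.* w ℤ.+ v) (u′ ℤ.* t) (u′ ℤ.* w ℤ.+ v′) =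
      ≈-by₁ (ℤ.- (u ℤ.* u′)) (x-part root′) (lemma₁ b c b′ t w u v u′ v′)
    ∙ ≈-by₁ (ℤ.- (u ℤ.* u′)) (1-part root′) (lemma₂ b c c′ t w u v u′ v′)
    where
    lemma₁ : ∀ b c b′ t w u v u′ v′ →
      (u ℤ.* u′ ℤ.* b ℤ.+ u ℤ.* v′ ℤ.+ u′ ℤ.* v) ℤ.* t ≡
      (u ℤ.* t) ℤ.* (u′ ℤ.* t) ℤ.* b′ ℤ.+ (u ℤ.* t) ℤ.* (u′ ℤ.* w ℤ.+ v′) ℤ.+ (u′ ℤ.* t) ℤ.* (u ℤ.* w ℤ.+ v)
      ℤ.+ ℤ.- (u ℤ.* u′) ℤ.* (t ℤ.* t ℤ.* b′ ℤ.+ t ℤ.* w ℤ.+ t ℤ.* w ℤ.- b ℤ.* t)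
    lemma₁ = solve-∀
    lemma₂ : ∀ b c c′ t w u v u′ v′ →
      (u ℤ.* u′ ℤ.* b ℤ.+ u ℤ.* v′ ℤ.+ u′ ℤ.* v) ℤ.* w ℤ.+ (u ℤ.* u′ ℤ.* c ℤ.+ v ℤ.* v′) ≡
      (u ℤ.* t) ℤ.* (u′ ℤ.* t) ℤ.* c′ ℤ.+ (u ℤ.* w ℤ.+ v) ℤ.* (u′ ℤ.* w ℤ.+ v′)
      ℤ.+ ℤ.- (u ℤ.* u′) ℤ.* (t ℤ.* t ℤ.* c′ ℤ.+ w ℤ.* w ℤ.- (b ℤ.* w ℤ.+ c))
    lemma₂ = solve-∀

  eval-↑ : ∀ x k → eval (x S.↑ k) ≋ eval x T.↑ k [ d ]
  eval-↑ x zero    = eval-const (+ 1)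
  eval-↑ x (suc k) = T.≋-trans (eval-* x (x S.↑ k)) (T.·-cong T.≋-refl (eval-↑ x k))

  eval-gen-↑ : ∀ k → eval (S.gen S.↑ k) ≋ θ T.↑ k [ d ]
  eval-gen-↑ k = T.≋-trans (eval-↑ S.gen k) (T.^-congˡ k eval-gen)

  power-at-root : ∀ k {v} → S.gen S.↑ k ≋ S.const v [ m ] → θ T.↑ k ≋ T.const v [ d ]
  power-at-root k {v} e = T.≋-trans (T.≋-sym (eval-gen-↑ k)) (T.≋-trans (eval-cong e) (eval-const v))

Unique⇒AllPairs : {A : Set} {R : A → A → Set} (xs : List A) → Unique xs →
                  (∀ {x y} → x ∈ xs → y ∈ xs → x ≢ y → R x y) → AllPairs R xs
Unique⇒AllPairs []       _            h = []
Unique⇒AllPairs (x ∷ xs) (x∉ ∷ xs!) h =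
  All.tabulate (λ y∈ → h (here refl) (there y∈) (All.lookup x∉ y∈))
  ∷ Unique⇒AllPairs xs xs! (λ p q → h (there p) (there q))

embed : ℕ × ℕ → ℤ × ℤ
embed (i , j) = + i , + j

embed-injective : ∀ {m x y} → x ∈ residuePairs m → y ∈ residuePairs m → embed x ≋ embed y [ m ] → x ≡ y
embed-injective x∈ y∈ (p ∙ q) =
  let a , b = ∈-residuePairs⇒< x∈ ; c , d = ∈-residuePairs⇒< y∈
  in cong₂ _,_ (residue-unique a c p) (residue-unique b d q)

infix 4 _≋?_

_≋?_ : ∀ {m} x y → Dec (x ≋ y [ m ])
(u , v) ≋? (u′ , v′) = map′ (λ (p , q) → p ∙ q) (λ (p ∙ q) → p , q)
  ((u ≈? u′) ×-dec (v ≈? v′))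

-- Frobenius and the field with p² elements

module QuadraticPrime (p : ℕ) (pp : Prime p) (b c : ℤ) where
  open Quadratic p b c

  instance
    p≢0 : NonZero p
    p≢0 = ℕ.prime⇒nonZero pp

  ⋆-def : ∀ k u v → k ⋆ (u , v) ≋ (+ k ℤ.* u , + k ℤ.* v) [ p ]
  ⋆-def zero    u v = ≋-reflexive (sym (ℤₚ.*-zeroˡ u)) (sym (ℤₚ.*-zeroˡ v))
  ⋆-def (suc k) u v = ≋-trans (⊹-cong ≋-refl (⋆-def k u v))
    (subst (_≋ (+ suc k ℤ.* u , + suc k ℤ.* v) [ p ]) (sym (add-def u v (+ k ℤ.* u) (+ k ℤ.* v)))
      (≋-reflexive (lemma k u) (lemma k v)))
    where
    lemma : ∀ k u → u ℤ.+ + k ℤ.* u ≡ + suc k ℤ.* u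
    lemma k u = sym (ℤₚ.suc-* (+ k) u)

  characteristic : ∀ x → p ⋆ x ≋ 𝟘 [ p ]
  characteristic (u , v) = ≋-trans (⋆-def p u v) (p≈0 u ∙ p≈0 v)
    where
    p≈0 : ∀ u → + p ℤ.* u ≈ + 0 [ p ]
    p≈0 u = congruent u (trans (ℤₚ.*-comm (+ p) u) (sym (ℤₚ.+-identityˡ _)))

  frobenius-+ : ∀ x y → (x ⊹ y) ↑ p ≋ x ↑ p ⊹ y ↑ p [ p ]
  frobenius-+ = freshman pp characteristic

  -- Induction on k by additivity of the p-th power: (1 + k)^p = 1 + k^p.
  fermat-ℕ : ∀ k → const (+ k) ↑ p ≋ const (+ k) [ p ]
  fermat-ℕ zero    = subst (λ j → const (+ 0) ↑ j ≋ const (+ 0) [ p ]) (ℕₚ.suc-pred p) (0↑ (pred p))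
  fermat-ℕ (suc k) = begin
    const (+ suc k) ↑ p             ≡⟨ cong (_↑ p) (add-def (+ 0) (+ 1) (+ 0) (+ k)) ⟨
    (𝟙 ⊹ const (+ k)) ↑ p           ≈⟨ frobenius-+ 𝟙 (const (+ k)) ⟩
    𝟙 ↑ p ⊹ const (+ k) ↑ p         ≈⟨ ⊹-cong (1↑ p) (fermat-ℕ k) ⟩
    𝟙 ⊹ const (+ k)                 ≡⟨ add-def (+ 0) (+ 1) (+ 0) (+ k) ⟩
    const (+ suc k)                 ∎
    where open import Relation.Binary.Reasoning.Setoid ≋-setoid

  fermat : ∀ a → const a ↑ p ≋ const a [ p ]
  fermat a = ≋-trans (^-congˡ p (const-cong (≈-sym (residue≈ p a))))
    (≋-trans (fermat-ℕ (residue p a)) (const-cong (residue≈ p a)))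

fermat-ℤ : ∀ {p} → Prime p → ∀ a → a ℤ.^ p ≈ a [ p ]
fermat-ℤ {p} pp a = 1-part (≋-trans (≋-sym (const-↑ a p)) (QuadraticPrime.fermat p pp (+ 0) (+ 0) a))
  where open Quadratic p (+ 0) (+ 0)

fermat-unit : ∀ {p} → Prime p → ∀ {a} → ¬ a ≈ + 0 [ p ] → a ℤ.^ (p ∸ 1) ≈ + 1 [ p ]
fermat-unit {zero}    pp = ⊥-elim (ℕ.¬prime[0] pp)
fermat-unit {p@(suc k)} pp {a} a≉0 = ≈-cancelˡ a pp a≉0
  (≈-trans (fermat-ℤ pp a) (≈-reflexive (sym (ℤₚ.*-identityʳ a))))

-- Since x² - D is irreducible modulo p, the ring is the field with p² elements, and `gen` is √D.
module NonresidueField (p : ℕ) (pp : Prime p) (h : ℕ) (p≡1+2h : p ≡ suc (2 * h)) (D : ℤ)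
  (nonresidue : ∀ y → ¬ y ℤ.* y ≈ D [ p ]) where
  open Quadratic p (+ 0) D
  open QuadraticPrime p pp (+ 0) D
  open import Relation.Binary.Reasoning.Setoid ≋-setoid

  mul₀ : ∀ u v u′ v′ → (u , v) · (u′ , v′) ≋ (u ℤ.* v′ ℤ.+ u′ ℤ.* v , u ℤ.* u′ ℤ.* D ℤ.+ v ℤ.* v′) [ p ]
  mul₀ u v u′ v′ rewrite mul-def (+ 0) D u v u′ v′ = ≋-reflexive (lemma u v u′ v′) refl
    where
    lemma : ∀ u v u′ v′ → u ℤ.* u′ ℤ.* + 0 ℤ.+ u ℤ.* v′ ℤ.+ u′ ℤ.* v ≡ u ℤ.* v′ ℤ.+ u′ ℤ.* v
    lemma = solve-∀

  D≉0 : ¬ D ≈ + 0 [ p ]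
  D≉0 D≈0 = nonresidue (+ 0) (≈-sym D≈0)

  1≉0 : ¬ + 1 ≈ + 0 [ p ]
  1≉0 1≈0 = ℕ.¬prime[1] (subst Prime (ℕ.∣1⇒≡1 (≈0⇒∣ 1≈0)) pp)

  -- An element of norm zero with u ≠ 0 would make v / u a square root of D.
  norm≈0 : ∀ {u v} → v ℤ.* v ℤ.- D ℤ.* (u ℤ.* u) ≈ + 0 [ p ] → (u , v) ≋ 𝟘 [ p ]
  norm≈0 {u} {v} N≈0 with u ≈? + 0
  ... | yes u≈0 = u≈0 ∙ [ id , id ]′ (≈-prime pp (≈-by₂ (+ 1) (D ℤ.* u) N≈0 u≈0 (lemma u v D)))
    where
    lemma : ∀ u v D → v ℤ.* v ≡ + 0 ℤ.+ + 1 ℤ.* (v ℤ.* v ℤ.- D ℤ.* (u ℤ.* u) ℤ.- + 0) ℤ.+ D ℤ.* u ℤ.* (u ℤ.- + 0)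
    lemma = solve-∀
  ... | no u≉0 = let i , ui≈1 = ≈-inverse pp u≉0 in ⊥-elim (nonresidue (v ℤ.* i)
      (≈-by₂ (i ℤ.* i) (D ℤ.* (u ℤ.* i ℤ.+ + 1)) N≈0 ui≈1 (lemma u v D i)))
    where
    lemma : ∀ u v D i → v ℤ.* i ℤ.* (v ℤ.* i) ≡ D
      ℤ.+ i ℤ.* i ℤ.* (v ℤ.* v ℤ.- D ℤ.* (u ℤ.* u) ℤ.- + 0)
      ℤ.+ D ℤ.* (u ℤ.* i ℤ.+ + 1) ℤ.* (u ℤ.* i ℤ.- + 1)
    lemma = solve-∀

  -- The norm v² - D u² is multiplicative, so a vanishing product makes one of the two norms vanish.
  no-zero-divisors : ∀ x y → x · y ≋ 𝟘 [ p ] → x ≋ 𝟘 [ p ] ⊎ y ≋ 𝟘 [ p ]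
  no-zero-divisors (u , v) (u′ , v′) e =
    [ inj₁ ∘ norm≈0 , inj₂ ∘ norm≈0 ]′ (≈-prime pp
      (≈-by₂ (u ℤ.* u′ ℤ.* D ℤ.+ v ℤ.* v′) (ℤ.- (D ℤ.* (u ℤ.* v′ ℤ.+ u′ ℤ.* v)))
        (1-part e′) (x-part e′) (lemma u v u′ v′ D)))
    where
    e′ = ≋-trans (≋-sym (mul₀ u v u′ v′)) e
    lemma : ∀ u v u′ v′ D →
      (v ℤ.* v ℤ.- D ℤ.* (u ℤ.* u)) ℤ.* (v′ ℤ.* v′ ℤ.- D ℤ.* (u′ ℤ.* u′)) ≡ + 0
      ℤ.+ (u ℤ.* u′ ℤ.* D ℤ.+ v ℤ.* v′) ℤ.* (u ℤ.* u′ ℤ.* D ℤ.+ v ℤ.* v′ ℤ.- + 0)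
      ℤ.+ ℤ.- (D ℤ.* (u ℤ.* v′ ℤ.+ u′ ℤ.* v)) ℤ.* (u ℤ.* v′ ℤ.+ u′ ℤ.* v ℤ.- + 0)
    lemma = solve-∀

  𝟙≉𝟘 : ¬ 𝟙 ≋ 𝟘 [ p ]
  𝟙≉𝟘 (_ ∙ 1≈0) = 1≉0 1≈0

  ·-cancelˡ : ∀ x y z → ¬ x ≋ 𝟘 [ p ] → x · y ≋ x · z [ p ] → y ≋ z [ p ]
  ·-cancelˡ x y z x≉0 e = [ (λ x≈0 → contradiction x≈0 x≉0) , (λ d → x∙y⁻¹≈ε⇒x≈y y z d) ]′
    (no-zero-divisors x (y ⊹ ⊝ z) (≋-trans (x[y-z]≈xy-xz x y z) (x≈y⇒x∙y⁻¹≈ε e)))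
    where
    open CommutativeRing (Q p (+ 0) D) using (ring; +-group)
    open import Algebra.Properties.Ring ring using (x[y-z]≈xy-xz)
    open import Algebra.Properties.Group +-group using (x∙y⁻¹≈ε⇒x≈y; x≈y⇒x∙y⁻¹≈ε)

  split-parts : ∀ u v → (u , v) ≋ const u · gen ⊹ const v [ p ]
  split-parts u v = begin
    u , v                            ≈⟨ ≋-reflexive (lemma₁ u) (lemma₂ u v D) ⟩
    (+ 0 ℤ.* + 0 ℤ.+ + 1 ℤ.* u) ℤ.+ + 0 , (+ 0 ℤ.* + 1 ℤ.* D ℤ.+ u ℤ.* + 0) ℤ.+ v ≡⟨ add-def _ _ (+ 0) v ⟨
    (+ 0 ℤ.* + 0 ℤ.+ + 1 ℤ.* u , + 0 ℤ.* + 1 ℤ.* D ℤ.+ u ℤ.* + 0) ⊹ const v ≈⟨ ⊹-cong (mul₀ (+ 0) u (+ 1) (+ 0)) ≋-refl ⟨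
    const u · gen ⊹ const v          ∎
    where
    lemma₁ : ∀ u → u ≡ (+ 0 ℤ.* + 0 ℤ.+ + 1 ℤ.* u) ℤ.+ + 0
    lemma₁ = solve-∀
    lemma₂ : ∀ u v D → v ≡ (+ 0 ℤ.* + 1 ℤ.* D ℤ.+ u ℤ.* + 0) ℤ.+ v
    lemma₂ = solve-∀

  -- D^((p - 1) / 2), the quantity of Euler's criterion. It measures the action of Frobenius: (√D)^p
  -- = ε √D.
  ε : ℤ
  ε = D ℤ.^ h

  gen↑p : gen ↑ p ≋ const ε · gen [ p ]
  gen↑p = begin
    gen ↑ p                    ≡⟨ cong (gen ↑_) p≡1+2h ⟩
    gen · gen ↑ (2 * h)        ≈⟨ ·-cong ≋-refl (^-assocʳ gen 2 h) ⟨
    gen · (gen ↑ 2) ↑ h        ≈⟨ ·-cong ≋-refl (^-congˡ h square) ⟩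
    gen · const D ↑ h          ≈⟨ ·-cong ≋-refl (const-↑ D h) ⟩
    gen · const ε              ≈⟨ ·-comm gen (const ε) ⟩
    const ε · gen              ∎
    where
    lemma : ∀ D → + 1 ℤ.* + 1 ℤ.* D ℤ.+ + 0 ℤ.* + 0 ≡ D
    lemma = solve-∀
    square : gen ↑ 2 ≋ const D [ p ]
    square = begin
      gen · (gen · 𝟙) ≈⟨ ·-cong ≋-refl (·-identityʳ gen) ⟩
      gen · gen       ≈⟨ mul₀ (+ 1) (+ 0) (+ 1) (+ 0) ⟩
      _               ≈⟨ ≋-reflexive refl (lemma D) ⟩
      const D         ∎

  ↑p : ∀ u v → (u , v) ↑ p ≋ (u ℤ.* ε , v) [ p ]
  ↑p u v = begin
    (u , v) ↑ p                              ≈⟨ ^-congˡ p (split-parts u v) ⟩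
    (const u · gen ⊹ const v) ↑ p            ≈⟨ frobenius-+ (const u · gen) (const v) ⟩
    (const u · gen) ↑ p ⊹ const v ↑ p        ≈⟨ ⊹-cong (^-distrib-* (const u) gen p) (fermat v) ⟩
    const u ↑ p · gen ↑ p ⊹ const v          ≈⟨ ⊹-cong (·-cong (fermat u) gen↑p) ≋-refl ⟩
    const u · (const ε · gen) ⊹ const v      ≈⟨ ⊹-cong (·-assoc (const u) (const ε) gen) ≋-refl ⟨
    const u · const ε · gen ⊹ const v        ≈⟨ ⊹-cong (·-cong (const-* u ε) ≋-refl) ≋-refl ⟩
    const (u ℤ.* ε) · gen ⊹ const v          ≈⟨ split-parts (u ℤ.* ε) v ⟨
    (u ℤ.* ε , v)                            ∎

  ε²≈1 : ε ℤ.* ε ≈ + 1 [ p ]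
  ε²≈1 = ≈-cancelˡ D pp D≉0 (≈-trans (≈-reflexive eq) (≈-trans (fermat-ℤ pp D)
    (≈-reflexive (sym (ℤₚ.*-identityʳ D)))))
    where
    eq : D ℤ.* (ε ℤ.* ε) ≡ D ℤ.^ p
    eq = trans (cong (D ℤ.*_) (trans (sym (ℤₚ.^-distribˡ-+-* D h h)) (cong (D ℤ.^_) (cong (λ z → h + z) (sym (ℕₚ.+-identityʳ h))))))
               (cong (D ℤ.^_) (sym p≡1+2h))

  ↑p≋⇒↑p-1≋𝟙 : ∀ x → ¬ x ≋ 𝟘 [ p ] → x ↑ p ≋ x [ p ] → x ↑ (2 * h) ≋ 𝟙 [ p ]
  ↑p≋⇒↑p-1≋𝟙 x x≉0 e = ·-cancelˡ x _ _ x≉0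
    (≋-trans (subst (λ k → x ↑ k ≋ x [ p ]) p≡1+2h e) (≋-sym (·-identityʳ x)))

  h≢0 : NonZero h
  h≢0 = ≢-nonZero λ h≡0 → ℕ.¬prime[1] (subst Prime (trans p≡1+2h (cong (λ h → suc (2 * h)) h≡0)) pp)

  -- Otherwise all √D + v with v < p would be roots of X^(p-1) = 1.
  ε≉1 : ¬ ε ≈ + 1 [ p ]
  ε≉1 ε≈1 = ℕₚ.<⇒≱ (ℕₚ.n<1+n (2 * h)) (subst (_≤ 2 * h) (trans (Listₚ.length-applyUpTo f p) p≡1+2h)
    (power-roots-bound no-zero-divisors 𝟙≉𝟘 (2 * h) {{ℕₚ.m*n≢0 2 h {{_}} {{h≢0}}}} 𝟙 (applyUpTo f p)
      (AllPairsₚ.applyUpTo⁺₁ f p λ i<j j<p e →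
        ℕₚ.<⇒≢ i<j (residue-unique (ℕₚ.<-trans i<j j<p) j<p (1-part e)))
      (Allₚ.applyUpTo⁺₁ f p λ {v} _ → ↑p≋⇒↑p-1≋𝟙 (f v) (1≉0 ∘ x-part)
        (≋-trans (↑p (+ 1) (+ v)) (≈-trans (≈-*ˡ (+ 1) ε≈1) ≈-refl ∙ ≈-refl)))))
    where
    f : ℕ → ℤ × ℤ
    f v = + 1 , + v

  ε≈-1 : ε ≈ -[1+ 0 ] [ p ]
  ε≈-1 = [ (λ e → contradiction (-≈0⇒≈ e) ε≉1) , -≈0⇒≈ ]′
    (≈-prime {a = ε ℤ.- + 1} {ε ℤ.- -[1+ 0 ]} pp (≈-by₁ (+ 1) ε²≈1 (lemma ε)))
    where
    lemma : ∀ e → (e ℤ.- + 1) ℤ.* (e ℤ.- -[1+ 0 ]) ≡ + 0 ℤ.+ + 1 ℤ.* (e ℤ.* e ℤ.- + 1)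
    lemma = solve-∀

  frobenius : ∀ u v → (u , v) ↑ p ≋ (ℤ.- u , v) [ p ]
  frobenius u v = ≋-trans (↑p u v) (≈-trans (≈-*ˡ u ε≈-1) (≈-reflexive (lemma u)) ∙ ≈-refl)
    where
    lemma : ∀ u → u ℤ.* -[1+ 0 ] ≡ ℤ.- u
    lemma = solve-∀

  ↑p²≋id : ∀ x → x ↑ (p * p) ≋ x [ p ]
  ↑p²≋id (u , v) = begin
    (u , v) ↑ (p * p)    ≈⟨ ^-assocʳ (u , v) p p ⟨
    ((u , v) ↑ p) ↑ p    ≈⟨ ^-congˡ p (frobenius u v) ⟩
    (ℤ.- u , v) ↑ p      ≈⟨ frobenius (ℤ.- u) v ⟩
    (ℤ.- ℤ.- u , v)      ≈⟨ ≋-reflexive (ℤₚ.neg-involutive u) refl ⟩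
    (u , v)              ∎

  ↑[p²-1]≋𝟙 : ∀ x → ¬ x ≋ 𝟘 [ p ] → x ↑ (p * p ∸ 1) ≋ 𝟙 [ p ]
  ↑[p²-1]≋𝟙 x x≉0 = ·-cancelˡ x _ _ x≉0 (≋-trans
    (subst (λ k → x ↑ k ≋ x [ p ]) (sym (ℕₚ.m+[n∸m]≡n {1} (>-nonZero⁻¹ (p * p) {{ℕₚ.m*n≢0 p p}}))) (↑p²≋id x))
    (≋-sym (·-identityʳ x)))

  count-power-roots : ∀ d .{{_ : NonZero d}} a →
                      ∑ (residuePairs p) (λ x → ind (_≋?_ {p} (embed x ↑ d) a)) ≤ d
  count-power-roots d a = subst (_≤ d) (trans (Listₚ.length-map embed (filter P? (residuePairs p))) (length-filter-∑ P? (residuePairs p)))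
    (power-roots-bound no-zero-divisors 𝟙≉𝟘 d a (map embed (filter P? (residuePairs p)))
      (AllPairsₚ.map⁺ (AllPairsₚ.filter⁺ P? (Unique⇒AllPairs (residuePairs p) (residuePairs! p)
        (λ x∈ y∈ x≢y e → x≢y (embed-injective x∈ y∈ e)))))
      (Allₚ.map⁺ (Allₚ.all-filter P? (residuePairs p))))
    where
    P? : ∀ x → Dec (embed x ↑ d ≋ a [ p ])
    P? x = (embed x ↑ d) ≋? a

-- Legendre symbols

mod≡% : ∀ a m .{{_ : NonZero m}} → a mod m ≡ a % m
mod≡% a (suc m) = refl

0mod≡0 : ∀ m .{{_ : NonZero m}} → 0 mod m ≡ 0
0mod≡0 m = trans (mod≡% 0 m) (ℕ.m<n⇒m%n≡m (>-nonZero⁻¹ m))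

mod≈ : ∀ a m .{{_ : NonZero m}} → + (a mod m) ≈ + a [ m ]
mod≈ a m = subst (λ r → + r ≈ + a [ m ]) (sym (mod≡% a m)) (%-≈ a m)

mod< : ∀ a m .{{_ : NonZero m}} → a mod m < m
mod< a m = subst (_< m) (sym (mod≡% a m)) (ℕ.m%n<n a m)

≈⇒mod≡ : ∀ {m a b} .{{_ : NonZero m}} → + a ≈ + b [ m ] → a mod m ≡ b mod m
≈⇒mod≡ {m} {a} {b} e = residue-unique (mod< a m) (mod< b m) (≈-trans (mod≈ a m) (≈-trans e (≈-sym (mod≈ b m))))

mod≡⇒≈ : ∀ {m a b} .{{_ : NonZero m}} → a mod m ≡ b mod m → + a ≈ + b [ m ]
mod≡⇒≈ {m} {a} {b} e = ≈-trans (≈-sym (mod≈ a m)) (≈-trans (≈-reflexive (cong +_ e)) (mod≈ b m))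

Square : ℕ → ℤ → Set
Square p z = ∃ λ y → y ℤ.* y ≈ z [ p ]

Nonresidue : ℕ → ℤ → Set
Nonresidue p z = ∀ y → ¬ y ℤ.* y ≈ z [ p ]

-- The value at the modulus 0 is junk.
χ : ℕ → ℤ → ℤ
χ zero    z = + 0
χ (suc k) z = legendre (z ℤ.%ℕ suc k) (suc k)

χ≡ : ∀ p .{{_ : NonZero p}} z → χ p z ≡ legendre (residue p z) p
χ≡ (suc k) z = refl

data χ-View (p : ℕ) (z : ℤ) : ℤ → Set where
  is-zero       : z ≈ + 0 [ p ] → χ-View p z (+ 0)
  is-residue    : ¬ z ≈ + 0 [ p ] → Square p z → χ-View p z (+ 1)
  is-nonresidue : Nonresidue p z → χ-View p z -[1+ 0 ]

legendre-view : ∀ p .{{_ : NonZero p}} a → χ-View p (+ a) (legendre a p)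
legendre-view p a with (a mod p) ≡ᵇ 0 in a≡0
... | true = is-zero (mod≡⇒≈ (trans (ℕₚ.≡ᵇ⇒≡ (a mod p) 0 (subst T (sym a≡0) tt))
                                     (sym (0mod≡0 p))))
... | false with any (λ y → ((y * y) mod p) ≡ᵇ (a mod p)) (upTo p) in found
... | true = is-residue a≉0 (square (Any.satisfied (Anyₚ.any⁻ _ (upTo p) (subst T (sym found) tt))))
  where
  a≉0 : ¬ + a ≈ + 0 [ p ]
  a≉0 e = subst T a≡0 (ℕₚ.≡⇒≡ᵇ (a mod p) 0 (trans (≈⇒mod≡ e) (0mod≡0 p)))
  square : ∃ (λ y → T (((y * y) mod p) ≡ᵇ (a mod p))) → Square p (+ a)
  square (y , e) = + y , ≈-trans (≈-reflexive (sym (ℤₚ.pos-* y y))) (mod≡⇒≈ (ℕₚ.≡ᵇ⇒≡ _ _ e))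
... | false = is-nonresidue λ y y²≈a → subst T found
  (Anyₚ.any⁺ _ (lose (∈-upTo (residue< p y)) (ℕₚ.≡⇒≡ᵇ _ _ (≈⇒mod≡
    (≈-trans (≈-reflexive (ℤₚ.pos-* (residue p y) _)) (≈-trans (≈-* (residue≈ p y) (residue≈ p y)) y²≈a))))))

χ-view : ∀ p .{{_ : NonZero p}} z → χ-View p z (χ p z)
χ-view p z = subst (χ-View p z) (sym (χ≡ p z)) (transport (legendre-view p (residue p z)))
  where
  r≈z : + residue p z ≈ z [ p ]
  r≈z = residue≈ p z
  transport : ∀ {v} → χ-View p (+ residue p z) v → χ-View p z v
  transport (is-zero e)         = is-zero (≈-trans (≈-sym r≈z) e)
  transport (is-residue ¬e (y , e)) = is-residue (¬e ∘ ≈-trans r≈z) (y , ≈-trans e r≈z)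
  transport (is-nonresidue h)   = is-nonresidue λ y e → h y (≈-trans e (≈-sym r≈z))

χ-cong : ∀ p .{{_ : NonZero p}} {z w} → z ≈ w [ p ] → χ p z ≡ χ p w
χ-cong p {z} {w} e = trans (χ≡ p z) (trans
  (cong (λ a → legendre a p) (residue-unique (residue< p z) (residue< p w)
    (≈-trans (residue≈ p z) (≈-trans e (≈-sym (residue≈ p w))))))
  (sym (χ≡ p w)))

legendre≡χ : ∀ p .{{_ : NonZero p}} a → legendre a p ≡ χ p (+ a)
legendre≡χ p a = trans (cong₂ (λ r s → if r ≡ᵇ 0 then + 0 else if any (λ y → ((y * y) mod p) ≡ᵇ s) (upTo p) then + 1 else -[1+ 0 ]) e e)
  (sym (χ≡ p (+ a)))
  where
  e : a mod p ≡ residue p (+ a) mod p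
  e = ≈⇒mod≡ (≈-sym (residue≈ p (+ a)))

χ≡0⇒≈0 : ∀ {p} .{{_ : NonZero p}} {z} → χ p z ≡ + 0 → z ≈ + 0 [ p ]
χ≡0⇒≈0 {p} {z} e with χ p z | χ-view p z
... | _ | is-zero z≈0 = z≈0

χ≡1⇒Square : ∀ {p} .{{_ : NonZero p}} {z} → χ p z ≡ + 1 → Square p z
χ≡1⇒Square {p} {z} e with χ p z | χ-view p z
... | _ | is-residue _ s = s

χ≢0⇒≉0 : ∀ {p} .{{_ : NonZero p}} {z} → χ p z ≢ + 0 → ¬ z ≈ + 0 [ p ]
χ≢0⇒≉0 {p} {z} χ≢0 z≈0 with χ p z | χ-view p z
... | _ | is-zero _ = χ≢0 refl
... | _ | is-residue z≉0 _ = z≉0 z≈0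
... | _ | is-nonresidue h = h (+ 0) (≈-sym z≈0)

χ≡-1⇒Nonresidue : ∀ {p} .{{_ : NonZero p}} {z} → χ p z ≡ -[1+ 0 ] → Nonresidue p z
χ≡-1⇒Nonresidue {p} {z} e with χ p z | χ-view p z
... | _ | is-nonresidue h = h

-- ν is the norm of x.
Δ : ℕ × ℕ → ℤ
Δ (b , c) = + b ℤ.* + b ℤ.+ + 4 ℤ.* + c

ν : ℕ × ℕ → ℤ
ν (b , c) = ℤ.- + c

Minus : ℕ → ℕ × ℕ → Set
Minus p z = χ p (Δ z) ≡ -[1+ 0 ]

minus? : ∀ p z → Dec (Minus p z)
minus? p z = χ p (Δ z) ℤ.≟ -[1+ 0 ]

module OddPrime (p : ℕ) (pp : Prime p) (h : ℕ) (p≡1+2h : p ≡ suc (2 * h)) where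

  private instance
    p≢0 : NonZero p
    p≢0 = ℕ.prime⇒nonZero pp

  2≉0 : ¬ + 2 ≈ + 0 [ p ]
  2≉0 2≈0 = no-2 h p≡1+2h (ℕ.∣⇒≤ (≈0⇒∣ 2≈0))
    where
    no-2 : ∀ h → p ≡ suc (2 * h) → ¬ p ≤ 2
    no-2 zero    refl _ = ℕ.¬prime[1] pp
    no-2 (suc h) refl (s≤s (s≤s q)) with subst (_≤ 0) (ℕₚ.+-suc h (h + 0)) q
    ... | ()

  1≉0 : ¬ + 1 ≈ + 0 [ p ]
  1≉0 1≈0 = ℕ.¬prime[1] (subst Prime (ℕ.∣1⇒≡1 (≈0⇒∣ 1≈0)) pp)

  1≉-1 : ¬ + 1 ≈ -[1+ 0 ] [ p ]
  1≉-1 e = 2≉0 (≈⇒-≈0 e)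

  4≉0 : ¬ + 4 ≈ + 0 [ p ]
  4≉0 4≈0 = [ 2≉0 , 2≉0 ]′ (≈-prime {a = + 2} {+ 2} pp 4≈0)

  square-roots : ∀ {x y} → x ℤ.* x ≈ y ℤ.* y [ p ] → x ≈ y [ p ] ⊎ x ≈ ℤ.- y [ p ]
  square-roots {x} {y} e = [ inj₁ ∘ -≈0⇒≈ , inj₂ ∘ -≈0⇒≈ ]′
    (≈-prime {a = x ℤ.- y} {x ℤ.- ℤ.- y} pp (≈-by₁ (+ 1) e (lemma x y)))
    where
    lemma : ∀ x y → (x ℤ.- y) ℤ.* (x ℤ.- ℤ.- y) ≡ + 0 ℤ.+ + 1 ℤ.* (x ℤ.* x ℤ.- y ℤ.* y)
    lemma = solve-∀

  z≈-z⇒z≈0 : ∀ {z} → z ≈ ℤ.- z [ p ] → z ≈ + 0 [ p ]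
  z≈-z⇒z≈0 {z} e = [ (λ q → contradiction q 2≉0) , id ]′ (≈-prime {a = + 2} {z} pp (≈-by₁ (+ 1) e (lemma z)))
    where
    lemma : ∀ z → + 2 ℤ.* z ≡ + 0 ℤ.+ + 1 ℤ.* (z ℤ.- ℤ.- z)
    lemma = solve-∀

  euler-nonresidue : ∀ {z} → Nonresidue p z → z ℤ.^ h ≈ -[1+ 0 ] [ p ]
  euler-nonresidue {z} nr = NonresidueField.ε≈-1 p pp h p≡1+2h z nr

  ^-distrib : ∀ x y k → (x ℤ.* y) ℤ.^ k ≡ x ℤ.^ k ℤ.* y ℤ.^ k
  ^-distrib x y zero    = refl
  ^-distrib x y (suc k) = trans (cong (x ℤ.* y ℤ.*_) (^-distrib x y k)) (lemma x y (x ℤ.^ k) (y ℤ.^ k))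
    where
    lemma : ∀ x y a b → x ℤ.* y ℤ.* (a ℤ.* b) ≡ x ℤ.* a ℤ.* (y ℤ.* b)
    lemma = solve-∀

  nonresidue-≉0 : ∀ {z} → Nonresidue p z → ¬ z ≈ + 0 [ p ]
  nonresidue-≉0 nr z≈0 = nr (+ 0) (≈-sym z≈0)

  ≉0-* : ∀ {x y} → ¬ x ≈ + 0 [ p ] → ¬ y ≈ + 0 [ p ] → ¬ x ℤ.* y ≈ + 0 [ p ]
  ≉0-* x≉0 y≉0 e = [ x≉0 , y≉0 ]′ (≈-prime pp e)

  -- By Euler's criterion (x y)^h = (-1)(-1) = 1, whereas a nonresidue would give -1.
  nonresidue-*-nonresidue : ∀ {x y} → Nonresidue p x → Nonresidue p y → Square p (x ℤ.* y)
  nonresidue-*-nonresidue {x} {y} nx ny with χ p (x ℤ.* y) | χ-view p (x ℤ.* y)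
  ... | _ | is-residue _ s = s
  ... | _ | is-zero e = contradiction e (≉0-* (nonresidue-≉0 nx) (nonresidue-≉0 ny))
  ... | _ | is-nonresidue nxy = contradiction
    (≈-trans (≈-sym (≈-* (euler-nonresidue nx) (euler-nonresidue ny)))
      (≈-trans (≈-reflexive (sym (^-distrib x y h))) (euler-nonresidue nxy))) 1≉-1

  -- If r² = x, a square root w of x y would give the square root w / r of y.
  residue-*-nonresidue : ∀ {x y} → ¬ x ≈ + 0 [ p ] → Square p x → Nonresidue p y → Nonresidue p (x ℤ.* y)
  residue-*-nonresidue {x} {y} x≉0 (r , r²≈x) ny w w²≈xy = ny (w ℤ.* i)
    (≈-by₃ (i ℤ.* i) (ℤ.- (y ℤ.* i ℤ.* i)) (y ℤ.* (r ℤ.* i ℤ.+ + 1)) w²≈xy r²≈x ri≈1 (lemma w x y i r))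
    where
    r≉0 : ¬ r ≈ + 0 [ p ]
    r≉0 r≈0 = x≉0 (≈-trans (≈-sym r²≈x) (≈-* r≈0 r≈0))
    i = proj₁ (≈-inverse pp r≉0)
    ri≈1 = proj₂ (≈-inverse pp r≉0)
    lemma : ∀ w x y i r → w ℤ.* i ℤ.* (w ℤ.* i) ≡ y ℤ.+ i ℤ.* i ℤ.* (w ℤ.* w ℤ.- x ℤ.* y)
      ℤ.+ ℤ.- (y ℤ.* i ℤ.* i) ℤ.* (r ℤ.* r ℤ.- x)
      ℤ.+ y ℤ.* (r ℤ.* i ℤ.+ + 1) ℤ.* (r ℤ.* i ℤ.- + 1)
    lemma = solve-∀

  χ-is-zero : ∀ {z} → z ≈ + 0 [ p ] → χ p z ≡ + 0
  χ-is-zero {z} e with χ p z | χ-view p z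
  ... | _ | is-zero _ = refl
  ... | _ | is-residue z≉0 _ = contradiction e z≉0
  ... | _ | is-nonresidue nr = contradiction e (nonresidue-≉0 nr)

  χ-is-residue : ∀ {z} → ¬ z ≈ + 0 [ p ] → Square p z → χ p z ≡ + 1
  χ-is-residue {z} z≉0 (y , e) with χ p z | χ-view p z
  ... | _ | is-zero z≈0 = contradiction z≈0 z≉0
  ... | _ | is-residue _ _ = refl
  ... | _ | is-nonresidue nr = contradiction e (nr y)

  χ-is-nonresidue : ∀ {z} → Nonresidue p z → χ p z ≡ -[1+ 0 ]
  χ-is-nonresidue {z} nr with χ p z | χ-view p z
  ... | _ | is-zero z≈0 = contradiction z≈0 (nonresidue-≉0 nr)
  ... | _ | is-residue _ (y , e) = contradiction e (nr y)
  ... | _ | is-nonresidue _ = refl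

  χ-* : ∀ x y → χ p (x ℤ.* y) ≡ χ p x ℤ.* χ p y
  χ-* x y with χ p x | χ-view p x | χ p y | χ-view p y
  ... | _ | is-zero x≈0 | v | _ = trans (χ-is-zero (≈-trans (≈-*ʳ y x≈0) (≈-reflexive (ℤₚ.*-zeroˡ y)))) (sym (ℤₚ.*-zeroˡ v))
  ... | v | is-residue _ _ | _ | is-zero y≈0 = trans (χ-is-zero (≈-trans (≈-*ˡ x y≈0) (≈-reflexive (ℤₚ.*-zeroʳ x)))) refl
  ... | v | is-nonresidue _ | _ | is-zero y≈0 = trans (χ-is-zero (≈-trans (≈-*ˡ x y≈0) (≈-reflexive (ℤₚ.*-zeroʳ x)))) refl
  ... | _ | is-residue x≉0 (r , r²≈x) | _ | is-residue y≉0 (s , s²≈y) =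
    χ-is-residue (≉0-* x≉0 y≉0) (r ℤ.* s , ≈-trans (≈-reflexive (lemma r s)) (≈-* r²≈x s²≈y))
    where
    lemma : ∀ r s → r ℤ.* s ℤ.* (r ℤ.* s) ≡ r ℤ.* r ℤ.* (s ℤ.* s)
    lemma = solve-∀
  ... | _ | is-residue x≉0 sx | _ | is-nonresidue ny = χ-is-nonresidue (residue-*-nonresidue x≉0 sx ny)
  ... | _ | is-nonresidue nx | _ | is-residue y≉0 sy =
    χ-is-nonresidue (subst (Nonresidue p) (ℤₚ.*-comm y x) (residue-*-nonresidue y≉0 sy nx))
  ... | _ | is-nonresidue nx | _ | is-nonresidue ny =
    χ-is-residue (≉0-* (nonresidue-≉0 nx) (nonresidue-≉0 ny)) (nonresidue-*-nonresidue nx ny)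

  count-χ : ℤ → ℕ
  count-χ v = ∑ (upTo p) (λ t → ind (χ p (+ t) ℤ.≟ v))

  private
    square? : ∀ t y → Dec (+ y ℤ.* + y ≈ + t [ p ])
    square? t y = + y ℤ.* + y ≈? + t

    roots : ℕ → ℕ
    roots t = ∑ (upTo p) (λ y → ind (square? t y))

    -- On the three values of χ this is 1 + v, the number of square roots of a residue with symbol
    -- v.
    weight : ℤ → ℕ
    weight v = ind (v ℤ.≟ + 0) + 2 * ind (v ℤ.≟ + 1)

    roots≡weight : ∀ t → roots t ≡ weight (χ p (+ t))
    roots≡weight t with χ p (+ t) | χ-view p (+ t)
    ... | _ | is-zero t≈0 = ∑-ind≡1 (square? t) (upTo p) (upTo! p)
      (λ x∈ y∈ ex ey → trans (root-0 x∈ ex) (sym (root-0 y∈ ey)))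
      (∈-upTo (>-nonZero⁻¹ p)) (≈-sym t≈0)
      where
      root-0 : ∀ {x} → x ∈ upTo p → + x ℤ.* + x ≈ + t [ p ] → x ≡ 0
      root-0 x∈ e = residue-unique (∈-upTo⇒< x∈) (>-nonZero⁻¹ p)
        ([ id , id ]′ (≈-prime pp (≈-trans e t≈0)))
    ... | _ | is-nonresidue nr = ∑≡0 (upTo p) λ {y} _ → ind-false (square? t y) (nr (+ y))
    ... | _ | is-residue t≉0 (y , y²≈t) = ℕₚ.≤-antisym upper lower
      where
      y≉0 : ¬ y ≈ + 0 [ p ]
      y≉0 y≈0 = t≉0 (≈-trans (≈-sym y²≈t) (≈-* y≈0 y≈0))
      y₁ = residue p y
      y₂ = residue p (ℤ.- y)
      sq₁ : + y₁ ℤ.* + y₁ ≈ + t [ p ]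
      sq₁ = ≈-trans (≈-* (residue≈ p y) (residue≈ p y)) y²≈t
      sq₂ : + y₂ ℤ.* + y₂ ≈ + t [ p ]
      sq₂ = ≈-trans (≈-* (residue≈ p (ℤ.- y)) (residue≈ p (ℤ.- y))) (≈-trans (≈-reflexive (lemma y)) y²≈t)
        where
        lemma : ∀ y → ℤ.- y ℤ.* ℤ.- y ≡ y ℤ.* y
        lemma = solve-∀
      y₁≢y₂ : y₁ ≢ y₂
      y₁≢y₂ e = y≉0 (z≈-z⇒z≈0 (≈-trans (≈-sym (residue≈ p y)) (≈-trans (≈-reflexive (cong +_ e)) (residue≈ p (ℤ.- y)))))
      lower : 2 ≤ roots t
      lower = ℕₚ.≤-trans (ℕₚ.≤-reflexive (sym (cong₂ _+_ (ind-true (square? t y₁) sq₁) (ind-true (square? t y₂) sq₂))))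
        (∈∈⇒+≤∑ (λ z → ind (square? t z)) (∈-upTo (residue< p y)) (∈-upTo (residue< p (ℤ.- y))) y₁≢y₂)
      either : ∀ {x} → x ∈ upTo p → ind (square? t x) ≤ ind (x ≟ y₁) + ind (x ≟ y₂)
      either {x} x∈ = ind-bound (square? t x) λ e →
        [ (λ e′ → ℕₚ.≤-trans (ℕₚ.≤-reflexive (sym (ind-true (x ≟ y₁)
             (residue-unique (∈-upTo⇒< x∈) (residue< p y) (≈-trans e′ (≈-sym (residue≈ p y))))))) (ℕₚ.m≤m+n _ _))
        , (λ e′ → ℕₚ.≤-trans (ℕₚ.≤-reflexive (sym (ind-true (x ≟ y₂)
             (residue-unique (∈-upTo⇒< x∈) (residue< p (ℤ.- y)) (≈-trans e′ (≈-sym (residue≈ p (ℤ.- y)))))))) (ℕₚ.m≤n+m _ _)) ]′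
        (square-roots {+ x} {y} (≈-trans e (≈-sym y²≈t)))
      upper : roots t ≤ 2
      upper = ℕₚ.≤-trans (∑-mono (upTo p) either) (ℕₚ.≤-trans (ℕₚ.≤-reflexive (∑-+ (upTo p) _ _))
        (ℕₚ.+-mono-≤ (∑-ind≤1 (_≟ y₁) (upTo p) (upTo! p) λ _ _ a b → trans a (sym b))
                     (∑-ind≤1 (_≟ y₂) (upTo p) (upTo! p) λ _ _ a b → trans a (sym b))))

    sum-roots : ∑ (upTo p) roots ≡ p
    sum-roots = trans (∑-swap (upTo p) (upTo p) _) (trans (∑-cong (upTo p) λ {y} _ → one y)
      (trans (∑-upTo-const p 1) (ℕₚ.*-identityʳ p)))
      where
      one : ∀ y → ∑ (upTo p) (λ t → ind (square? t y)) ≡ 1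
      one y = ∑-ind≡1 (λ t → square? t y) (upTo p) (upTo! p)
        (λ x∈ z∈ ex ez → residue-unique (∈-upTo⇒< x∈) (∈-upTo⇒< z∈) (≈-trans (≈-sym ex) ez))
        (∈-upTo (residue< p (+ y ℤ.* + y))) (≈-sym (residue≈ p (+ y ℤ.* + y)))

  -- The pairs (t , y) with y² = t are counted in two ways: by t through the number of square roots,
  -- and by y, where each y determines one t.
  zeros+2residues : count-χ (+ 0) + 2 * count-χ (+ 1) ≡ p
  zeros+2residues = begin
    count-χ (+ 0) + 2 * count-χ (+ 1)              ≡⟨ cong (λ k → count-χ (+ 0) + k) (∑-*ˡ (upTo p) 2 _) ⟨
    count-χ (+ 0) + ∑ (upTo p) (λ t → 2 * ind (χ p (+ t) ℤ.≟ + 1)) ≡⟨ ∑-+ (upTo p) _ _ ⟨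
    ∑ (upTo p) (λ t → weight (χ p (+ t)))          ≡⟨ ∑-cong (upTo p) (λ {t} _ → roots≡weight t) ⟨
    ∑ (upTo p) roots                               ≡⟨ sum-roots ⟩
    p                                              ∎
    where open ≡-Reasoning

  trichotomy : ∀ z → ind (χ p z ℤ.≟ + 0) + (ind (χ p z ℤ.≟ + 1) + ind (χ p z ℤ.≟ -[1+ 0 ])) ≡ 1
  trichotomy z with χ p z | χ-view p z
  ... | _ | is-zero _       = refl
  ... | _ | is-residue _ _  = refl
  ... | _ | is-nonresidue _ = refl

  zeros+residues+nonresidues : count-χ (+ 0) + (count-χ (+ 1) + count-χ -[1+ 0 ]) ≡ p
  zeros+residues+nonresidues = begin
    count-χ (+ 0) + (count-χ (+ 1) + count-χ -[1+ 0 ]) ≡⟨ cong (λ k → count-χ (+ 0) + k) (∑-+ (upTo p) _ _) ⟨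
    count-χ (+ 0) + ∑ (upTo p) (λ t → ind (χ p (+ t) ℤ.≟ + 1) + ind (χ p (+ t) ℤ.≟ -[1+ 0 ])) ≡⟨ ∑-+ (upTo p) _ _ ⟨
    ∑ (upTo p) (λ t → ind (χ p (+ t) ℤ.≟ + 0) + (ind (χ p (+ t) ℤ.≟ + 1) + ind (χ p (+ t) ℤ.≟ -[1+ 0 ]))) ≡⟨ ∑-cong (upTo p) (λ {t} _ → trichotomy (+ t)) ⟩
    ∑ (upTo p) (λ _ → 1)                             ≡⟨ trans (∑-upTo-const p 1) (ℕₚ.*-identityʳ p) ⟩
    p                                                ∎
    where open ≡-Reasoning

  residues≡nonresidues : count-χ (+ 1) ≡ count-χ -[1+ 0 ]
  residues≡nonresidues = ℕₚ.+-cancelˡ-≡ (count-χ (+ 1)) _ _ (ℕₚ.+-cancelˡ-≡ (count-χ (+ 0)) _ _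
    (trans (cong (λ k → count-χ (+ 0) + (count-χ (+ 1) + k)) (sym (ℕₚ.+-identityʳ _)))
      (trans zeros+2residues (sym zeros+residues+nonresidues))))

  2nonresidues≤p : 2 * count-χ -[1+ 0 ] ≤ p
  2nonresidues≤p = ℕₚ.≤-trans (ℕₚ.m≤n+m _ (count-χ (+ 0)))
    (ℕₚ.≤-reflexive (trans (cong (λ k → count-χ (+ 0) + 2 * k) (sym residues≡nonresidues)) zeros+2residues))

  -- For fixed b the map c ↦ b² + 4c permutes the residues, because 4 is invertible. So every column
  -- holds as many pairs as there are nonresidues.
  2minus≤p² : 2 * ∑ (residuePairs p) (ind ∘ minus? p) ≤ p * p
  2minus≤p² = begin
    2 * ∑ (residuePairs p) (ind ∘ minus? p)                        ≡⟨ cong (2 *_) (∑-cartesian (upTo p) (upTo p) _) ⟩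
    2 * ∑ (upTo p) (λ b → ∑ (upTo p) (λ c → ind (minus? p (b , c)))) ≡⟨ cong (2 *_) (∑-cong (upTo p) λ {b} _ → shift b) ⟩
    2 * ∑ (upTo p) (λ _ → count-χ -[1+ 0 ])                      ≡⟨ cong (2 *_) (∑-upTo-const p _) ⟩
    2 * (p * count-χ -[1+ 0 ])                                   ≡⟨ lemma p (count-χ -[1+ 0 ]) ⟩
    p * (2 * count-χ -[1+ 0 ])                                   ≤⟨ ℕₚ.*-monoʳ-≤ p 2nonresidues≤p ⟩
    p * p                                                        ∎
    where
    open ℕₚ.≤-Reasoning
    lemma : ∀ p k → 2 * (p * k) ≡ p * (2 * k)
    lemma = ℕ-Solver.solve-∀
    shift : ∀ b → ∑ (upTo p) (λ c → ind (minus? p (b , c))) ≡ count-χ -[1+ 0 ]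
    shift b = trans
      (∑-cong (upTo p) λ {c} _ → cong (λ v → ind (v ℤ.≟ -[1+ 0 ])) (χ-cong p (≈-sym (residue≈ p (Δ (b , c))))))
      (∑-reindex _≟_ (upTo! p) (upTo! p) refl (λ c → residue p (Δ (b , c)))
        (λ {c} _ → ∈-upTo (residue< p (Δ (b , c))))
        (λ {c} {c′} c∈ c′∈ e → residue-unique (∈-upTo⇒< c∈) (∈-upTo⇒< c′∈)
          (≈-cancelˡ (+ 4) pp 4≉0 (≈-by₁ (+ 1)
            (≈-trans (≈-sym (residue≈ p (Δ (b , c)))) (≈-trans (≈-reflexive (cong +_ e)) (residue≈ p (Δ (b , c′)))))
            (lemma′ (+ b) (+ c) (+ c′)))))
        (λ t → ind (χ p (+ t) ℤ.≟ -[1+ 0 ])))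
      where
      lemma′ : ∀ b c c′ → + 4 ℤ.* c ≡ + 4 ℤ.* c′ ℤ.+ + 1 ℤ.* (b ℤ.* b ℤ.+ + 4 ℤ.* c ℤ.- (b ℤ.* b ℤ.+ + 4 ℤ.* c′))
      lemma′ = solve-∀

-- Counting parameters modulo a prime

-- θ = u √D + v is a root of x² - bx - c modulo p, where z = (b , c).
record Root (p : ℕ) (D : ℤ) (z : ℕ × ℕ) (θ : ℤ × ℤ) : Set where
  constructor root
  field square : mul (+ 0) D θ θ ≋ (+ proj₁ z ℤ.* proj₁ θ , + proj₁ z ℤ.* proj₂ θ ℤ.+ + proj₂ z) [ p ]

-- What the test leaves of its conditions at a prime where Δ is a nonzero square. `N` is going to be
-- n.
Plus : ℕ → ℕ → ℕ × ℕ → Set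
Plus p N z@(b , c) = χ p (Δ z) ≡ + 1 × (¬ ν z ≈ + 0 [ p ]) ×
  (Quadratic._↑_ p (+ b) (+ c) (+ 1 , + 0) (suc N) ≋ (+ 0 , ν z) [ p ])

plus? : ∀ p N z → Dec (Plus p N z)
plus? p N z@(b , c) = (χ p (Δ z) ℤ.≟ + 1) ×-dec ¬? (ν z ≈? + 0) ×-dec (_ ≋? _)

module ParameterCounts (p : ℕ) (pp : Prime p) (h : ℕ) (p≡1+2h : p ≡ suc (2 * h)) where
  open OddPrime p pp h p≡1+2h

  private instance
    p≢0 : NonZero p
    p≢0 = ℕ.prime⇒nonZero pp

  half : ∃ λ t → + 2 ℤ.* t ≈ + 1 [ p ]
  half = ≈-inverse pp 2≉0

  root-equations : ∀ {D z θ} → Root p D z θ →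
    + 2 ℤ.* (proj₁ θ ℤ.* proj₂ θ) ≈ + proj₁ z ℤ.* proj₁ θ [ p ] ×
    proj₁ θ ℤ.* proj₁ θ ℤ.* D ℤ.+ proj₂ θ ℤ.* proj₂ θ ≈ + proj₁ z ℤ.* proj₂ θ ℤ.+ + proj₂ z [ p ]
  root-equations {D} {b , c} {u , v} (root r) =
    let r′ = subst (_≋ (+ b ℤ.* u , + b ℤ.* v ℤ.+ + c) [ p ]) (mul-def (+ 0) D u v u v) r
    in ≈-trans (≈-reflexive (lemma u v)) (x-part r′) , 1-part r′
    where
    lemma : ∀ u v → + 2 ℤ.* (u ℤ.* v) ≡ u ℤ.* u ℤ.* + 0 ℤ.+ u ℤ.* v ℤ.+ u ℤ.* v
    lemma = solve-∀

  Root-intro : ∀ {D b c u v} → + 2 ℤ.* (u ℤ.* v) ≈ + b ℤ.* u [ p ] →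
    u ℤ.* u ℤ.* D ℤ.+ v ℤ.* v ≈ + b ℤ.* v ℤ.+ + c [ p ] → Root p D (b , c) (u , v)
  Root-intro {D} {b} {c} {u} {v} e₁ e₂ = root (subst (_≋ (+ b ℤ.* u , + b ℤ.* v ℤ.+ + c) [ p ]) (sym (mul-def (+ 0) D u v u v))
    (≈-trans (≈-reflexive (sym (lemma u v))) e₁ ∙ e₂))
    where
    lemma : ∀ u v → + 2 ℤ.* (u ℤ.* v) ≡ u ℤ.* u ℤ.* + 0 ℤ.+ u ℤ.* v ℤ.+ u ℤ.* v
    lemma = solve-∀

  conjugate-root : ∀ {D z u v} → Root p D z (u , v) → Root p D z (ℤ.- u , v)
  conjugate-root {D} {b , c} {u} {v} r = let e₁ , e₂ = root-equations {θ = u , v} r in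
    Root-intro (≈-by₁ (ℤ.- + 1) e₁ (lemma₁ (+ b) u v)) (≈-trans (≈-reflexive (lemma₂ D u v)) e₂)
    where
    lemma₁ : ∀ b u v → + 2 ℤ.* (ℤ.- u ℤ.* v) ≡ b ℤ.* ℤ.- u ℤ.+ ℤ.- + 1 ℤ.* (+ 2 ℤ.* (u ℤ.* v) ℤ.- b ℤ.* u)
    lemma₁ = solve-∀
    lemma₂ : ∀ D u v → ℤ.- u ℤ.* ℤ.- u ℤ.* D ℤ.+ v ℤ.* v ≡ u ℤ.* u ℤ.* D ℤ.+ v ℤ.* v
    lemma₂ = solve-∀

  Root-cong : ∀ {D z θ θ′} → θ ≋ θ′ [ p ] → Root p D z θ → Root p D z θ′
  Root-cong {D} {b , c} {u , v} {u′ , v′} (eu ∙ ev) r = let e₁ , e₂ = root-equations {θ = u , v} r in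
    Root-intro
      (≈-trans (≈-sym (≈-*ˡ (+ 2) (≈-* eu ev))) (≈-trans e₁ (≈-*ˡ (+ b) eu)))
      (≈-trans (≈-sym (≈-+ (≈-*ʳ D (≈-* eu eu)) (≈-* ev ev)))
        (≈-trans e₂ (≈-+ (≈-*ˡ (+ b) ev) ≈-refl)))

  -- With y² = D Δ, the root is (b + (y / D) √D) / 2.
  root-exists : ∀ {D z} → Nonresidue p D → Nonresidue p (Δ z) → ∃₂ λ u v → ¬ u ≈ + 0 [ p ] × Root p D z (u , v)
  root-exists {D} {z@(b , c)} nD nΔ = u , v , u≉0 , Root-intro e₁ e₂
    where
    i = proj₁ (≈-inverse pp (nonresidue-≉0 nD))
    Di≈1 = proj₂ (≈-inverse pp (nonresidue-≉0 nD))
    t = proj₁ half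
    2t≈1 = proj₂ half
    y = proj₁ (nonresidue-*-nonresidue nD nΔ)
    y²≈DΔ = proj₂ (nonresidue-*-nonresidue nD nΔ)
    u = y ℤ.* i ℤ.* t
    v = + b ℤ.* t
    e₁ : + 2 ℤ.* (u ℤ.* v) ≈ + b ℤ.* u [ p ]
    e₁ = ≈-by₁ (+ b ℤ.* u) 2t≈1 (lemma (+ b) u t)
      where
      lemma : ∀ b u t → + 2 ℤ.* (u ℤ.* (b ℤ.* t)) ≡ b ℤ.* u ℤ.+ b ℤ.* u ℤ.* (+ 2 ℤ.* t ℤ.- + 1)
      lemma = solve-∀
    e₂ : u ℤ.* u ℤ.* D ℤ.+ v ℤ.* v ≈ + b ℤ.* v ℤ.+ + c [ p ]
    e₂ = ≈-by₃ (D ℤ.* i ℤ.* i ℤ.* t ℤ.* t) ((D ℤ.* i ℤ.+ + 1) ℤ.* Δ z ℤ.* t ℤ.* t)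
           (+ b ℤ.* + b ℤ.* t ℤ.+ + c ℤ.* (+ 2 ℤ.* t ℤ.+ + 1)) y²≈DΔ Di≈1 2t≈1 (lemma D (+ b) (+ c) y i t)
      where
      lemma : ∀ D b c y i t → let Δ = b ℤ.* b ℤ.+ + 4 ℤ.* c in
        (y ℤ.* i ℤ.* t) ℤ.* (y ℤ.* i ℤ.* t) ℤ.* D ℤ.+ (b ℤ.* t) ℤ.* (b ℤ.* t) ≡ b ℤ.* (b ℤ.* t) ℤ.+ c
        ℤ.+ D ℤ.* i ℤ.* i ℤ.* t ℤ.* t ℤ.* (y ℤ.* y ℤ.- D ℤ.* Δ)
        ℤ.+ (D ℤ.* i ℤ.+ + 1) ℤ.* Δ ℤ.* t ℤ.* t ℤ.* (D ℤ.* i ℤ.- + 1)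
        ℤ.+ (b ℤ.* b ℤ.* t ℤ.+ c ℤ.* (+ 2 ℤ.* t ℤ.+ + 1)) ℤ.* (+ 2 ℤ.* t ℤ.- + 1)
      lemma = solve-∀
    i≉0 : ¬ i ≈ + 0 [ p ]
    i≉0 i≈0 = 1≉0 (≈-trans (≈-sym Di≈1) (≈-trans (≈-*ˡ D i≈0) (≈-reflexive (ℤₚ.*-zeroʳ D))))
    t≉0 : ¬ t ≈ + 0 [ p ]
    t≉0 t≈0 = 1≉0 (≈-trans (≈-sym 2t≈1) (≈-*ˡ (+ 2) t≈0))
    y≉0 : ¬ y ≈ + 0 [ p ]
    y≉0 y≈0 = ≉0-* (nonresidue-≉0 nD) (nonresidue-≉0 nΔ) (≈-trans (≈-sym y²≈DΔ) (≈-* y≈0 y≈0))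
    u≉0 : ¬ u ≈ + 0 [ p ]
    u≉0 = ≉0-* (≉0-* y≉0 i≉0) t≉0

  -- If u = 0, completing the square makes 2v - b a square root of Δ.
  root-irrational : ∀ {D z u v} → Nonresidue p (Δ z) → Root p D z (u , v) → ¬ u ≈ + 0 [ p ]
  root-irrational {D} {b , c} {u} {v} nΔ r u≈0 = nΔ (+ 2 ℤ.* v ℤ.- + b)
    (≈-by₂ (+ 4) (ℤ.- (+ 4 ℤ.* u ℤ.* D)) (proj₂ (root-equations {θ = u , v} r)) u≈0 (lemma D (+ b) (+ c) u v))
    where
    lemma : ∀ D b c u v → (+ 2 ℤ.* v ℤ.- b) ℤ.* (+ 2 ℤ.* v ℤ.- b) ≡ b ℤ.* b ℤ.+ + 4 ℤ.* c
      ℤ.+ + 4 ℤ.* (u ℤ.* u ℤ.* D ℤ.+ v ℤ.* v ℤ.- (b ℤ.* v ℤ.+ c))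
      ℤ.+ ℤ.- (+ 4 ℤ.* u ℤ.* D) ℤ.* (u ℤ.- + 0)
    lemma = solve-∀

  root-determines-trace : ∀ {D z u v} → ¬ u ≈ + 0 [ p ] → Root p D z (u , v) → + proj₁ z ≈ + 2 ℤ.* v [ p ]
  root-determines-trace {D} {b , c} {u} {v} u≉0 r = ≈-cancelˡ u pp u≉0
    (≈-by₁ (ℤ.- + 1) (proj₁ (root-equations {θ = u , v} r)) (lemma (+ b) u v))
    where
    lemma : ∀ b u v → u ℤ.* b ≡ u ℤ.* (+ 2 ℤ.* v) ℤ.+ ℤ.- + 1 ℤ.* (+ 2 ℤ.* (u ℤ.* v) ℤ.- b ℤ.* u)
    lemma = solve-∀

  root-determines-norm : ∀ {D z u v} → ¬ u ≈ + 0 [ p ] → Root p D z (u , v) → ν z ≈ v ℤ.* v ℤ.- D ℤ.* (u ℤ.* u) [ p ]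
  root-determines-norm {D} {b , c} {u} {v} u≉0 r =
    ≈-by₂ (+ 1) v (proj₂ (root-equations {θ = u , v} r)) (root-determines-trace {D} {b , c} {u} {v} u≉0 r) (lemma D (+ b) (+ c) u v)
    where
    lemma : ∀ D b c u v → ℤ.- c ≡ (v ℤ.* v ℤ.- D ℤ.* (u ℤ.* u))
      ℤ.+ + 1 ℤ.* (u ℤ.* u ℤ.* D ℤ.+ v ℤ.* v ℤ.- (b ℤ.* v ℤ.+ c)) ℤ.+ v ℤ.* (b ℤ.- + 2 ℤ.* v)
    lemma = solve-∀

  parameters-unique : ∀ {z z′} → z ∈ residuePairs p → z′ ∈ residuePairs p →
    + proj₁ z ≈ + proj₁ z′ [ p ] → ν z ≈ ν z′ [ p ] → z ≡ z′
  parameters-unique {b , c} {b′ , c′} z∈ z′∈ e e′ =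
    let b< , c< = ∈-residuePairs⇒< z∈ ; b′< , c′< = ∈-residuePairs⇒< z′∈
    in cong₂ _,_ (residue-unique b< b′< e) (residue-unique c< c′< (≈-by₁ (ℤ.- + 1) e′ (lemma (+ c) (+ c′))))
    where
    lemma : ∀ c c′ → c ≡ c′ ℤ.+ ℤ.- + 1 ℤ.* (ℤ.- c ℤ.- ℤ.- c′)
    lemma = solve-∀

  Root? : ∀ D z θ → Dec (Root p D z θ)
  Root? D (b , c) θ = map′ root Root.square
    (mul (+ 0) D θ θ ≋? (+ b ℤ.* proj₁ θ , + b ℤ.* proj₂ θ ℤ.+ + c))

  -- Every pair z satisfying P has two distinct conjugate roots in 𝔽ₚ², both of them solutions of
  -- θ^d = a. Conversely θ determines z through its trace and norm. As a field has at most d such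
  -- solutions, twice the number of pairs is at most d.
  minus-count : {P : ℕ × ℕ → Set} (P? : ∀ z → Dec (P z)) (d : ℕ) .{{_ : NonZero d}} (a : ℤ) →
    (∀ {z} → P z → Nonresidue p (Δ z)) →
    (∀ {z D} → Nonresidue p D → P z → ∀ θ → Root p D z θ → Quadratic._↑_ p (+ 0) D θ d ≋ (+ 0 , a) [ p ]) →
    2 * ∑ (residuePairs p) (ind ∘ P?) ≤ d
  minus-count {P} P? d a minus power = subst (_≤ d) (∑-*ˡ (residuePairs p) 2 (ind ∘ P?))
    (∑-bound-by-witness (residuePairs p) (λ z → 2 * ind (P? z)) λ {z} _ 1≤ →
      subst (_≤ d) (sym (∑-*ˡ (residuePairs p) 2 (ind ∘ P?))) (bound z (witness z 1≤)))
    where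
    witness : ∀ z → 1 ≤ 2 * ind (P? z) → P z
    witness z 1≤ with P? z
    ... | yes Pz = Pz
    bound : ∀ z₀ → P z₀ → 2 * ∑ (residuePairs p) (ind ∘ P?) ≤ d
    bound z₀ Pz₀ = ℕₚ.≤-trans (double-count-≤ (residuePairs p) (residuePairs p) r 2 (λ {z} _ → two-roots z) (λ {x} _ → one-parameter x))
                              (count-power-roots d (+ 0 , a))
      where
      -- One pair satisfying P provides the nonresidue D. The field of √D then contains the roots
      -- for all other pairs, because the product of two nonresidues is a square.
      D = Δ z₀
      nD = minus {z₀} Pz₀
      open NonresidueField p pp h p≡1+2h D nD using (count-power-roots)
      open Quadratic p (+ 0) D using (_↑_; ≋-trans; ≋-sym)
      r? : ∀ z x → Dec (P z × Root p D z (embed x))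
      r? z x = P? z ×-dec Root? D z (embed x)
      r : ℕ × ℕ → ℕ × ℕ → ℕ
      r z x = ind (r? z x)
      two-roots : ∀ z → 2 * ind (P? z) ≤ ∑ (residuePairs p) (r z)
      two-roots z = *-ind-bound 2 (P? z) (two-roots′ z)
        where
        two-roots′ : ∀ z → P z → 2 ≤ ∑ (residuePairs p) (r z)
        two-roots′ z Pz = ℕₚ.≤-trans (ℕₚ.≤-reflexive (sym (cong₂ _+_
                  (ind-true (r? z x₁) (Pz , root₁)) (ind-true (r? z x₂) (Pz , root₂)))))
                (∈∈⇒+≤∑ (r z) (x∈ u v) (x∈ (ℤ.- u) v) x₁≢x₂)
          where
          rt = root-exists {z = z} nD (minus {z} Pz)
          u = proj₁ rt
          v = proj₁ (proj₂ rt)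
          u≉0 = proj₁ (proj₂ (proj₂ rt))
          x₁ = residue p u , residue p v
          x₂ = residue p (ℤ.- u) , residue p v
          x∈ : ∀ u v → (residue p u , residue p v) ∈ residuePairs p
          x∈ u v = ∈-residuePairs (residue< p u) (residue< p v)
          root₁ : Root p D z (embed x₁)
          root₁ = Root-cong (≈-sym (residue≈ p u) ∙ ≈-sym (residue≈ p v)) (proj₂ (proj₂ (proj₂ rt)))
          root₂ : Root p D z (embed x₂)
          root₂ = Root-cong (≈-sym (residue≈ p (ℤ.- u)) ∙ ≈-sym (residue≈ p v)) (conjugate-root (proj₂ (proj₂ (proj₂ rt))))
          x₁≢x₂ : x₁ ≢ x₂
          x₁≢x₂ e = u≉0 (z≈-z⇒z≈0 (≈-trans (≈-sym (residue≈ p u))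
            (≈-trans (≈-reflexive (cong (+_ ∘ proj₁) e)) (residue≈ p (ℤ.- u)))))
      one-parameter : ∀ x → ∑ (residuePairs p) (λ z → r z x) ≤ ind (_≋?_ {p} (embed x ↑ d) (+ 0 , a))
      one-parameter x = ∑-bound-by-witness (residuePairs p) (λ z → r z x) λ {z} _ 1≤ →
        let Pz , rt = ind-pos (r? z x) 1≤ in
        subst (∑ (residuePairs p) (λ z → r z x) ≤_) (sym (ind-true (_≋?_ {p} (embed x ↑ d) (+ 0 , a)) (power nD Pz (embed x) rt)))
          (∑-ind≤1 (λ z → r? z x) (residuePairs p) (residuePairs! p) λ {z} z∈ z′∈ (Pz , rt) (Pz′ , rt′) →
            let u≉0 = root-irrational (minus {z} Pz) rt
            in parameters-unique z∈ z′∈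
                 (≈-trans (root-determines-trace u≉0 rt) (≈-sym (root-determines-trace u≉0 rt′)))
                 (≈-trans (root-determines-norm u≉0 rt) (≈-sym (root-determines-norm u≉0 rt′))))

  -- Each such pair has two distinct roots α in 𝔽ₚ, and by `recover` each of the p residues α
  -- belongs to at most one pair.
  2plus≤p : ∀ N → 2 * ∑ (residuePairs p) (ind ∘ plus? p N) ≤ p
  2plus≤p N = ℕₚ.≤-trans (double-count-≤ (residuePairs p) (upTo p) r 2 {g = λ _ → 1} (λ {z} _ → two-roots z) (λ {α} _ → one-parameter α))
                         (ℕₚ.≤-reflexive (trans (∑-upTo-const p 1) (ℕₚ.*-identityʳ p)))
    where
    r? : ∀ z (α : ℕ) → Dec (Plus p N z × (+ α ℤ.* + α ≈ + proj₁ z ℤ.* + α ℤ.+ + proj₂ z [ p ]))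
    r? z α = plus? p N z ×-dec (+ α ℤ.* + α ≈? + proj₁ z ℤ.* + α ℤ.+ + proj₂ z)
    r : ℕ × ℕ → ℕ → ℕ
    r z α = ind (r? z α)
    two-roots : ∀ z → 2 * ind (plus? p N z) ≤ ∑ (upTo p) (r z)
    two-roots z = *-ind-bound 2 (plus? p N z) (two-roots′ z)
      where
      two-roots′ : ∀ z → Plus p N z → 2 ≤ ∑ (upTo p) (r z)
      two-roots′ z@(b , c) Pz = ℕₚ.≤-trans (ℕₚ.≤-reflexive (sym (cong₂ _+_
                (ind-true (r? z (residue p (α y))) (Pz , α-root y y²≈Δ)) (ind-true (r? z (residue p (α (ℤ.- y)))) (Pz , α-root (ℤ.- y) -y²≈Δ)))))
              (∈∈⇒+≤∑ (r z) (∈-upTo (residue< p (α y))) (∈-upTo (residue< p (α (ℤ.- y)))) distinct)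
        where
        t = proj₁ half
        2t≈1 = proj₂ half
        y = proj₁ (χ≡1⇒Square {p} {Δ z} (proj₁ Pz))
        y²≈Δ = proj₂ (χ≡1⇒Square {p} {Δ z} (proj₁ Pz))
        -y²≈Δ : ℤ.- y ℤ.* ℤ.- y ≈ Δ z [ p ]
        -y²≈Δ = ≈-trans (≈-reflexive (lemma y)) y²≈Δ
          where
          lemma : ∀ y → ℤ.- y ℤ.* ℤ.- y ≡ y ℤ.* y
          lemma = solve-∀
        y≉0 : ¬ y ≈ + 0 [ p ]
        y≉0 y≈0 with trans (sym (proj₁ Pz)) (χ-is-zero (≈-trans (≈-sym y²≈Δ) (≈-* y≈0 y≈0)))
        ... | ()
        α : ℤ → ℤ
        α y = (+ b ℤ.+ y) ℤ.* t
        α-root : ∀ y → y ℤ.* y ≈ Δ z [ p ] → + residue p (α y) ℤ.* + residue p (α y) ≈ + b ℤ.* + residue p (α y) ℤ.+ + c [ p ]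
        α-root y e = ≈-trans (≈-* (residue≈ p (α y)) (residue≈ p (α y)))
          (≈-trans (≈-by₂ (t ℤ.* t) ((+ b ℤ.* (+ b ℤ.+ y)) ℤ.* t ℤ.+ + c ℤ.* (+ 2 ℤ.* t ℤ.+ + 1)) e 2t≈1 (lemma (+ b) (+ c) y t))
            (≈-+ (≈-*ˡ (+ b) (≈-sym (residue≈ p (α y)))) ≈-refl))
          where
          lemma : ∀ b c y t → (b ℤ.+ y) ℤ.* t ℤ.* ((b ℤ.+ y) ℤ.* t) ≡ b ℤ.* ((b ℤ.+ y) ℤ.* t) ℤ.+ c
            ℤ.+ t ℤ.* t ℤ.* (y ℤ.* y ℤ.- (b ℤ.* b ℤ.+ + 4 ℤ.* c))
            ℤ.+ ((b ℤ.* (b ℤ.+ y)) ℤ.* t ℤ.+ c ℤ.* (+ 2 ℤ.* t ℤ.+ + 1)) ℤ.* (+ 2 ℤ.* t ℤ.- + 1)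
          lemma = solve-∀
        distinct : residue p (α y) ≢ residue p (α (ℤ.- y))
        distinct e = y≉0 (≈-by₂ (+ 1) (ℤ.- y)
          (≈-trans (≈-sym (residue≈ p (α y))) (≈-trans (≈-reflexive (cong +_ e)) (residue≈ p (α (ℤ.- y))))) 2t≈1 (lemma (+ b) y t))
          where
          lemma : ∀ b y t → y ≡ + 0 ℤ.+ + 1 ℤ.* ((b ℤ.+ y) ℤ.* t ℤ.- (b ℤ.+ ℤ.- y) ℤ.* t) ℤ.+ ℤ.- y ℤ.* (+ 2 ℤ.* t ℤ.- + 1)
          lemma = solve-∀
    -- A root α has conjugate α^N, so that b = α + α^N and c = - α^(N+1).
    recover : ∀ {α : ℕ} {z} → Plus p N z → + α ℤ.* + α ≈ + proj₁ z ℤ.* + α ℤ.+ + proj₂ z [ p ] →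
      (+ proj₁ z ≈ + α ℤ.+ (+ α) ℤ.^ N [ p ]) × (ν z ≈ (+ α) ℤ.^ suc N [ p ])
    recover {α} {z@(b , c)} (_ , ν≉0 , power) rt = b≈ , ≈-sym norm
      where
      θ : ℤ × ℤ
      θ = + 0 , + α
      root′ : mul (+ 0) (+ 0) θ θ ≋ (+ b ℤ.* + 0 , + b ℤ.* + α ℤ.+ + c) [ p ]
      root′ = subst (_≋ (+ b ℤ.* + 0 , + b ℤ.* + α ℤ.+ + c) [ p ]) (sym (mul-def (+ 0) (+ 0) (+ 0) (+ α) (+ 0) (+ α)))
        (≈-reflexive (lemma₁ (+ α) (+ b)) ∙ ≈-trans (≈-reflexive (lemma₂ (+ α))) rt)
        where
        lemma₁ : ∀ a b → + 0 ℤ.* + 0 ℤ.* + 0 ℤ.+ + 0 ℤ.* a ℤ.+ + 0 ℤ.* a ≡ b ℤ.* + 0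
        lemma₁ = solve-∀
        lemma₂ : ∀ a → + 0 ℤ.* + 0 ℤ.* + 0 ℤ.+ a ℤ.* a ≡ a ℤ.* a
        lemma₂ = solve-∀
      open Evaluation p (+ b) (+ c) p (+ 0) (+ 0) ℕ.∣-refl θ root′
      open Quadratic p (+ 0) (+ 0)
      norm : (+ α) ℤ.^ suc N ≈ ν z [ p ]
      norm = 1-part (≋-trans (≋-sym (const-↑ (+ α) (suc N))) (power-at-root (suc N) power))
      α≉0 : ¬ + α ≈ + 0 [ p ]
      α≉0 α≈0 = ν≉0 (≈-trans (≈-sym norm) (≈-trans (≈-*ʳ ((+ α) ℤ.^ N) α≈0) (≈-reflexive (ℤₚ.*-zeroˡ ((+ α) ℤ.^ N)))))
      b≈ : + b ≈ + α ℤ.+ (+ α) ℤ.^ N [ p ]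
      b≈ = ≈-cancelˡ (+ α) pp α≉0 (≈-by₂ (ℤ.- + 1) (ℤ.- + 1) rt norm (lemma (+ α) (+ b) (+ c) ((+ α) ℤ.^ N)))
        where
        lemma : ∀ a b c aN → a ℤ.* b ≡ a ℤ.* (a ℤ.+ aN) ℤ.+ ℤ.- + 1 ℤ.* (a ℤ.* a ℤ.- (b ℤ.* a ℤ.+ c))
          ℤ.+ ℤ.- + 1 ℤ.* (a ℤ.* aN ℤ.- ℤ.- c)
        lemma = solve-∀
    one-parameter : ∀ α → ∑ (residuePairs p) (λ z → r z α) ≤ 1
    one-parameter α = ∑-ind≤1 (λ z → r? z α) (residuePairs p) (residuePairs! p) λ z∈ z′∈ (Pz , e) (Pz′ , e′) →
      let b≈ , n≈ = recover {α} Pz e ; b≈′ , n≈′ = recover {α} Pz′ e′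
      in parameters-unique z∈ z′∈ (≈-trans b≈ (≈-sym b≈′)) (≈-trans n≈ (≈-sym n≈′))

-- Parity, and orders of elements at primes where Δ is a nonresidue

Odd : ℕ → Set
Odd s = ∃ λ m → s ≡ suc (2 * m)

-1^odd : ∀ {s} → Odd s → -[1+ 0 ] ℤ.^ s ≡ -[1+ 0 ]
-1^odd (m , refl) = cong (-[1+ 0 ] ℤ.*_) (trans (sym (ℤₚ.^-*-assoc -[1+ 0 ] 2 m)) (ℤₚ.^-zeroˡ m))

≡-mod-2 : ∀ m → (∃ λ k → m ≡ 2 * k) ⊎ Odd m
≡-mod-2 zero = inj₁ (0 , refl)
≡-mod-2 (suc m) with ≡-mod-2 m
... | inj₁ (k , refl) = inj₂ (k , refl)
... | inj₂ (k , refl) = inj₁ (suc k , sym (ℕₚ.*-suc 2 k))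

∤2⇒Odd : ∀ {m} → ¬ (2 ∣ m) → Odd m
∤2⇒Odd {m} 2∤m = [ (λ (k , e) → contradiction (ℕ.divides k (trans e (ℕₚ.*-comm 2 k))) 2∤m) , id ]′ (≡-mod-2 m)

Odd⇒2∤ : ∀ {m} → Odd m → ¬ (2 ∣ m)
Odd⇒2∤ (k , refl) 2∣ with ℕ.∣1⇒≡1 (ℕ.∣m+n∣m⇒∣n (subst (2 ∣_) (ℕₚ.+-comm 1 (2 * k)) 2∣) (ℕ.m∣m*n k))
... | ()

^-mono-∣ : ∀ {a m n} → m ≤ n → a ^ m ∣ a ^ n
^-mono-∣ {a} {m} {n} m≤n = ℕ.divides (a ^ (n ∸ m)) (trans (cong (a ^_) (sym (ℕₚ.m∸n+n≡m m≤n)))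
  (ℕₚ.^-distribˡ-+-* a (n ∸ m) m))

split2Aux-odd : ∀ f m → 0 < m → m ≤ f → Odd (proj₂ (split2Aux f m))
split2Aux-odd zero    (suc m) _ ()
split2Aux-odd (suc f) (suc m) _ (s≤s m≤f) with (suc m % 2) ≡ᵇ 0 in even
... | true  = split2Aux-odd f (suc m / 2) (ℕₚ.n≢0⇒n>0 half≢0)
                (ℕₚ.≤-trans (ℕₚ.≤-pred (ℕ.m/n<m (suc m) 2 (s≤s (s≤s z≤n)))) m≤f)
  where
  half≢0 : suc m / 2 ≢ 0
  half≢0 e with trans (ℕ.m≡m%n+[m/n]*n (suc m) 2) (cong₂ (λ a b → a + b * 2) (ℕₚ.≡ᵇ⇒≡ (suc m % 2) 0 (subst T (sym even) tt)) e)
  ... | ()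
... | false = ∤2⇒Odd (λ 2∣m → subst T even (ℕₚ.≡⇒≡ᵇ (suc m % 2) 0 (ℕ.n∣m⇒m%n≡0 (suc m) 2 2∣m)))

split2Aux-* : ∀ f m → 2 ^ proj₁ (split2Aux f m) * proj₂ (split2Aux f m) ≡ m
split2Aux-* zero    m = ℕₚ.*-identityˡ m
split2Aux-* (suc f) zero = refl
split2Aux-* (suc f) (suc m) with (suc m % 2) ≡ᵇ 0 in even
... | false = ℕₚ.*-identityˡ (suc m)
... | true  = begin
  2 * 2 ^ r * s         ≡⟨ ℕₚ.*-assoc 2 (2 ^ r) s ⟩
  2 * (2 ^ r * s)       ≡⟨ cong (2 *_) (split2Aux-* f (suc m / 2)) ⟩
  2 * (suc m / 2)       ≡⟨ ℕ.m*[n/m]≡n (ℕ.m%n≡0⇒n∣m (suc m) 2 (ℕₚ.≡ᵇ⇒≡ (suc m % 2) 0 (subst T (sym even) tt))) ⟩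
  suc m                 ∎
  where
  open ≡-Reasoning
  r = proj₁ (split2Aux f (suc m / 2))
  s = proj₂ (split2Aux f (suc m / 2))

split2-odd : ∀ {m} → 0 < m → Odd (proj₂ (split2 m))
split2-odd {m} 0<m = split2Aux-odd m m 0<m ℕₚ.≤-refl

split2-* : ∀ m → 2 ^ proj₁ (split2 m) * proj₂ (split2 m) ≡ m
split2-* m = split2Aux-* m m

-- p² - 1 is the order of the unit group of 𝔽ₚ². `val` and `odd-part` split it into its 2-adic
-- valuation and its odd part, as step (5) does with n² - 1.
val : ℕ → ℕ
val p = proj₁ (split2 (p * p ∸ 1))

odd-part : ℕ → ℕ
odd-part p = proj₂ (split2 (p * p ∸ 1))

-- The conjugate of x is ν / x, so the equation says that the N-th power of x is its conjugate, as
-- for the Frobenius map.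
Frobenius : ℕ → ℕ → ℕ × ℕ → Set
Frobenius p N z@(b , c) = χ p (Δ z) ≡ -[1+ 0 ] ×
  (Quadratic._↑_ p (+ b) (+ c) (+ 1 , + 0) (suc N) ≋ (+ 0 , ν z) [ p ])

Power : ℕ → ℕ → ℤ → ℕ × ℕ → Set
Power p d a z@(b , c) = χ p (Δ z) ≡ -[1+ 0 ] × (Quadratic._↑_ p (+ b) (+ c) (+ 1 , + 0) d ≋ (+ 0 , a) [ p ])

frobenius? : ∀ p N z → Dec (Frobenius p N z)
frobenius? p N z = (χ p (Δ z) ℤ.≟ -[1+ 0 ]) ×-dec (_ ≋? _)

power? : ∀ p d a z → Dec (Power p d a z)
power? p d a z = (χ p (Δ z) ℤ.≟ -[1+ 0 ]) ×-dec (_ ≋? _)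

module MinusBounds (p : ℕ) (pp : Prime p) (h : ℕ) (p≡1+2h : p ≡ suc (2 * h)) where
  open OddPrime p pp h p≡1+2h
  open ParameterCounts p pp h p≡1+2h

  private instance
    p≢0 : NonZero p
    p≢0 = ℕ.prime⇒nonZero pp

  1<p : 1 < p
  1<p = nonTrivial⇒n>1 p {{ℕ.prime⇒nonTrivial pp}}

  0<p²-1 : 0 < p * p ∸ 1
  0<p²-1 = ℕₚ.m<n⇒0<n∸m (ℕₚ.<-≤-trans 1<p (ℕₚ.m≤m*n p p))

  odd-part-odd : Odd (odd-part p)
  odd-part-odd = split2-odd 0<p²-1

  p²-1≡ : p * p ∸ 1 ≡ 2 ^ val p * odd-part p
  p²-1≡ = sym (split2-* (p * p ∸ 1))

  p²-1≡2[h[p+1]] : p * p ∸ 1 ≡ 2 * (h * suc p)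
  p²-1≡2[h[p+1]] rewrite p≡1+2h = lemma h
    where
    lemma : ∀ h → 2 * h + 2 * h * suc (2 * h) ≡ 2 * (h * suc (suc (2 * h)))
    lemma = ℕ-Solver.solve-∀

  val≢0 : ∃ λ e → val p ≡ suc e
  val≢0 with val p in eq
  ... | suc e = e , refl
  ... | zero  = ⊥-elim (Odd⇒2∤ odd-part-odd (subst (2 ∣_) (trans (sym p²-1≡2[h[p+1]]) (trans p²-1≡
      (trans (cong (λ e → 2 ^ e * odd-part p) eq) (ℕₚ.*-identityˡ _)))) (ℕ.m∣m*n (h * suc p))))

  -- p² - 1 = 4 h (h + 1), and one of two consecutive numbers is even.
  8∣p²-1 : 8 ∣ p * p ∸ 1
  8∣p²-1 with ≡-mod-2 h
  ... | inj₁ (k , refl) = ℕ.divides (k * suc (2 * k)) (trans p²-1≡2[h[p+1]]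
        (trans (cong (λ q → 2 * (2 * k * suc q)) p≡1+2h) (lemma k)))
    where
    lemma : ∀ k → 2 * (2 * k * suc (suc (2 * (2 * k)))) ≡ k * suc (2 * k) * 8
    lemma = ℕ-Solver.solve-∀
  ... | inj₂ (k , refl) = ℕ.divides (suc (2 * k) * suc k) (trans p²-1≡2[h[p+1]]
        (trans (cong (λ q → 2 * (suc (2 * k) * suc q)) p≡1+2h) (lemma k)))
    where
    lemma : ∀ k → 2 * (suc (2 * k) * suc (suc (2 * suc (2 * k)))) ≡ suc (2 * k) * suc k * 8
    lemma = ℕ-Solver.solve-∀

  3≤val : 3 ≤ val p
  3≤val with 3 ≤? val p
  ... | yes 3≤ = 3≤
  ... | no 3≰ = ⊥-elim (Odd⇒2∤ odd-part-odd (small (val p) (ℕₚ.≤-pred (ℕₚ.≰⇒> 3≰)) (subst (8 ∣_) p²-1≡ 8∣p²-1)))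
    where
    small : ∀ e → e ≤ 2 → 8 ∣ 2 ^ e * odd-part p → 2 ∣ odd-part p
    small 0 _ d = ℕ.∣-trans (ℕ.divides 4 refl) (subst (8 ∣_) (ℕₚ.*-identityˡ _) d)
    small 1 _ d = ℕ.∣-trans (ℕ.divides 2 refl) (ℕ.*-cancelˡ-∣ {4} 2 d)
    small 2 _ d = ℕ.*-cancelˡ-∣ {2} 4 d
    small (suc (suc (suc _))) (s≤s (s≤s ())) _

  module _ {D : ℤ} (nD : Nonresidue p D) where
    open Quadratic p (+ 0) D
    open NonresidueField p pp h p≡1+2h D nD using (no-zero-divisors; frobenius; ↑p²≋id; ↑[p²-1]≋𝟙; ·-cancelˡ; mul₀)
    open import Relation.Binary.Reasoning.Setoid ≋-setoid

    conjugate : ∀ {z θ} → Nonresidue p (Δ z) → Root p D z θ → θ · θ ↑ p ≋ const (ν z) [ p ]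
    conjugate {z} {θ@(u , v)} nΔ r = begin
      (u , v) · (u , v) ↑ p           ≈⟨ ·-cong ≋-refl (frobenius u v) ⟩
      (u , v) · (ℤ.- u , v)           ≈⟨ mul₀ u v (ℤ.- u) v ⟩
      (u ℤ.* v ℤ.+ ℤ.- u ℤ.* v , u ℤ.* ℤ.- u ℤ.* D ℤ.+ v ℤ.* v) ≈⟨ ≋-reflexive (lemma₁ u v) (lemma₂ D u v) ⟩
      const (v ℤ.* v ℤ.- D ℤ.* (u ℤ.* u)) ≈⟨ const-cong (root-determines-norm {z = z} (root-irrational nΔ r) r) ⟨
      const (ν z)                     ∎
      where
      lemma₁ : ∀ u v → u ℤ.* v ℤ.+ ℤ.- u ℤ.* v ≡ + 0
      lemma₁ = solve-∀
      lemma₂ : ∀ D u v → u ℤ.* ℤ.- u ℤ.* D ℤ.+ v ℤ.* v ≡ v ℤ.* v ℤ.- D ℤ.* (u ℤ.* u)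
      lemma₂ = solve-∀

    root≉0 : ∀ {z θ} → Nonresidue p (Δ z) → Root p D z θ → ¬ θ ≋ 𝟘 [ p ]
    root≉0 nΔ r (u≈0 ∙ _) = root-irrational nΔ r u≈0

    power-transfer : ∀ {z θ} k {a} → Root p D z θ →
      Quadratic._↑_ p (+ proj₁ z) (+ proj₂ z) (+ 1 , + 0) k ≋ (+ 0 , a) [ p ] → θ ↑ k ≋ const a [ p ]
    power-transfer {z} {θ} k (root r) = Evaluation.power-at-root p (+ proj₁ z) (+ proj₂ z) p (+ 0) D ℕ.∣-refl θ r k

    -- Comparing with `conjugate` gives (θ^(k+1))^p = θ^p. Raising to the p-th power once more
    -- undoes Frobenius, which has order two, and leaves θ^(k+1) = θ.
    frobenius-power : ∀ {z θ} k → Nonresidue p (Δ z) → Root p D z θ →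
      θ ↑ suc (p * suc k) ≋ const (ν z) [ p ] → θ ↑ k ≋ 𝟙 [ p ]
    frobenius-power {z} {θ} k nΔ r e = ·-cancelˡ θ _ _ θ≉0 (begin
      θ ↑ suc k                     ≈⟨ ↑p²≋id (θ ↑ suc k) ⟨
      (θ ↑ suc k) ↑ (p * p)         ≈⟨ ^-assocʳ (θ ↑ suc k) p p ⟨
      ((θ ↑ suc k) ↑ p) ↑ p         ≈⟨ ^-congˡ p (^-assocʳ θ (suc k) p) ⟩
      (θ ↑ (suc k * p)) ↑ p         ≡⟨ cong (λ m → (θ ↑ m) ↑ p) (ℕₚ.*-comm (suc k) p) ⟩
      (θ ↑ (p * suc k)) ↑ p         ≈⟨ ^-congˡ p (·-cancelˡ θ _ _ θ≉0 (≋-trans e (≋-sym (conjugate nΔ r)))) ⟩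
      (θ ↑ p) ↑ p                   ≈⟨ ^-assocʳ θ p p ⟩
      θ ↑ (p * p)                   ≈⟨ ↑p²≋id θ ⟩
      θ                             ≈⟨ ·-identityʳ θ ⟨
      θ · 𝟙                         ∎)
      where
      θ≉0 = root≉0 nΔ r

    square-roots-of-1 : ∀ x → x · x ≋ 𝟙 [ p ] → x ≋ 𝟙 [ p ] ⊎ x ≋ const -[1+ 0 ] [ p ]
    square-roots-of-1 (u , v) e with ≋-trans (≋-sym (mul₀ u v u v)) e
    ... | e₁ ∙ e₂ = [ (λ { (a ∙ b) → inj₁ (a ∙ -≈0⇒≈ b) }) , (λ { (a ∙ b) → inj₂ (a ∙ -≈0⇒≈ b) }) ]′
      (no-zero-divisors (u , v ℤ.- + 1) (u , v ℤ.- -[1+ 0 ]) (≋-trans (mul₀ u _ u _)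
        (≈-by₁ (+ 1) e₁ (lemma₁ u v) ∙ ≈-by₁ (+ 1) e₂ (lemma₂ D u v))))
      where
      lemma₁ : ∀ u v → u ℤ.* (v ℤ.- -[1+ 0 ]) ℤ.+ u ℤ.* (v ℤ.- + 1) ≡ + 0 ℤ.+ + 1 ℤ.* (u ℤ.* v ℤ.+ u ℤ.* v ℤ.- + 0)
      lemma₁ = solve-∀
      lemma₂ : ∀ D u v → u ℤ.* u ℤ.* D ℤ.+ (v ℤ.- + 1) ℤ.* (v ℤ.- -[1+ 0 ]) ≡
        + 0 ℤ.+ + 1 ℤ.* (u ℤ.* u ℤ.* D ℤ.+ v ℤ.* v ℤ.- + 1)
      lemma₂ = solve-∀

    -1↑odd : ∀ {s} → Odd s → const -[1+ 0 ] ↑ s ≋ const -[1+ 0 ] [ p ]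
    -1↑odd {s} o = ≋-trans (const-↑ -[1+ 0 ] s) (≋-reflexive refl (-1^odd o))

    𝟙≉-1 : ¬ 𝟙 ≋ const -[1+ 0 ] [ p ]
    𝟙≉-1 (_ ∙ e) = 1≉-1 e

    -- Induction on the exponent of 2. The element x^(2^e) is a square root of 1. It is not -1,
    -- since its s-th power is 1 while (-1)^s = -1.
    odd-order∧2-power-order : ∀ {s} → Odd s → ∀ e x → x ↑ s ≋ 𝟙 [ p ] → x ↑ (2 ^ e) ≋ 𝟙 [ p ] → x ≋ 𝟙 [ p ]
    odd-order∧2-power-order o zero    x _ x≋1 = ≋-trans (≋-sym (·-identityʳ x)) x≋1
    odd-order∧2-power-order {s} o (suc e) x xˢ≋1 x²≋1 =
      [ odd-order∧2-power-order o e x xˢ≋1 , (λ y≋-1 → contradiction (begin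
          𝟙                        ≈⟨ 1↑ (2 ^ e) ⟨
          𝟙 ↑ (2 ^ e)              ≈⟨ ^-congˡ (2 ^ e) xˢ≋1 ⟨
          (x ↑ s) ↑ (2 ^ e)        ≈⟨ ^-assocʳ x s (2 ^ e) ⟩
          x ↑ (s * 2 ^ e)          ≡⟨ cong (x ↑_) (ℕₚ.*-comm s (2 ^ e)) ⟩
          x ↑ (2 ^ e * s)          ≈⟨ ^-assocʳ x (2 ^ e) s ⟨
          (x ↑ (2 ^ e)) ↑ s        ≈⟨ ^-congˡ s y≋-1 ⟩
          const -[1+ 0 ] ↑ s       ≈⟨ -1↑odd o ⟩
          const -[1+ 0 ]           ∎) 𝟙≉-1) ]′
      (square-roots-of-1 (x ↑ (2 ^ e)) (begin
        x ↑ (2 ^ e) · x ↑ (2 ^ e)  ≈⟨ ^-homo-* x (2 ^ e) (2 ^ e) ⟨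
        x ↑ (2 ^ e + 2 ^ e)        ≡⟨ cong (λ k → x ↑ (2 ^ e + k)) (ℕₚ.+-identityʳ (2 ^ e)) ⟨
        x ↑ (2 ^ suc e)            ≈⟨ x²≋1 ⟩
        𝟙                          ∎))

    ↑[2^val*odd-part]≋𝟙 : ∀ θ → ¬ θ ≋ 𝟘 [ p ] → θ ↑ (2 ^ val p * odd-part p) ≋ 𝟙 [ p ]
    ↑[2^val*odd-part]≋𝟙 θ θ≉0 = subst (λ k → θ ↑ k ≋ 𝟙 [ p ]) p²-1≡ (↑[p²-1]≋𝟙 θ θ≉0)

    -- The exponent s belongs to n and may be far too large for counting roots. It is replaced by
    -- the odd part of p² - 1: the power θ^(odd-part p) is killed both by the odd s and by a power
    -- of 2.
    one-power : ∀ {s} → Odd s → ∀ θ → ¬ θ ≋ 𝟘 [ p ] → θ ↑ s ≋ 𝟙 [ p ] → θ ↑ odd-part p ≋ 𝟙 [ p ]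
    one-power {s} o θ θ≉0 e = odd-order∧2-power-order o (val p) (θ ↑ odd-part p)
      (≋-trans (^-assocʳ θ (odd-part p) s) (↑≈1⇒↑multiple≈1 θ (ℕ.n∣m*n (odd-part p)) e))
      (≋-trans (^-assocʳ θ (odd-part p) (2 ^ val p)) (≋-trans
        (≋-reflexive′ (cong (θ ↑_) (ℕₚ.*-comm (odd-part p) (2 ^ val p)))) (↑[2^val*odd-part]≋𝟙 θ θ≉0)))
      where
      ≋-reflexive′ : ∀ {x y} → x ≡ y → x ≋ y [ p ]
      ≋-reflexive′ refl = ≋-refl

    -- The same replacement of s: the element -θ^(2^j · odd-part p) is killed by s, because all the
    -- signs involved are odd powers of -1, and also by 2^(val p). So it is 1.
    negated-power : ∀ {s} → Odd s → ∀ j θ → ¬ θ ≋ 𝟘 [ p ] → θ ↑ (2 ^ j * s) ≋ const -[1+ 0 ] [ p ] →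
      θ ↑ (2 ^ j * odd-part p) ≋ const -[1+ 0 ] [ p ]
    negated-power {s} o j θ θ≉0 e = begin
      y                                     ≈⟨ ·-identityˡ y ⟨
      𝟙 · y                                 ≈⟨ ·-cong (const-* -[1+ 0 ] -[1+ 0 ]) ≋-refl ⟨
      const -[1+ 0 ] · const -[1+ 0 ] · y   ≈⟨ ·-assoc _ _ _ ⟩
      const -[1+ 0 ] · (const -[1+ 0 ] · y) ≈⟨ ·-cong ≋-refl (odd-order∧2-power-order o (val p) (const -[1+ 0 ] · y) odd 2-power) ⟩
      const -[1+ 0 ] · 𝟙                    ≈⟨ ·-identityʳ _ ⟩
      const -[1+ 0 ]                        ∎
      where
      y = θ ↑ (2 ^ j * odd-part p)
      odd : (const -[1+ 0 ] · y) ↑ s ≋ 𝟙 [ p ]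
      odd = begin
        (const -[1+ 0 ] · y) ↑ s              ≈⟨ ^-distrib-* (const -[1+ 0 ]) y s ⟩
        const -[1+ 0 ] ↑ s · y ↑ s            ≈⟨ ·-cong (-1↑odd o) (^-assocʳ θ (2 ^ j * odd-part p) s) ⟩
        const -[1+ 0 ] · θ ↑ (2 ^ j * odd-part p * s) ≡⟨ cong (λ k → const -[1+ 0 ] · θ ↑ k) (lemma (2 ^ j) (odd-part p) s) ⟩
        const -[1+ 0 ] · θ ↑ (2 ^ j * s * odd-part p) ≈⟨ ·-cong ≋-refl (^-assocʳ θ (2 ^ j * s) (odd-part p)) ⟨
        const -[1+ 0 ] · (θ ↑ (2 ^ j * s)) ↑ odd-part p ≈⟨ ·-cong ≋-refl (≋-trans (^-congˡ (odd-part p) e) (-1↑odd odd-part-odd)) ⟩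
        const -[1+ 0 ] · const -[1+ 0 ]       ≈⟨ const-* -[1+ 0 ] -[1+ 0 ] ⟩
        𝟙                                     ∎
        where
        lemma : ∀ a b c → a * b * c ≡ a * c * b
        lemma = ℕ-Solver.solve-∀
      -1↑even : ∀ k → const -[1+ 0 ] ↑ (2 * k) ≋ 𝟙 [ p ]
      -1↑even k = ↑≈1⇒↑*≈1 (const -[1+ 0 ]) 2 k (const-↑ -[1+ 0 ] 2)
      2-power : (const -[1+ 0 ] · y) ↑ (2 ^ val p) ≋ 𝟙 [ p ]
      2-power = begin
        (const -[1+ 0 ] · y) ↑ (2 ^ val p)               ≈⟨ ^-distrib-* (const -[1+ 0 ]) y (2 ^ val p) ⟩
        const -[1+ 0 ] ↑ (2 ^ val p) · y ↑ (2 ^ val p)   ≈⟨ ·-cong (subst (λ e → const -[1+ 0 ] ↑ (2 ^ e) ≋ 𝟙 [ p ]) (sym (proj₂ val≢0)) (-1↑even (2 ^ proj₁ val≢0)))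
                                                              (^-assocʳ θ (2 ^ j * odd-part p) (2 ^ val p)) ⟩
        𝟙 · θ ↑ (2 ^ j * odd-part p * 2 ^ val p)         ≈⟨ ·-identityˡ _ ⟩
        θ ↑ (2 ^ j * odd-part p * 2 ^ val p)             ≈⟨ ↑≈1⇒↑multiple≈1 θ (ℕ.divides (2 ^ j) (lemma (2 ^ j) (odd-part p) (2 ^ val p))) (↑[2^val*odd-part]≋𝟙 θ θ≉0) ⟩
        𝟙                                                ∎
        where
        lemma : ∀ a b c → a * b * c ≡ a * (c * b)
        lemma = ℕ-Solver.solve-∀

  -- Used with k = n / p - 1. The roots are then killed by both p² - 1 and k, hence by their gcd.
  frobenius-bound : ∀ k → 2 * ∑ (residuePairs p) (ind ∘ frobenius? p (p * suc k)) ≤ gcd (p * p ∸ 1) k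
  frobenius-bound k = minus-count (frobenius? p (p * suc k)) (gcd (p * p ∸ 1) k) {{gcd≢0}} (+ 1)
    (λ {z} P → χ≡-1⇒Nonresidue {p} {Δ z} (proj₁ P))
    (λ {z} nD P θ r → let nΔ = χ≡-1⇒Nonresidue {p} {Δ z} (proj₁ P) in
      Quadratic.↑gcd≈1 p (+ 0) _ θ (p * p ∸ 1) k
        (NonresidueField.↑[p²-1]≋𝟙 p pp h p≡1+2h _ nD θ (root≉0 nD nΔ r))
        (frobenius-power nD k nΔ r (power-transfer nD (suc (p * suc k)) r (proj₂ P))))
    where
    gcd≢0 : NonZero (gcd (p * p ∸ 1) k)
    gcd≢0 = ≢-nonZero λ e → ℕₚ.>⇒≢ 0<p²-1 (GCD.gcd[m,n]≡0⇒m≡0 e)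

  odd-part≢0 : NonZero (odd-part p)
  odd-part≢0 = subst NonZero (sym (proj₂ odd-part-odd)) _

  one-bound : ∀ {s} → Odd s → 2 * ∑ (residuePairs p) (ind ∘ power? p s (+ 1)) ≤ odd-part p
  one-bound {s} o = minus-count (power? p s (+ 1)) (odd-part p) {{odd-part≢0}} (+ 1)
    (λ {z} P → χ≡-1⇒Nonresidue {p} {Δ z} (proj₁ P))
    (λ {z} nD P θ r → let nΔ = χ≡-1⇒Nonresidue {p} {Δ z} (proj₁ P) in
      one-power nD o θ (root≉0 nD nΔ r) (power-transfer nD s r (proj₂ P)))

  negated-bound : ∀ {s} → Odd s → ∀ j →
    2 * ∑ (residuePairs p) (ind ∘ power? p (2 ^ j * s) -[1+ 0 ]) ≤ 2 ^ j * odd-part p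
  negated-bound {s} o j = minus-count (power? p (2 ^ j * s) -[1+ 0 ]) (2 ^ j * odd-part p)
    {{ℕₚ.m*n≢0 _ _ {{ℕₚ.m^n≢0 2 j}} {{odd-part≢0}}}} -[1+ 0 ]
    (λ {z} P → χ≡-1⇒Nonresidue {p} {Δ z} (proj₁ P))
    (λ {z} nD P θ r → let nΔ = χ≡-1⇒Nonresidue {p} {Δ z} (proj₁ P) in
      negated-power nD o j θ (root≉0 nD nΔ r) (power-transfer nD (2 ^ j * s) r (proj₂ P)))

  -- If x^m = w with 2m = n + 1, the norm of x is w², so x^((p²-1)/2) = (w²)^((p-1)/2) = 1.
  negated-exponent : ∀ {s} → Odd s → ∀ j m {w} z → Power p (2 ^ j * s) -[1+ 0 ] z →
    Quadratic._↑_ p (+ proj₁ z) (+ proj₂ z) (+ 1 , + 0) m ≋ (+ 0 , w) [ p ] →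
    Quadratic._↑_ p (+ proj₁ z) (+ proj₂ z) (+ 1 , + 0) (2 * m) ≋ (+ 0 , ν z) [ p ] →
    suc (suc j) ≤ val p
  negated-exponent {s} o j m {w} z (χ≡-1 , xʲ≋-1) xᵐ≋w x²ᵐ≋ν with suc (suc j) ≤? val p
  ... | yes j+2≤val = j+2≤val
  ... | no  j+2≰val = ⊥-elim (1≉-1 (1-part (≋-trans (≋-sym θ^≋1)
                        (negated-power nD o j θ θ≉0 (power-transfer nD (2 ^ j * s) r xʲ≋-1)))))
    where
    nD = χ≡-1⇒Nonresidue {p} {Δ z} χ≡-1
    open Quadratic p (+ 0) (Δ z)
    open import Relation.Binary.Reasoning.Setoid ≋-setoid
    -- The field of √Δ contains the roots of x² - bx - c itself, so D = Δ z plays both roles.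
    rt = root-exists {z = z} nD nD
    θ : ℤ × ℤ
    θ = proj₁ rt , proj₁ (proj₂ rt)
    r : Root p (Δ z) z θ
    r = proj₂ (proj₂ (proj₂ rt))
    θ≉0 : ¬ θ ≋ 𝟘 [ p ]
    θ≉0 = root≉0 nD nD r
    -- With this e the product 2^e · odd-part p is (p² - 1) / 2, and the negated conclusion becomes
    -- e ≤ j.
    e = proj₁ val≢0
    e≤j : e ≤ j
    e≤j = ℕₚ.≤-pred (subst (_≤ suc j) (proj₂ val≢0) (ℕₚ.≤-pred (ℕₚ.≰⇒> j+2≰val)))
    w²≈ν : w ℤ.^ 2 ≈ ν z [ p ]
    w²≈ν = 1-part (begin
      const (w ℤ.^ 2)   ≈⟨ const-↑ w 2 ⟨
      const w ↑ 2       ≈⟨ ^-congˡ 2 (power-transfer nD m r xᵐ≋w) ⟨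
      (θ ↑ m) ↑ 2       ≈⟨ ^-assocʳ θ m 2 ⟩
      θ ↑ (m * 2)       ≡⟨ cong (θ ↑_) (ℕₚ.*-comm m 2) ⟩
      θ ↑ (2 * m)       ≈⟨ power-transfer nD (2 * m) r x²ᵐ≋ν ⟩
      const (ν z)       ∎)
    -- Otherwise the norm θ · θ^p = w² would vanish in a field although θ ≠ 0.
    w≉0 : ¬ w ≈ + 0 [ p ]
    w≉0 w≈0 = [ θ≉0 , θᵖ≉0 ]′ (NonresidueField.no-zero-divisors p pp h p≡1+2h (Δ z) nD θ (θ ↑ p)
        (≋-trans (conjugate nD nD r) (const-cong (≈-trans (≈-sym w²≈ν) (≈-*ʳ (w ℤ.* + 1) w≈0)))))
      where
      θᵖ≉0 : ¬ θ ↑ p ≋ 𝟘 [ p ]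
      θᵖ≉0 e = θ≉0 (≋-trans (≋-sym (NonresidueField.↑p²≋id p pp h p≡1+2h (Δ z) nD θ))
        (≋-trans (≋-sym (^-assocʳ θ p p)) (≋-trans (^-congˡ p e)
          (subst (λ k → 𝟘 ↑ k ≋ 𝟘 [ p ]) (ℕₚ.suc-pred p) (0↑ (pred p))))))
    half-exponent : h * suc p ≡ 2 ^ e * odd-part p
    half-exponent = ℕₚ.*-cancelˡ-≡ _ _ 2 (trans (sym p²-1≡2[h[p+1]]) (trans p²-1≡
      (trans (cong (λ k → 2 ^ k * odd-part p) (proj₂ val≢0)) (ℕₚ.*-assoc 2 (2 ^ e) (odd-part p)))))
    θ^half≋1 : θ ↑ (2 ^ e * odd-part p) ≋ 𝟙 [ p ]
    θ^half≋1 = begin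
      θ ↑ (2 ^ e * odd-part p) ≡⟨ cong (θ ↑_) (trans (ℕₚ.*-comm (suc p) h) half-exponent) ⟨
      θ ↑ (suc p * h)          ≈⟨ ^-assocʳ θ (suc p) h ⟨
      (θ ↑ suc p) ↑ h          ≈⟨ ^-congˡ h (conjugate nD nD r) ⟩
      const (ν z) ↑ h          ≈⟨ ^-congˡ h (const-cong w²≈ν) ⟨
      const (w ℤ.^ 2) ↑ h      ≈⟨ const-↑ (w ℤ.^ 2) h ⟩
      const ((w ℤ.^ 2) ℤ.^ h)  ≡⟨ cong const (trans (ℤₚ.^-*-assoc w 2 h) (cong (w ℤ.^_) (sym (cong (_∸ 1) p≡1+2h)))) ⟩
      const (w ℤ.^ (p ∸ 1))    ≈⟨ const-cong (fermat-unit pp w≉0) ⟩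
      𝟙                        ∎
    θ^≋1 : θ ↑ (2 ^ j * odd-part p) ≋ 𝟙 [ p ]
    θ^≋1 = ↑≈1⇒↑multiple≈1 θ (ℕ.*-monoˡ-∣ (odd-part p) (^-mono-∣ e≤j)) θ^half≋1

-- Balance of the two signs of χ(Δ) χ(-c) modulo a prime

module SameDiff (p : ℕ) (pp : Prime p) (h : ℕ) (p≡1+2h : p ≡ suc (2 * h)) where
  open OddPrime p pp h p≡1+2h

  private instance
    p≢0 : NonZero p
    p≢0 = ℕ.prime⇒nonZero pp

  nonzeros : ℕ
  nonzeros = ∑ (upTo p) (λ b → ind (¬? (b ≟ 0)))

  -- The pairs are sorted by u = 4ν / Δ. As 4 and Δ² are squares, χ(Δ) χ(ν) = χ(u), so the sign
  -- depends on u only.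
  Ratio : ℕ → ℕ × ℕ → Set
  Ratio u z = (¬ Δ z ≈ + 0 [ p ]) × (+ 4 ℤ.* ν z ≈ + u ℤ.* Δ z [ p ])

  ratio? : ∀ u z → Dec (Ratio u z)
  ratio? u z = ¬? (Δ z ≈? + 0) ×-dec (+ 4 ℤ.* ν z ≈? + u ℤ.* Δ z)

  ℕ≈0⇒≡0 : ∀ {b} → b < p → + b ≈ + 0 [ p ] → b ≡ 0
  ℕ≈0⇒≡0 b<p = residue-unique b<p (>-nonZero⁻¹ p)

  square≈0 : ∀ {b} → b ℤ.* b ≈ + 0 [ p ] → b ≈ + 0 [ p ]
  square≈0 e = [ id , id ]′ (≈-prime pp e)

  -- For 1 + u = 0 the condition says b = 0 and c ≠ 0; otherwise every b ≠ 0 determines c.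
  count-ratio : ∀ u → ∑ (residuePairs p) (ind ∘ ratio? u) ≡ nonzeros
  count-ratio u with + 1 ℤ.+ + u ≈? + 0
  ... | yes 1+u≈0 = begin
    ∑ (residuePairs p) (ind ∘ ratio? u)                          ≡⟨ ∑-cartesian (upTo p) (upTo p) _ ⟩
    ∑ (upTo p) (λ b → ∑ (upTo p) (λ c → ind (ratio? u (b , c)))) ≡⟨ ∑-cong (upTo p) (λ {b} b∈ → ∑-cong (upTo p) (λ {c} c∈ → same b∈ c∈)) ⟩
    ∑ (upTo p) (λ b → ∑ (upTo p) (λ c → ind (b ≟ 0) * ind (¬? (c ≟ 0)))) ≡⟨ ∑-cong (upTo p) (λ {b} _ → ∑-*ˡ (upTo p) (ind (b ≟ 0)) _) ⟩
    ∑ (upTo p) (λ b → ind (b ≟ 0) * nonzeros)                    ≡⟨ ∑-*ʳ (upTo p) nonzeros _ ⟩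
    ∑ (upTo p) (λ b → ind (b ≟ 0)) * nonzeros                    ≡⟨ cong (_* nonzeros) (∑-ind≡1 (_≟ 0) (upTo p) (upTo! p) (λ _ _ e e′ → trans e (sym e′)) (∈-upTo (>-nonZero⁻¹ p)) refl) ⟩
    1 * nonzeros                                                 ≡⟨ ℕₚ.*-identityˡ nonzeros ⟩
    nonzeros                                                     ∎
    where
    open ≡-Reasoning
    same : ∀ {b c} → b ∈ upTo p → c ∈ upTo p → ind (ratio? u (b , c)) ≡ ind (b ≟ 0) * ind (¬? (c ≟ 0))
    same {b} {c} b∈ c∈ = trans (ind-cong (ratio? u (b , c)) ((b ≟ 0) ×-dec ¬? (c ≟ 0)) to from) (ind-× (b ≟ 0) (¬? (c ≟ 0)))
      where
      lemma : ∀ b c u → b ℤ.* b ≡ + 0 ℤ.+ (b ℤ.* b ℤ.+ + 4 ℤ.* c) ℤ.* (+ 1 ℤ.+ u ℤ.- + 0)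
        ℤ.+ + 1 ℤ.* (+ 4 ℤ.* ℤ.- c ℤ.- u ℤ.* (b ℤ.* b ℤ.+ + 4 ℤ.* c))
      lemma = solve-∀
      to : Ratio u (b , c) → b ≡ 0 × c ≢ 0
      to (Δ≉0 , e) = ℕ≈0⇒≡0 (∈-upTo⇒< b∈) b≈0 , λ { refl → Δ≉0 (≈-trans (≈-reflexive (ℤₚ.+-identityʳ (+ b ℤ.* + b))) (≈-* b≈0 b≈0)) }
        where
        b≈0 : + b ≈ + 0 [ p ]
        b≈0 = square≈0 (≈-by₂ (Δ (b , c)) (+ 1) 1+u≈0 e (lemma (+ b) (+ c) (+ u)))
      from : b ≡ 0 × c ≢ 0 → Ratio u (b , c)
      from (refl , c≢0) = (λ e → [ 4≉0 , c≢0 ∘ ℕ≈0⇒≡0 (∈-upTo⇒< c∈) ]′ (≈-prime {a = + 4} {+ c} pp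
          (≈-trans (≈-reflexive (sym (ℤₚ.+-identityˡ (+ 4 ℤ.* + c)))) e)))
        , ≈-by₁ (ℤ.- (+ 4 ℤ.* + c)) 1+u≈0 (lemma′ (+ c) (+ u))
        where
        lemma′ : ∀ c u → + 4 ℤ.* ℤ.- c ≡ u ℤ.* (+ 0 ℤ.* + 0 ℤ.+ + 4 ℤ.* c) ℤ.+ ℤ.- (+ 4 ℤ.* c) ℤ.* (+ 1 ℤ.+ u ℤ.- + 0)
        lemma′ = solve-∀
  ... | no 1+u≉0 = begin
    ∑ (residuePairs p) (ind ∘ ratio? u)                          ≡⟨ ∑-cartesian (upTo p) (upTo p) _ ⟩
    ∑ (upTo p) (λ b → ∑ (upTo p) (λ c → ind (ratio? u (b , c)))) ≡⟨ ∑-cong (upTo p) (λ {b} b∈ → column b b∈) ⟩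
    nonzeros                                                     ∎
    where
    open ≡-Reasoning
    i = proj₁ (≈-inverse pp 1+u≉0)
    [1+u]i≈1 = proj₂ (≈-inverse pp 1+u≉0)
    k = proj₁ (≈-inverse pp 4≉0)
    4k≈1 = proj₂ (≈-inverse pp 4≉0)
    b²≈ : ∀ {b c} → Ratio u (b , c) → + b ℤ.* + b ≈ (+ 1 ℤ.+ + u) ℤ.* Δ (b , c) [ p ]
    b²≈ {b} {c} (_ , e) = ≈-by₁ (+ 1) e (lemma (+ b) (+ c) (+ u))
      where
      lemma : ∀ b c u → b ℤ.* b ≡ (+ 1 ℤ.+ u) ℤ.* (b ℤ.* b ℤ.+ + 4 ℤ.* c)
        ℤ.+ + 1 ℤ.* (+ 4 ℤ.* ℤ.- c ℤ.- u ℤ.* (b ℤ.* b ℤ.+ + 4 ℤ.* c))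
      lemma = solve-∀
    column : ∀ b → b ∈ upTo p → ∑ (upTo p) (λ c → ind (ratio? u (b , c))) ≡ ind (¬? (b ≟ 0))
    column b b∈ with b ≟ 0
    ... | yes refl = ∑≡0 (upTo p) λ {c} _ → ind-false (ratio? u (0 , c)) λ rt →
          [ 1+u≉0 , proj₁ rt ]′ (≈-prime pp (≈-sym (b²≈ {0} {c} rt)))
    ... | no b≢0 = trans (∑-ind≡1 (λ c → ratio? u (b , c)) (upTo p) (upTo! p) unique (∈-upTo (residue< p c₀)) exists)
                         (sym (ind-true (¬? (b ≟ 0)) b≢0))
      where
      unique : ∀ {c c′} → c ∈ upTo p → c′ ∈ upTo p → Ratio u (b , c) → Ratio u (b , c′) → c ≡ c′
      unique {c} {c′} c∈ c′∈ rt rt′ = residue-unique (∈-upTo⇒< c∈) (∈-upTo⇒< c′∈)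
        (≈-cancelˡ (+ 4) pp 4≉0 (≈-cancelˡ (+ 1 ℤ.+ + u) pp 1+u≉0
          (≈-by₂ (ℤ.- + 1) (+ 1) (b²≈ {b} {c} rt) (b²≈ {b} {c′} rt′) (lemma (+ b) (+ c) (+ c′) (+ u)))))
        where
        lemma : ∀ b c c′ u → (+ 1 ℤ.+ u) ℤ.* (+ 4 ℤ.* c) ≡ (+ 1 ℤ.+ u) ℤ.* (+ 4 ℤ.* c′)
          ℤ.+ ℤ.- + 1 ℤ.* (b ℤ.* b ℤ.- (+ 1 ℤ.+ u) ℤ.* (b ℤ.* b ℤ.+ + 4 ℤ.* c))
          ℤ.+ + 1 ℤ.* (b ℤ.* b ℤ.- (+ 1 ℤ.+ u) ℤ.* (b ℤ.* b ℤ.+ + 4 ℤ.* c′))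
        lemma = solve-∀
      -- The solution c of b² = (1 + u) Δ: with i = 1 / (1 + u) and k = 1 / 4 it is Δ = b² i and c =
      -- (Δ - b²) k.
      c₀ : ℤ
      c₀ = (+ b ℤ.* + b ℤ.* i ℤ.- + b ℤ.* + b) ℤ.* k
      c = residue p c₀
      Δ≈ : Δ (b , c) ≈ + b ℤ.* + b ℤ.* i [ p ]
      Δ≈ = ≈-by₂ (+ 4) (+ b ℤ.* + b ℤ.* i ℤ.- + b ℤ.* + b) (residue≈ p c₀) 4k≈1 (lemma (+ b) (+ c) i k)
        where
        lemma : ∀ b c i k → b ℤ.* b ℤ.+ + 4 ℤ.* c ≡ b ℤ.* b ℤ.* i
          ℤ.+ + 4 ℤ.* (c ℤ.- (b ℤ.* b ℤ.* i ℤ.- b ℤ.* b) ℤ.* k)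
          ℤ.+ (b ℤ.* b ℤ.* i ℤ.- b ℤ.* b) ℤ.* (+ 4 ℤ.* k ℤ.- + 1)
        lemma = solve-∀
      b≉0 : ¬ + b ≈ + 0 [ p ]
      b≉0 = b≢0 ∘ ℕ≈0⇒≡0 (∈-upTo⇒< b∈)
      i≉0 : ¬ i ≈ + 0 [ p ]
      i≉0 i≈0 = 1≉0 (≈-trans (≈-sym [1+u]i≈1) (≈-trans (≈-*ˡ (+ 1 ℤ.+ + u) i≈0) (≈-reflexive (ℤₚ.*-zeroʳ (+ 1 ℤ.+ + u)))))
      exists : Ratio u (b , c)
      exists = (λ e → ≉0-* (≉0-* b≉0 b≉0) i≉0 (≈-trans (≈-sym Δ≈) e))
        , ≈-by₂ (ℤ.- (+ 1 ℤ.+ + u)) (ℤ.- (+ b ℤ.* + b)) Δ≈ [1+u]i≈1 (lemma (+ b) (+ c) (+ u) i)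
        where
        lemma : ∀ b c u i → + 4 ℤ.* ℤ.- c ≡ u ℤ.* (b ℤ.* b ℤ.+ + 4 ℤ.* c)
          ℤ.+ ℤ.- (+ 1 ℤ.+ u) ℤ.* (b ℤ.* b ℤ.+ + 4 ℤ.* c ℤ.- b ℤ.* b ℤ.* i)
          ℤ.+ ℤ.- (b ℤ.* b) ℤ.* ((+ 1 ℤ.+ u) ℤ.* i ℤ.- + 1)
        lemma = solve-∀

  χ-square : ∀ {z} → ¬ z ≈ + 0 [ p ] → χ p z ℤ.* χ p z ≡ + 1
  χ-square {z} z≉0 with χ p z | χ-view p z
  ... | _ | is-zero z≈0     = contradiction z≈0 z≉0
  ... | _ | is-residue _ _  = refl
  ... | _ | is-nonresidue _ = refl

  χ-4 : χ p (+ 4) ≡ + 1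
  χ-4 = χ-is-residue 4≉0 (+ 2 , ≈-refl)

  χχ? : ∀ v z → Dec (χ p (Δ z) ℤ.* χ p (ν z) ≡ v)
  χχ? v z = χ p (Δ z) ℤ.* χ p (ν z) ℤ.≟ v

  ratio-χ : ∀ {u z} → Ratio u z → χ p (Δ z) ℤ.* χ p (ν z) ≡ χ p (+ u)
  ratio-χ {u} {z} (Δ≉0 , e) = begin
    χ p (Δ z) ℤ.* χ p (ν z)                        ≡⟨ cong (χ p (Δ z) ℤ.*_) (trans (sym (ℤₚ.*-identityˡ (χ p (ν z)))) (cong (ℤ._* χ p (ν z)) (sym χ-4))) ⟩
    χ p (Δ z) ℤ.* (χ p (+ 4) ℤ.* χ p (ν z))        ≡⟨ cong (χ p (Δ z) ℤ.*_) (trans (sym (χ-* (+ 4) (ν z))) (trans (χ-cong p e) (χ-* (+ u) (Δ z)))) ⟩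
    χ p (Δ z) ℤ.* (χ p (+ u) ℤ.* χ p (Δ z))        ≡⟨ lemma (χ p (Δ z)) (χ p (+ u)) ⟩
    χ p (+ u) ℤ.* (χ p (Δ z) ℤ.* χ p (Δ z))        ≡⟨ cong (χ p (+ u) ℤ.*_) (χ-square Δ≉0) ⟩
    χ p (+ u) ℤ.* + 1                              ≡⟨ ℤₚ.*-identityʳ _ ⟩
    χ p (+ u)                                      ∎
    where
    open ≡-Reasoning
    lemma : ∀ a b → a ℤ.* (b ℤ.* a) ≡ b ℤ.* (a ℤ.* a)
    lemma = solve-∀

  -- By `count-ratio` every u accounts for equally many pairs, and `ratio-χ` turns the sign of a
  -- pair into χ(u). The condition v ≠ 0 ensures Δ ≠ 0, so that the ratio exists.
  count-χχ : ∀ v → v ≢ + 0 → ∑ (residuePairs p) (ind ∘ χχ? v) ≡ count-χ v * nonzeros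
  count-χχ v v≢0 = trans
    (double-count-≡ (residuePairs p) (upTo p) (λ z u → ind (χ p (+ u) ℤ.≟ v) * ind (ratio? u z))
      (λ {z} _ → row z) (λ {u} _ → trans (∑-*ˡ (residuePairs p) (ind (χ p (+ u) ℤ.≟ v)) (ind ∘ ratio? u))
        (cong (λ k → ind (χ p (+ u) ℤ.≟ v) * k) (count-ratio u))))
    (∑-*ʳ (upTo p) nonzeros (λ u → ind (χ p (+ u) ℤ.≟ v)))
    where
    row? : ∀ z u → Dec (χ p (+ u) ≡ v × Ratio u z)
    row? z u = (χ p (+ u) ℤ.≟ v) ×-dec ratio? u z
    row : ∀ z → ∑ (upTo p) (λ u → ind (χ p (+ u) ℤ.≟ v) * ind (ratio? u z)) ≡ ind (χχ? v z)
    row z = trans (∑-cong (upTo p) (λ {u} _ → sym (ind-× (χ p (+ u) ℤ.≟ v) (ratio? u z)))) (helper (χχ? v z))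
      where
      helper : (d : Dec (χ p (Δ z) ℤ.* χ p (ν z) ≡ v)) → ∑ (upTo p) (λ u → ind (row? z u)) ≡ ind d
      helper (no ¬e) = ∑≡0 (upTo p) λ {u} _ → ind-false (row? z u) λ (χu≡v , rt) → ¬e (trans (ratio-χ {u} {z} rt) χu≡v)
      helper (yes e) = ∑-ind≡1 (row? z) (upTo p) (upTo! p)
        (λ {u} {u′} u∈ u′∈ (_ , _ , r) (_ , _ , r′) → residue-unique (∈-upTo⇒< u∈) (∈-upTo⇒< u′∈)
          (≈-cancelˡ (Δ z) pp Δ≉0 (≈-trans (≈-reflexive (ℤₚ.*-comm (Δ z) (+ u)))
            (≈-trans (≈-sym r) (≈-trans r′ (≈-reflexive (ℤₚ.*-comm (+ u′) (Δ z))))))))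
        (∈-upTo (residue< p u₀)) (trans (sym (ratio-χ {residue p u₀} {z} rt)) e , rt)
        where
        Δ≉0 : ¬ Δ z ≈ + 0 [ p ]
        Δ≉0 Δ≈0 = v≢0 (trans (sym e) (trans (cong (ℤ._* χ p (ν z)) (χ-is-zero Δ≈0)) (ℤₚ.*-zeroˡ (χ p (ν z)))))
        i = proj₁ (≈-inverse pp Δ≉0)
        Δi≈1 = proj₂ (≈-inverse pp Δ≉0)
        u₀ = + 4 ℤ.* ν z ℤ.* i
        rt : Ratio (residue p u₀) z
        rt = Δ≉0 , ≈-by₂ (ℤ.- (+ 4 ℤ.* ν z)) (ℤ.- Δ z) Δi≈1 (residue≈ p u₀) (lemma (ν z) (Δ z) i (+ residue p u₀))
          where
          lemma : ∀ n d i u → + 4 ℤ.* n ≡ u ℤ.* d ℤ.+ ℤ.- (+ 4 ℤ.* n) ℤ.* (d ℤ.* i ℤ.- + 1)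
            ℤ.+ ℤ.- d ℤ.* (u ℤ.- + 4 ℤ.* n ℤ.* i)
          lemma = solve-∀

  same≡diff : ∑ (residuePairs p) (ind ∘ χχ? (+ 1)) ≡ ∑ (residuePairs p) (ind ∘ χχ? -[1+ 0 ])
  same≡diff = trans (count-χχ (+ 1) λ ()) (trans (cong (_* nonzeros) residues≡nonresidues) (sym (count-χχ -[1+ 0 ] λ ())))

-- Chinese remaindering of sums over parameter pairs

length-residuePairs : ∀ m → length (residuePairs m) ≡ m * m
length-residuePairs m = trans (length-cartesianProduct (upTo m) (upTo m)) (cong₂ _*_ (Listₚ.length-upTo m) (Listₚ.length-upTo m))

Periodic : {A : Set} → ℕ → (ℕ × ℕ → A) → Set
Periodic m F = ∀ {z z′} → embed z ≋ embed z′ [ m ] → F z ≡ F z′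

-- Reduction modulo p and modulo N is injective on pairs by the Chinese remainder theorem, and (pN)²
-- = p² N² makes the two index lists equally long, so `∑-reindex` applies.
crt-∑ : ∀ {p N} .{{_ : NonZero p}} .{{_ : NonZero N}} → Coprime p N → {F G : ℕ × ℕ → ℕ} →
        Periodic p F → Periodic N G →
        ∑ (residuePairs (p * N)) (λ z → F z * G z) ≡ ∑ (residuePairs p) F * ∑ (residuePairs N) G
crt-∑ {p} {N} cop {F} {G} perF perG = begin
  ∑ (residuePairs (p * N)) (λ z → F z * G z)      ≡⟨ ∑-cong (residuePairs (p * N)) (λ {z} _ → cong₂ _*_ (perF (reduce≈ p z)) (perG (reduce≈ N z))) ⟩
  ∑ (residuePairs (p * N)) (g ∘ π)                ≡⟨ ∑-reindex (≡-dec (≡-dec _≟_ _≟_) (≡-dec _≟_ _≟_)) (residuePairs! (p * N))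
                                                       (Uniqueₚ.cartesianProduct⁺ (residuePairs! p) (residuePairs! N)) lengths π
                                                       (λ {z} _ → ∈ₚ.∈-cartesianProduct⁺ (reduce∈ p z) (reduce∈ N z)) injective g ⟩
  ∑ (cartesianProduct (residuePairs p) (residuePairs N)) g ≡⟨ ∑-cartesian (residuePairs p) (residuePairs N) g ⟩
  ∑ (residuePairs p) (λ x → ∑ (residuePairs N) (λ y → F x * G y)) ≡⟨ ∑-cong (residuePairs p) (λ {x} _ → ∑-*ˡ (residuePairs N) (F x) G) ⟩
  ∑ (residuePairs p) (λ x → F x * ∑ (residuePairs N) G) ≡⟨ ∑-*ʳ (residuePairs p) (∑ (residuePairs N) G) F ⟩
  ∑ (residuePairs p) F * ∑ (residuePairs N) G     ∎
  where
  open ≡-Reasoning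
  reduce : ∀ m .{{_ : NonZero m}} → ℕ × ℕ → ℕ × ℕ
  reduce m (b , c) = b % m , c % m
  reduce≈ : ∀ m .{{_ : NonZero m}} z → embed z ≋ embed (reduce m z) [ m ]
  reduce≈ m (b , c) = ≈-sym (%-≈ b m) ∙ ≈-sym (%-≈ c m)
  reduce∈ : ∀ m .{{_ : NonZero m}} z → reduce m z ∈ residuePairs m
  reduce∈ m (b , c) = ∈-residuePairs (ℕ.m%n<n b m) (ℕ.m%n<n c m)
  π : ℕ × ℕ → (ℕ × ℕ) × (ℕ × ℕ)
  π z = reduce p z , reduce N z
  g : (ℕ × ℕ) × (ℕ × ℕ) → ℕ
  g (x , y) = F x * G y
  lengths : length (residuePairs (p * N)) ≡ length (cartesianProduct (residuePairs p) (residuePairs N))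
  lengths = trans (length-residuePairs (p * N)) (trans (lemma p N) (sym (trans (length-cartesianProduct (residuePairs p) (residuePairs N))
    (cong₂ _*_ (length-residuePairs p) (length-residuePairs N)))))
    where
    lemma : ∀ p N → p * N * (p * N) ≡ p * p * (N * N)
    lemma = ℕ-Solver.solve-∀
  congruent-mod : ∀ m .{{_ : NonZero m}} {z z′} → reduce m z ≡ reduce m z′ → embed z ≋ embed z′ [ m ]
  congruent-mod m {z} {z′} e with reduce≈ m z | reduce≈ m z′
  ... | a ∙ b | a′ ∙ b′ = ≈-trans a (≈-trans (≈-reflexive (cong (+_ ∘ proj₁) e)) (≈-sym a′))
                        ∙ ≈-trans b (≈-trans (≈-reflexive (cong (+_ ∘ proj₂) e)) (≈-sym b′))
  injective : ∀ {z z′} → z ∈ residuePairs (p * N) → z′ ∈ residuePairs (p * N) → π z ≡ π z′ → z ≡ z′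
  injective {z} {z′} z∈ z′∈ e with congruent-mod p {z} {z′} (cong proj₁ e) | congruent-mod N {z} {z′} (cong proj₂ e)
  ... | a ∙ b | a′ ∙ b′ = embed-injective z∈ z′∈ (≈-crt cop a a′ ∙ ≈-crt cop b b′)

-- Jacobi symbols and the size of M(n)

T-∧⁻ : ∀ {x y} → T (x ∧ y) → T x × T y
T-∧⁻ = Equivalence.to Boolₚ.T-∧

T-∧⁺ : ∀ {x y} → T x × T y → T (x ∧ y)
T-∧⁺ = Equivalence.from Boolₚ.T-∧

T-∨⁻ : ∀ {x y} → T (x ∨ y) → T x ⊎ T y
T-∨⁻ = Equivalence.to Boolₚ.T-∨

T-∨⁺ : ∀ {x y} → T x ⊎ T y → T (x ∨ y)
T-∨⁺ = Equivalence.from Boolₚ.T-∨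

T-does⁻ : {P : Set} (d : Dec P) → T (does d) → P
T-does⁻ (yes p) _ = p

T-does⁺ : {P : Set} (d : Dec P) → P → T (does d)
T-does⁺ (yes _) _ = tt
T-does⁺ (no ¬p) p = contradiction p ¬p

-- Invariant of the search: n has no nontrivial divisor below the candidate 2 + k. The function `f`
-- generalises `id`, because `applyUpTo` composes it with `suc` at every step.
firstDivisor-spec : ∀ n m (f : ℕ → ℕ) k → (∀ i → f i ≡ k + i) → (2 + k) ℕ.Rough n → 2 + k ≤ n → n < 2 + k + m →
  let d = firstDivisor n (map (λ d → 2 + d) (applyUpTo f m)) in d ∣ n × d ℕ.Rough n × 2 ≤ d
firstDivisor-spec n zero f k hf rough k≤ n< =
  contradiction k≤ (ℕₚ.<⇒≱ (subst (n <_) (ℕₚ.+-identityʳ (2 + k)) n<))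
firstDivisor-spec n (suc m) f k hf rough k≤ n< with n % (2 + f 0) ≡ᵇ 0 in divisible
... | true  = ℕ.m%n≡0⇒n∣m n (2 + f 0) (ℕₚ.≡ᵇ⇒≡ _ 0 (subst T (sym divisible) tt))
            , subst (ℕ._Rough n) (cong (λ i → 2 + i) (sym f0≡k)) rough , s≤s (s≤s z≤n)
  where
  f0≡k : f 0 ≡ k
  f0≡k = trans (hf 0) (ℕₚ.+-identityʳ k)
... | false = firstDivisor-spec n m (f ∘ suc) (suc k) (λ i → trans (hf (suc i)) (ℕₚ.+-suc k i))
    (ℕ.∤⇒rough-suc (λ d → ∤n (subst (λ i → 2 + i ∣ n) (sym f0≡k) d)) rough)
    (ℕₚ.≤∧≢⇒< k≤ (λ e → ∤n (subst (λ i → 2 + i ∣ n) (sym f0≡k) (ℕ.∣-reflexive e))))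
    (subst (n <_) (cong (λ i → 2 + i) (ℕₚ.+-suc k m)) n<)
  where
  f0≡k : f 0 ≡ k
  f0≡k = trans (hf 0) (ℕₚ.+-identityʳ k)
  ∤n : ¬ (2 + f 0) ∣ n
  ∤n d = subst T divisible (ℕₚ.≡⇒≡ᵇ _ 0 (ℕ.n∣m⇒m%n≡0 n (2 + f 0) d))

spf-spec : ∀ {n} → 1 < n → spf n ∣ n × spf n ℕ.Rough n × 2 ≤ spf n
spf-spec {n} 1<n = firstDivisor-spec n n id 0 (λ i → refl) ℕ.2-rough 1<n (ℕₚ.m≤n⇒m≤1+n (ℕₚ.n<1+n n))

spf∣ : ∀ {n} → 1 < n → spf n ∣ n
spf∣ = proj₁ ∘ spf-spec

spf-prime : ∀ {n} → 1 < n → Prime (spf n)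
spf-prime {n} 1<n = let d , rough , 2≤ = spf-spec 1<n in
  ℕ.rough∧∣⇒prime {{n>1⇒nonTrivial 2≤}} rough d

-- Follows the recursion of `jacobiAux` step by step, so that the Jacobi symbol becomes the product
-- `Χ` over this list.
factors : ℕ → ℕ → List ℕ
factors zero    n = []
factors (suc f) n = if n ≤ᵇ 1 then [] else spf n ∷ factors f (n div spf n)

div-* : ∀ {d n} → d ∣ n → 0 < d → d * (n div d) ≡ n
div-* {suc d} d∣n _ = ℕ.m*[n/m]≡n d∣n

0<prime : ∀ {p} → Prime p → 0 < p
0<prime {p} pp = >-nonZero⁻¹ p {{ℕ.prime⇒nonZero pp}}

1<prime : ∀ {p} → Prime p → 1 < p
1<prime {p} pp = nonTrivial⇒n>1 p {{ℕ.prime⇒nonTrivial pp}}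

1≤quotient : ∀ d {q n} → d * q ≡ n → 0 < n → 1 ≤ q
1≤quotient d {zero} e 0<n = contradiction (trans (sym e) (ℕₚ.*-zeroʳ d)) (ℕₚ.>⇒≢ 0<n)
1≤quotient d {suc _} _ _ = s≤s z≤n

factors-spec : ∀ f n → 0 < n → n ≤ f → All Prime (factors f n) × product (factors f n) ≡ n
factors-spec zero    (suc n) _ ()
factors-spec (suc f) n 0<n n≤f with n ≤ᵇ 1 in small
... | true  = [] , ℕₚ.≤-antisym 0<n (ℕₚ.≤ᵇ⇒≤ n 1 (subst T (sym small) tt))
... | false = let ps , e = factors-spec f q 0<q (ℕₚ.≤-pred (ℕₚ.<-≤-trans q<n n≤f))
              in spf-prime 1<n ∷ ps , trans (cong (spf n *_) e) dq≡n
  where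
  1<n : 1 < n
  1<n = ℕₚ.≰⇒> (λ n≤1 → subst T small (ℕₚ.≤⇒≤ᵇ n≤1))
  q = n div spf n
  dq≡n : spf n * q ≡ n
  dq≡n = div-* (spf∣ 1<n) (0<prime (spf-prime 1<n))
  0<q : 0 < q
  0<q = 1≤quotient (spf n) dq≡n 0<n
  q<n : q < n
  q<n = subst (q <_) (trans (ℕₚ.*-comm q (spf n)) dq≡n) (ℕₚ.m<m*n q (spf n) {{>-nonZero 0<q}} (1<prime (spf-prime 1<n)))

Χ : List ℕ → ℤ → ℤ
Χ []      z = + 1
Χ (p ∷ L) z = χ p z ℤ.* Χ L z

jacobiAux≡Χ : ∀ f n a → 0 < n → jacobiAux f a n ≡ Χ (factors f n) (+ a)
jacobiAux≡Χ zero    n a 0<n = refl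
jacobiAux≡Χ (suc f) n a 0<n with n ≤ᵇ 1 in small
... | true  = refl
... | false = cong₂ ℤ._*_ (legendre≡χ (spf n) {{ℕ.prime⇒nonZero (spf-prime 1<n)}} a)
    (jacobiAux≡Χ f (n div spf n) a (1≤quotient (spf n) (div-* (spf∣ 1<n) (0<prime (spf-prime 1<n))) 0<n))
  where
  1<n : 1 < n
  1<n = ℕₚ.≰⇒> (λ n≤1 → subst T small (ℕₚ.≤⇒≤ᵇ n≤1))

Χ-cong : ∀ {L} → All Prime L → ∀ {z w} → z ≈ w [ product L ] → Χ L z ≡ Χ L w
Χ-cong []                 e = refl
Χ-cong {p ∷ L} (pp ∷ pps) e = cong₂ ℤ._*_ (χ-cong p {{ℕ.prime⇒nonZero pp}} (≈-weaken (ℕ.m∣m*n (product L)) e))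
  (Χ-cong pps (≈-weaken (ℕ.n∣m*n p) e))

χ-0±1 : ∀ {p} → Prime p → ∀ z → (χ p z ≡ + 0) ⊎ (χ p z ≡ + 1) ⊎ (χ p z ≡ -[1+ 0 ])
χ-0±1 {p} pp z with χ p z | χ-view p {{ℕ.prime⇒nonZero pp}} z
... | _ | is-zero _       = inj₁ refl
... | _ | is-residue _ _  = inj₂ (inj₁ refl)
... | _ | is-nonresidue _ = inj₂ (inj₂ refl)

Χ-0±1 : ∀ {L} → All Prime L → ∀ z → (Χ L z ≡ + 0) ⊎ (Χ L z ≡ + 1) ⊎ (Χ L z ≡ -[1+ 0 ])
Χ-0±1 []                 z = inj₂ (inj₁ refl)
Χ-0±1 {p ∷ L} (pp ∷ pps) z with χ p z | χ-0±1 pp z | Χ L z | Χ-0±1 pps z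
... | _ | inj₁ refl        | _ | _                = inj₁ refl
... | _ | inj₂ (inj₁ refl) | _ | inj₁ refl        = inj₁ refl
... | _ | inj₂ (inj₂ refl) | _ | inj₁ refl        = inj₁ refl
... | _ | inj₂ (inj₁ refl) | _ | inj₂ (inj₁ refl) = inj₂ (inj₁ refl)
... | _ | inj₂ (inj₁ refl) | _ | inj₂ (inj₂ refl) = inj₂ (inj₂ refl)
... | _ | inj₂ (inj₂ refl) | _ | inj₂ (inj₁ refl) = inj₂ (inj₂ refl)
... | _ | inj₂ (inj₂ refl) | _ | inj₂ (inj₂ refl) = inj₂ (inj₁ refl)

Χ≡0⇒∣ : ∀ {L} → All Prime L → ∀ z → Χ L z ≡ + 0 → ∃ λ p → p ∈ L × z ≈ + 0 [ p ]
Χ≡0⇒∣ {p ∷ L} (pp ∷ pps) z e with ℤₚ.i*j≡0⇒i≡0∨j≡0 (χ p z) e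
... | inj₁ e′ = p , here refl , χ≡0⇒≈0 {{ℕ.prime⇒nonZero pp}} e′
... | inj₂ e′ = let q , q∈ , q∣ = Χ≡0⇒∣ pps z e′ in q , there q∈ , q∣

Χ≢0⇒χ≢0 : ∀ {L p} z → p ∈ L → Χ L z ≢ + 0 → χ p z ≢ + 0
Χ≢0⇒χ≢0 {q ∷ L} z (here refl) Χ≢0 e = Χ≢0 (trans (cong (ℤ._* Χ L z) e) (ℤₚ.*-zeroˡ (Χ L z)))
Χ≢0⇒χ≢0 {q ∷ L} z (there p∈) Χ≢0 e = Χ≢0⇒χ≢0 z p∈ (λ e′ → Χ≢0 (trans (cong (χ q z ℤ.*_) e′) (ℤₚ.*-zeroʳ (χ q z)))) e

Χ≢0⇒≉0 : ∀ {L} → All Prime L → ∀ {p} z → p ∈ L → Χ L z ≢ + 0 → ¬ z ≈ + 0 [ p ]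
Χ≢0⇒≉0 pps z p∈ Χ≢0 = χ≢0⇒≉0 {{ℕ.prime⇒nonZero (All.lookup pps p∈)}} (Χ≢0⇒χ≢0 z p∈ Χ≢0)

prime∣product : ∀ {q L} → Prime q → All Prime L → q ∣ product L → q ∈ L
prime∣product {q} {[]} qp [] q∣1 = ⊥-elim (ℕ.¬prime[1] (subst Prime (ℕ.∣1⇒≡1 q∣1) qp))
prime∣product {q} {p ∷ L} qp (pp ∷ pps) q∣ with ℕ.euclidsLemma p (product L) qp q∣
... | inj₂ q∣L = there (prime∣product qp pps q∣L)
... | inj₁ q∣p with ℕ.prime⇒irreducible pp q∣p
...   | inj₁ refl = ⊥-elim (ℕ.¬prime[1] qp)
...   | inj₂ refl = here refl

J : List ℕ → ℕ × ℕ → Set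
J L z = Χ L (Δ z) ≡ -[1+ 0 ] × Χ L (ν z) ≡ + 1

J? : ∀ L z → Dec (J L z)
J? L z = (Χ L (Δ z) ℤ.≟ -[1+ 0 ]) ×-dec (Χ L (ν z) ℤ.≟ + 1)

discriminant : ℕ × ℕ → ℕ
discriminant (b , c) = b * b + 4 * c

Δ≡discriminant : ∀ z → + discriminant z ≡ Δ z
Δ≡discriminant (b , c) = trans (ℤₚ.pos-+ (b * b) (4 * c)) (cong₂ ℤ._+_ (ℤₚ.pos-* b b) (ℤₚ.pos-* 4 c))

complement≈ : ∀ n .{{_ : NonZero n}} c → + ((n ∸ (c mod n)) mod n) ≈ ℤ.- + c [ n ]
complement≈ n c = ≈-trans (mod≈ (n ∸ (c mod n)) n) (≈-trans (≈-reflexive (sym (ℤₚ.⊖-≥ (ℕₚ.<⇒≤ (mod< c n)))))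
  (≈-trans (≈-reflexive (sym (ℤₚ.m-n≡m⊖n n (c mod n)))) (≈-by₂ (+ 1) (ℤ.- + 1) n≈0 (mod≈ c n) (lemma (+ n) (+ (c mod n)) (+ c)))))
  where
  n≈0 : + n ≈ + 0 [ n ]
  n≈0 = ∣⇒≈0 ℕ.∣-refl
  lemma : ∀ n c′ c → n ℤ.- c′ ≡ ℤ.- c ℤ.+ + 1 ℤ.* (n ℤ.- + 0) ℤ.+ ℤ.- + 1 ℤ.* (c′ ℤ.- c)
  lemma = solve-∀

-- The list of prime factors is a variable `L` with an equation, so that later arguments can match
-- on its shape.
module Modulus (n : ℕ) (1<n : 1 < n) (L : List ℕ) (L≡ : L ≡ factors n n) where

  instance
    n≢0 : NonZero n
    n≢0 = >-nonZero (ℕₚ.<-trans (s≤s z≤n) 1<n)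

  primes : All Prime L
  primes = subst (All Prime) (sym L≡) (proj₁ (factors-spec n n (>-nonZero⁻¹ n) ℕₚ.≤-refl))

  product≡n : product L ≡ n
  product≡n = trans (cong product L≡) (proj₂ (factors-spec n n (>-nonZero⁻¹ n) ℕₚ.≤-refl))

  ∈⇒∣n : ∀ {p} → p ∈ L → p ∣ n
  ∈⇒∣n {p} p∈ = subst (p ∣_) product≡n (ListActionₚ.∈⇒∣product p∈)

  prime∣n⇒∈ : ∀ {p} → Prime p → p ∣ n → p ∈ L
  prime∣n⇒∈ pp p∣n = prime∣product pp primes (subst (_ ∣_) (sym product≡n) p∣n)

  Χ-cong-n : ∀ {z w} → z ≈ w [ n ] → Χ L z ≡ Χ L w
  Χ-cong-n e = Χ-cong primes (subst (λ m → _ ≈ _ [ m ]) (sym product≡n) e)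

  jacobi≡Χ : ∀ a → jacobi a n ≡ Χ L (+ a)
  jacobi≡Χ a = trans (jacobiAux≡Χ n n a (>-nonZero⁻¹ n)) (cong (λ L → Χ L (+ a)) (sym L≡))

  jacobi-Δ : ∀ z → jacobi (discriminant z mod n) n ≡ Χ L (Δ z)
  jacobi-Δ z = trans (jacobi≡Χ _) (Χ-cong-n (≈-trans (mod≈ (discriminant z) n) (≈-reflexive (Δ≡discriminant z))))

  jacobi-ν : ∀ z → jacobi ((n ∸ (proj₂ z mod n)) mod n) n ≡ Χ L (ν z)
  jacobi-ν z = trans (jacobi≡Χ _) (Χ-cong-n (complement≈ n (proj₂ z)))

  qftParams⇒J : ∀ z → T (qftParams n (proj₁ z) (proj₂ z)) → J L z
  qftParams⇒J z@(b , c) t = let t₁ , t₂ = T-∧⁻ {does (jacobi ((b * b + 4 * c) mod n) n ℤ.≟ -[1+ 0 ])} t in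
    trans (sym (jacobi-Δ z)) (T-does⁻ (_ ℤ.≟ _) t₁) , trans (sym (jacobi-ν z)) (T-does⁻ (_ ℤ.≟ _) t₂)

  J⇒qftParams : ∀ z → J L z → T (qftParams n (proj₁ z) (proj₂ z))
  J⇒qftParams z@(b , c) (e₁ , e₂) = T-∧⁺ {does (jacobi ((b * b + 4 * c) mod n) n ℤ.≟ -[1+ 0 ])}
    (T-does⁺ (_ ℤ.≟ _) (trans (jacobi-Δ z) e₁) , T-does⁺ (_ ℤ.≟ _) (trans (jacobi-ν z) e₂))

  Counted : ℕ × ℕ → Set
  Counted z = T (qftParams n (proj₁ z) (proj₂ z) ∨ nontrivGcd (discriminant z) n ∨ nontrivGcd (proj₂ z) n)

  counted? : ∀ z → Dec (Counted z)
  counted? z = T? _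

  M≡∑ : M n ≡ ∑ (residuePairs n) (ind ∘ counted?)
  M≡∑ = length-filter-∑ counted? (residuePairs n)

  Degenerate : ℕ × ℕ → Set
  Degenerate z = T (nontrivGcd (discriminant z) n) ⊎ T (nontrivGcd (proj₂ z) n)

  degenerate? : ∀ z → Dec (Degenerate z)
  degenerate? z = T? (nontrivGcd (discriminant z) n) ⊎-dec T? (nontrivGcd (proj₂ z) n)

  Χ≢0⇒gcd≡1 : ∀ a → Χ L (+ a) ≢ + 0 → gcd a n ≡ 1
  Χ≢0⇒gcd≡1 a Χ≢0 with gcd a n in eq
  ... | zero          = ⊥-elim (≢-nonZero⁻¹ n (GCD.gcd[m,n]≡0⇒n≡0 a eq))
  ... | suc zero      = refl
  ... | g@(suc (suc _)) = ⊥-elim (Χ≢0⇒≉0 primes (+ a) q∈ Χ≢0 (∣⇒≈0 (ℕ.∣-trans q∣g (subst (_∣ a) eq (GCD.gcd[m,n]∣m a n)))))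
    where
    1<g : 1 < g
    1<g = s≤s (s≤s z≤n)
    q∣g = spf∣ 1<g
    q∈ = prime∣n⇒∈ (spf-prime 1<g) (ℕ.∣-trans q∣g (subst (_∣ n) eq (GCD.gcd[m,n]∣n a n)))

  nontrivGcd⇒Χ≡0 : ∀ a → T (nontrivGcd a n) → ¬ Χ L (+ a) ≢ + 0
  nontrivGcd⇒Χ≡0 a t Χ≢0 = ℕₚ.<⇒≢ (ℕₚ.<ᵇ⇒< 1 (gcd a n) (proj₁ (T-∧⁻ {1 <ᵇ gcd a n} t))) (sym (Χ≢0⇒gcd≡1 a Χ≢0))

  Χ-c≢0 : ∀ z → Χ L (ν z) ≢ + 0 → Χ L (+ proj₂ z) ≢ + 0
  Χ-c≢0 (b , c) Χ≢0 e with Χ≡0⇒∣ primes (+ c) e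
  ... | p , p∈ , c≈0 = Χ≢0⇒≉0 primes (ν (b , c)) p∈ Χ≢0 (≈-neg c≈0)

  J∧Degenerate : ∀ z → J L z → ¬ Degenerate z
  J∧Degenerate z (e₁ , _) (inj₁ t) = nontrivGcd⇒Χ≡0 (discriminant z) t
    (λ e → case trans (sym e₁) (trans (cong (Χ L) (sym (Δ≡discriminant z))) e) of λ ())
  J∧Degenerate z (_ , e₂) (inj₂ t) = nontrivGcd⇒Χ≡0 (proj₂ z) t
    (Χ-c≢0 z (λ e → case trans (sym e₂) e of λ ()))

  J+Degenerate≤M : ∑ (residuePairs n) (ind ∘ J? L) + ∑ (residuePairs n) (ind ∘ degenerate?) ≤ M n
  J+Degenerate≤M = subst₂ _≤_ (∑-+ (residuePairs n) (ind ∘ J? L) (ind ∘ degenerate?)) (sym M≡∑)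
    (∑-mono (residuePairs n) λ {z} _ → pointwise z)
    where
    pointwise : ∀ z → ind (J? L z) + ind (degenerate? z) ≤ ind (counted? z)
    pointwise z = [ (λ j → subst₂ (λ a b → a + b ≤ ind (counted? z)) (sym (ind-true (J? L z) j)) (sym (ind-false (degenerate? z) (J∧Degenerate z j)))
                        (ℕₚ.≤-reflexive (sym (ind-true (counted? z) (T-∨⁺ (inj₁ (J⇒qftParams z j)))))))
                  , (λ ¬j → subst (λ a → a + ind (degenerate? z) ≤ ind (counted? z)) (sym (ind-false (J? L z) ¬j))
                        (ind-mono (degenerate? z) (counted? z) (λ d → T-∨⁺ {qftParams n (proj₁ z) (proj₂ z)} (inj₂ (T-∨⁺ d))))) ]′
                  (toSum (J? L z))

  J≤M : ∑ (residuePairs n) (ind ∘ J? L) ≤ M n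
  J≤M = ℕₚ.≤-trans (ℕₚ.m≤m+n _ _) J+Degenerate≤M

  gcd-divisor : ∀ {d} → d ∣ n → gcd d n ≡ d
  gcd-divisor {d} d∣n = ℕ.∣-antisym (GCD.gcd[m,n]∣m d n) (GCD.gcd-greatest ℕ.∣-refl d∣n)

  -- All pairs (b , d) are degenerate, because gcd(d, n) = d is a proper divisor.
  n≤Degenerate : ∀ {d} → 1 < d → d < n → d ∣ n → n ≤ ∑ (residuePairs n) (ind ∘ degenerate?)
  n≤Degenerate {d} 1<d d<n d∣n = begin
    n                                        ≡⟨ trans (∑-upTo-const n 1) (ℕₚ.*-identityʳ n) ⟨
    ∑ (upTo n) (λ _ → 1)                     ≤⟨ ∑-mono (upTo n) (λ {b} _ → column b) ⟩
    ∑ (upTo n) (λ b → ∑ (upTo n) (λ c → ind (degenerate? (b , c)))) ≡⟨ ∑-cartesian (upTo n) (upTo n) _ ⟨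
    ∑ (residuePairs n) (ind ∘ degenerate?)   ∎
    where
    open ℕₚ.≤-Reasoning
    nontrivial : T (nontrivGcd d n)
    nontrivial = subst (λ g → T ((1 <ᵇ g) ∧ (g <ᵇ n))) (sym (gcd-divisor d∣n)) (T-∧⁺ (ℕₚ.<⇒<ᵇ 1<d , ℕₚ.<⇒<ᵇ d<n))
    column : ∀ b → 1 ≤ ∑ (upTo n) (λ c → ind (degenerate? (b , c)))
    column b = ℕₚ.≤-trans (ℕₚ.≤-reflexive (sym (ind-true (degenerate? (b , d)) (inj₂ nontrivial))))
      (∈⇒≤∑ (λ c → ind (degenerate? (b , c))) (∈-upTo d<n))

  0<M : ∀ {d} → 1 < d → d < n → d ∣ n → 0 < M n
  0<M 1<d d<n d∣n = ℕₚ.≤-trans (>-nonZero⁻¹ n) (ℕₚ.≤-trans (n≤Degenerate 1<d d<n d∣n)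
    (ℕₚ.≤-trans (ℕₚ.m≤n+m _ _) J+Degenerate≤M))

Δ-cong : ∀ {m z z′} → embed z ≋ embed z′ [ m ] → Δ z ≈ Δ z′ [ m ]
Δ-cong (p ∙ q) = ≈-+ (≈-* p p) (≈-*ˡ (+ 4) q)

ν-cong : ∀ {m z z′} → embed z ≋ embed z′ [ m ] → ν z ≈ ν z′ [ m ]
ν-cong (p ∙ q) = ≈-neg q

Trit : ℤ → Set
Trit x = (x ≡ + 0) ⊎ (x ≡ + 1) ⊎ (x ≡ -[1+ 0 ])

Trit-* : ∀ {x y} → Trit x → Trit y → Trit (x ℤ.* y)
Trit-* (inj₁ refl)        (inj₁ refl)        = inj₁ refl
Trit-* (inj₁ refl)        (inj₂ (inj₁ refl)) = inj₁ refl
Trit-* (inj₁ refl)        (inj₂ (inj₂ refl)) = inj₁ refl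
Trit-* (inj₂ (inj₁ refl)) (inj₁ refl)        = inj₁ refl
Trit-* (inj₂ (inj₁ refl)) (inj₂ (inj₁ refl)) = inj₂ (inj₁ refl)
Trit-* (inj₂ (inj₁ refl)) (inj₂ (inj₂ refl)) = inj₂ (inj₂ refl)
Trit-* (inj₂ (inj₂ refl)) (inj₁ refl)        = inj₁ refl
Trit-* (inj₂ (inj₂ refl)) (inj₂ (inj₁ refl)) = inj₂ (inj₂ refl)
Trit-* (inj₂ (inj₂ refl)) (inj₂ (inj₂ refl)) = inj₂ (inj₁ refl)

ind-*≡1 : ∀ {x y} → Trit x → Trit y →
  ind (x ℤ.* y ℤ.≟ + 1) ≡ ind (x ℤ.≟ + 1) * ind (y ℤ.≟ + 1) + ind (x ℤ.≟ -[1+ 0 ]) * ind (y ℤ.≟ -[1+ 0 ])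
ind-*≡1 (inj₁ refl)        (inj₁ refl)        = refl
ind-*≡1 (inj₁ refl)        (inj₂ (inj₁ refl)) = refl
ind-*≡1 (inj₁ refl)        (inj₂ (inj₂ refl)) = refl
ind-*≡1 (inj₂ (inj₁ refl)) (inj₁ refl)        = refl
ind-*≡1 (inj₂ (inj₁ refl)) (inj₂ (inj₁ refl)) = refl
ind-*≡1 (inj₂ (inj₁ refl)) (inj₂ (inj₂ refl)) = refl
ind-*≡1 (inj₂ (inj₂ refl)) (inj₁ refl)        = refl
ind-*≡1 (inj₂ (inj₂ refl)) (inj₂ (inj₁ refl)) = refl
ind-*≡1 (inj₂ (inj₂ refl)) (inj₂ (inj₂ refl)) = refl

ind-*≡-1 : ∀ {x y} → Trit x → Trit y →
  ind (x ℤ.* y ℤ.≟ -[1+ 0 ]) ≡ ind (x ℤ.≟ + 1) * ind (y ℤ.≟ -[1+ 0 ]) + ind (x ℤ.≟ -[1+ 0 ]) * ind (y ℤ.≟ + 1)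
ind-*≡-1 (inj₁ refl)        (inj₁ refl)        = refl
ind-*≡-1 (inj₁ refl)        (inj₂ (inj₁ refl)) = refl
ind-*≡-1 (inj₁ refl)        (inj₂ (inj₂ refl)) = refl
ind-*≡-1 (inj₂ (inj₁ refl)) (inj₁ refl)        = refl
ind-*≡-1 (inj₂ (inj₁ refl)) (inj₂ (inj₁ refl)) = refl
ind-*≡-1 (inj₂ (inj₁ refl)) (inj₂ (inj₂ refl)) = refl
ind-*≡-1 (inj₂ (inj₂ refl)) (inj₁ refl)        = refl
ind-*≡-1 (inj₂ (inj₂ refl)) (inj₂ (inj₁ refl)) = refl
ind-*≡-1 (inj₂ (inj₂ refl)) (inj₂ (inj₂ refl)) = refl

prime∣odd⇒Odd : ∀ {p n} → Odd n → p ∣ n → Odd p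
prime∣odd⇒Odd o p∣n = ∤2⇒Odd (λ 2∣p → Odd⇒2∤ o (ℕ.∣-trans 2∣p p∣n))

Χ-square-unit : ∀ {L} → All Prime L → Odd (product L) → ∀ s i → s ℤ.* i ≈ + 1 [ product L ] →
                ∀ z → Χ L (s ℤ.* s ℤ.* z) ≡ Χ L z
Χ-square-unit []                 o s i si≈1 z = refl
Χ-square-unit {p ∷ L} (pp ∷ pps) o s i si≈1 z = cong₂ ℤ._*_ (begin
    χ p (s ℤ.* s ℤ.* z)            ≡⟨ χ-* (s ℤ.* s) z ⟩
    χ p (s ℤ.* s) ℤ.* χ p z        ≡⟨ cong (ℤ._* χ p z) (χ-is-residue (≉0-* s≉0 s≉0) (s , ≈-refl)) ⟩
    + 1 ℤ.* χ p z                  ≡⟨ ℤₚ.*-identityˡ _ ⟩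
    χ p z                          ∎)
  (Χ-square-unit pps (prime∣odd⇒Odd o (ℕ.n∣m*n p)) s i (≈-weaken (ℕ.n∣m*n p) si≈1) z)
  where
  open ≡-Reasoning
  instance _ = ℕ.prime⇒nonZero pp
  odd = prime∣odd⇒Odd o (ℕ.m∣m*n (product L))
  open OddPrime p pp (proj₁ odd) (proj₂ odd)
  s≉0 : ¬ s ≈ + 0 [ p ]
  s≉0 s≈0 = 1≉0 (≈-trans (≈-sym (≈-weaken (ℕ.m∣m*n (product L)) si≈1)) (≈-trans (≈-*ʳ i s≈0) (≈-reflexive (ℤₚ.*-zeroˡ i))))

module OddModulus (n : ℕ) (1<n : 1 < n) (L : List ℕ) (L≡ : L ≡ factors n n) (n-odd : Odd n) where
  open Modulus n 1<n L L≡

  private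
    pairs = residuePairs n
    h = proj₁ n-odd

  -- (n + 1) / 2, the inverse of 2.
  half : ℤ
  half = + suc h

  2half≈1 : + 2 ℤ.* half ≈ + 1 [ n ]
  2half≈1 = congruent (+ 1) (trans (sym (ℤₚ.pos-* 2 (suc h))) (trans (cong +_ (trans (lemma h) (cong suc (sym (proj₂ n-odd)))))
    (trans (ℤₚ.pos-+ 1 n) (cong (λ k → + 1 ℤ.+ k) (sym (ℤₚ.*-identityˡ (+ n)))))))
    where
    lemma : ∀ h → 2 * suc h ≡ 1 + suc (2 * h)
    lemma = ℕ-Solver.solve-∀

  cancel-4 : ∀ {x y} → + 4 ℤ.* x ≈ + 4 ℤ.* y [ n ] → x ≈ y [ n ]
  cancel-4 {x} {y} e = ≈-by₂ (half ℤ.* half) ((y ℤ.- x) ℤ.* (+ 2 ℤ.* half ℤ.+ + 1)) e 2half≈1 (lemma x y half)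
    where
    lemma : ∀ x y t → x ≡ y ℤ.+ t ℤ.* t ℤ.* (+ 4 ℤ.* x ℤ.- + 4 ℤ.* y)
      ℤ.+ (y ℤ.- x) ℤ.* (+ 2 ℤ.* t ℤ.+ + 1) ℤ.* (+ 2 ℤ.* t ℤ.- + 1)
    lemma = solve-∀

  Χ-square : ∀ s i → s ℤ.* i ≈ + 1 [ n ] → ∀ z → Χ L (s ℤ.* s ℤ.* z) ≡ Χ L z
  Χ-square s i si≈1 = Χ-square-unit primes (subst Odd (sym product≡n) n-odd) s i (subst (λ m → s ℤ.* i ≈ + 1 [ m ]) (sym product≡n) si≈1)

  Χ-4 : ∀ z → Χ L (+ 4 ℤ.* z) ≡ Χ L z
  Χ-4 = Χ-square (+ 2) half 2half≈1

  J′? : ∀ z → Dec (Χ L (Δ z) ≡ + 1 × Χ L (ν z) ≡ -[1+ 0 ])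
  J′? z = (Χ L (Δ z) ℤ.≟ + 1) ×-dec (Χ L (ν z) ℤ.≟ -[1+ 0 ])

  -- The map c ↦ -Δ / 4 exchanges Δ = b² + 4c and -4c.
  J′≤J : ∑ pairs (ind ∘ J′?) ≤ ∑ pairs (ind ∘ J? L)
  J′≤J = ℕₚ.≤-trans (ℕₚ.≤-reflexive (sym (ℕₚ.*-identityˡ _)))
    (double-count-≤ pairs pairs (λ z z′ → ind (r? z z′)) 1 (λ {z} z∈ → lower z z∈) (λ {z′} _ → upper z′))
    where
    Swapped : ℕ × ℕ → ℕ × ℕ → Set
    Swapped z z′ = proj₁ z ≡ proj₁ z′ × (+ 4 ℤ.* + proj₂ z′ ≈ ℤ.- Δ z [ n ])
    r? : ∀ z z′ → Dec ((Χ L (Δ z) ≡ + 1 × Χ L (ν z) ≡ -[1+ 0 ]) × Swapped z z′)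
    r? z z′ = J′? z ×-dec ((proj₁ z ≟ proj₁ z′) ×-dec (_ ≈? _))
    lower : ∀ z → z ∈ pairs → 1 * ind (J′? z) ≤ ∑ pairs (λ z′ → ind (r? z z′))
    lower z@(b , c) z∈ = *-ind-bound 1 (J′? z) λ j →
      ℕₚ.≤-trans (ℕₚ.≤-reflexive (sym (ind-true (r? z (b , residue n c₀)) (j , refl , swapped))))
        (∈⇒≤∑ (λ z′ → ind (r? z z′)) (∈-residuePairs (proj₁ (∈-residuePairs⇒< z∈)) (residue< n c₀)))
      where
      c₀ = ℤ.- Δ z ℤ.* half ℤ.* half
      swapped : + 4 ℤ.* + residue n c₀ ≈ ℤ.- Δ z [ n ]
      swapped = ≈-by₂ (+ 4) (ℤ.- Δ z ℤ.* (+ 2 ℤ.* half ℤ.+ + 1)) (residue≈ n c₀) 2half≈1 (lemma (+ residue n c₀) (Δ z) half)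
        where
        lemma : ∀ c d t → + 4 ℤ.* c ≡ ℤ.- d ℤ.+ + 4 ℤ.* (c ℤ.- ℤ.- d ℤ.* t ℤ.* t)
          ℤ.+ ℤ.- d ℤ.* (+ 2 ℤ.* t ℤ.+ + 1) ℤ.* (+ 2 ℤ.* t ℤ.- + 1)
        lemma = solve-∀
    swapped-J : ∀ z z′ → Χ L (Δ z) ≡ + 1 × Χ L (ν z) ≡ -[1+ 0 ] → Swapped z z′ → J L z′
    swapped-J z@(b , c) z′@(b , c′) (e₁ , e₂) (refl , s) =
        trans (Χ-cong-n (≈-by₁ (+ 1) s (lemma₁ (+ b) (+ c) (+ c′)))) (trans (Χ-4 (ν z)) e₂)
      , trans (sym (Χ-4 (ν z′))) (trans (Χ-cong-n (≈-by₁ (ℤ.- + 1) s (lemma₂ (+ b) (+ c) (+ c′)))) e₁)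
      where
      lemma₁ : ∀ b c c′ → b ℤ.* b ℤ.+ + 4 ℤ.* c′ ≡ + 4 ℤ.* ℤ.- c
        ℤ.+ + 1 ℤ.* (+ 4 ℤ.* c′ ℤ.- ℤ.- (b ℤ.* b ℤ.+ + 4 ℤ.* c))
      lemma₁ = solve-∀
      lemma₂ : ∀ b c c′ → + 4 ℤ.* ℤ.- c′ ≡ b ℤ.* b ℤ.+ + 4 ℤ.* c
        ℤ.+ ℤ.- + 1 ℤ.* (+ 4 ℤ.* c′ ℤ.- ℤ.- (b ℤ.* b ℤ.+ + 4 ℤ.* c))
      lemma₂ = solve-∀
    swapped-unique : ∀ {z₁ z₂} z′ → z₁ ∈ pairs → z₂ ∈ pairs → Swapped z₁ z′ → Swapped z₂ z′ → z₁ ≡ z₂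
    swapped-unique {b , c₁} {b , c₂} z′ z₁∈ z₂∈ (refl , s₁) (refl , s₂) = cong (b ,_)
      (residue-unique (proj₂ (∈-residuePairs⇒< z₁∈)) (proj₂ (∈-residuePairs⇒< z₂∈))
        (cancel-4 (≈-by₂ (+ 1) (ℤ.- + 1) s₁ s₂ (lemma (+ b) (+ c₁) (+ c₂) (+ proj₂ z′)))))
      where
      lemma : ∀ b c₁ c₂ c′ → + 4 ℤ.* c₁ ≡ + 4 ℤ.* c₂
        ℤ.+ + 1 ℤ.* (+ 4 ℤ.* c′ ℤ.- ℤ.- (b ℤ.* b ℤ.+ + 4 ℤ.* c₁))
        ℤ.+ ℤ.- + 1 ℤ.* (+ 4 ℤ.* c′ ℤ.- ℤ.- (b ℤ.* b ℤ.+ + 4 ℤ.* c₂))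
      lemma = solve-∀
    upper : ∀ z′ → ∑ pairs (λ z → ind (r? z z′)) ≤ ind (J? L z′)
    upper z′ = ∑-bound-by-witness pairs (λ z → ind (r? z z′)) λ {z} _ 1≤ →
      let j , s = ind-pos (r? z z′) 1≤ in
      subst (∑ pairs (λ z → ind (r? z z′)) ≤_) (sym (ind-true (J? L z′) (swapped-J z z′ j s)))
        (∑-ind≤1 (λ z → r? z z′) pairs (residuePairs! n) λ z₁∈ z₂∈ (_ , s₁) (_ , s₂) → swapped-unique z′ z₁∈ z₂∈ s₁ s₂)

  ΧΧ : ℕ × ℕ → ℤ
  ΧΧ z = Χ L (Δ z) ℤ.* Χ L (ν z)

  diff≤J+J′ : ∀ z → ind (ΧΧ z ℤ.≟ -[1+ 0 ]) ≤ ind (J? L z) + ind (J′? z)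
  diff≤J+J′ z with Χ L (Δ z) | Χ-0±1 primes (Δ z) | Χ L (ν z) | Χ-0±1 primes (ν z)
  ... | _ | inj₁ refl        | _ | inj₁ refl        = z≤n
  ... | _ | inj₁ refl        | _ | inj₂ (inj₁ refl) = z≤n
  ... | _ | inj₁ refl        | _ | inj₂ (inj₂ refl) = z≤n
  ... | _ | inj₂ (inj₁ refl) | _ | inj₁ refl        = z≤n
  ... | _ | inj₂ (inj₁ refl) | _ | inj₂ (inj₁ refl) = z≤n
  ... | _ | inj₂ (inj₁ refl) | _ | inj₂ (inj₂ refl) = s≤s z≤n
  ... | _ | inj₂ (inj₂ refl) | _ | inj₁ refl        = z≤n
  ... | _ | inj₂ (inj₂ refl) | _ | inj₂ (inj₁ refl) = s≤s z≤n
  ... | _ | inj₂ (inj₂ refl) | _ | inj₂ (inj₂ refl) = z≤n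

  Δ≈0? : ∀ z → Dec (Δ z ≈ + 0 [ n ])
  Δ≈0? z = Δ z ≈? + 0

  Χ≡0⇒degenerate : ∀ a → Χ L (+ a) ≡ + 0 → T (nontrivGcd a n) ⊎ n ∣ a
  Χ≡0⇒degenerate a e with Χ≡0⇒∣ primes (+ a) e
  ... | q , q∈ , a≈0 with gcd a n <? n
  ...   | yes g<n = inj₁ (T-∧⁺ (ℕₚ.<⇒<ᵇ (ℕₚ.<-≤-trans (1<prime (All.lookup primes q∈))
                      (ℕ.∣⇒≤ {{≢-nonZero (λ g≡0 → ≢-nonZero⁻¹ n (GCD.gcd[m,n]≡0⇒n≡0 a g≡0))}}
                        (GCD.gcd-greatest (≈0⇒∣ a≈0) (∈⇒∣n q∈)))) , ℕₚ.<⇒<ᵇ g<n))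
  ...   | no  g≮n = inj₂ (subst (_∣ a) (ℕₚ.≤-antisym (GCD.gcd[m,n]≤n a n) (ℕₚ.≮⇒≥ g≮n)) (GCD.gcd[m,n]∣m a n))

  1≤sum : ∀ a b c d e → (1 ≤ a) ⊎ (1 ≤ b) ⊎ (1 ≤ c) ⊎ (1 ≤ d) ⊎ (1 ≤ e) → 1 ≤ a + b + c + d + e
  1≤sum (suc a) b       c       d       e       (inj₁ _)                      = s≤s z≤n
  1≤sum a       (suc b) c       d       e       (inj₂ (inj₁ _))               rewrite ℕₚ.+-suc a b = s≤s z≤n
  1≤sum a       b       (suc c) d       e       (inj₂ (inj₂ (inj₁ _)))        rewrite ℕₚ.+-suc (a + b) c = s≤s z≤n
  1≤sum a       b       c       (suc d) e       (inj₂ (inj₂ (inj₂ (inj₁ _)))) rewrite ℕₚ.+-suc (a + b + c) d = s≤s z≤n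
  1≤sum a       b       c       d       (suc e) (inj₂ (inj₂ (inj₂ (inj₂ _)))) rewrite ℕₚ.+-suc (a + b + c + d) e = s≤s z≤n

  -- If the product of symbols is 0, then Δ or c has a common factor with n. Either this gcd is a
  -- proper divisor and the pair is degenerate, or it is n, which leaves the thin cases c = 0 and Δ
  -- ≡ 0.
  cover : ∀ {z} → z ∈ pairs → 1 ≤ ind (ΧΧ z ℤ.≟ + 1) + ind (ΧΧ z ℤ.≟ -[1+ 0 ]) + ind (degenerate? z) + ind (proj₂ z ≟ 0) + ind (Δ≈0? z)
  cover {z@(b , c)} z∈ =
    1≤sum (ind (ΧΧ z ℤ.≟ + 1)) (ind (ΧΧ z ℤ.≟ -[1+ 0 ])) (ind (degenerate? z)) (ind (c ≟ 0)) (ind (Δ≈0? z))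
      ([ vanishing , [ inj₁ ∘ 1≤ind (ΧΧ z ℤ.≟ + 1) , inj₂ ∘ inj₁ ∘ 1≤ind (ΧΧ z ℤ.≟ -[1+ 0 ]) ]′ ]′
        (Trit-* (Χ-0±1 primes (Δ z)) (Χ-0±1 primes (ν z))))
    where
    1≤ind : {P : Set} (d : Dec P) → P → 1 ≤ ind d
    1≤ind d p = ℕₚ.≤-reflexive (sym (ind-true d p))
    Χc≡0 : Χ L (ν z) ≡ + 0 → Χ L (+ c) ≡ + 0
    Χc≡0 e = decidable-stable (Χ L (+ c) ℤ.≟ + 0) λ Χc≢0 →
      let q , q∈ , ν≈0 = Χ≡0⇒∣ primes (ν z) e
      in Χ≢0⇒≉0 primes (+ c) q∈ Χc≢0 (≈-trans (≈-reflexive (sym (ℤₚ.neg-involutive (+ c)))) (≈-neg ν≈0))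
    vanishing : ΧΧ z ≡ + 0 → (1 ≤ ind (ΧΧ z ℤ.≟ + 1)) ⊎ (1 ≤ ind (ΧΧ z ℤ.≟ -[1+ 0 ])) ⊎ (1 ≤ ind (degenerate? z)) ⊎ (1 ≤ ind (c ≟ 0)) ⊎ (1 ≤ ind (Δ≈0? z))
    vanishing e with ℤₚ.i*j≡0⇒i≡0∨j≡0 (Χ L (Δ z)) e
    ... | inj₁ eΔ = [ (λ t → inj₂ (inj₂ (inj₁ (1≤ind (degenerate? z) (inj₁ t)))))
                    , (λ n∣ → inj₂ (inj₂ (inj₂ (inj₂ (1≤ind (Δ≈0? z) (≈-trans (≈-reflexive (sym (Δ≡discriminant z))) (∣⇒≈0 n∣))))))) ]′
                    (Χ≡0⇒degenerate (discriminant z) (trans (cong (Χ L) (Δ≡discriminant z)) eΔ))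
    ... | inj₂ eν = [ (λ t → inj₂ (inj₂ (inj₁ (1≤ind (degenerate? z) (inj₂ t)))))
                    , (λ n∣ → inj₂ (inj₂ (inj₂ (inj₁ (1≤ind (c ≟ 0) (∣∧<⇒≡0 n∣ (proj₂ (∈-residuePairs⇒< z∈)))))))) ]′
                    (Χ≡0⇒degenerate c (Χc≡0 eν))

  columns≤n : {P : ℕ × ℕ → Set} (P? : ∀ z → Dec (P z)) → (∀ b → ∑ (upTo n) (λ c → ind (P? (b , c))) ≤ 1) →
              ∑ pairs (ind ∘ P?) ≤ n
  columns≤n P? col = begin
    ∑ pairs (ind ∘ P?)                               ≡⟨ ∑-cartesian (upTo n) (upTo n) _ ⟩
    ∑ (upTo n) (λ b → ∑ (upTo n) (λ c → ind (P? (b , c)))) ≤⟨ ∑-mono (upTo n) (λ {b} _ → col b) ⟩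
    ∑ (upTo n) (λ _ → 1)                             ≡⟨ trans (∑-upTo-const n 1) (ℕₚ.*-identityʳ n) ⟩
    n                                                ∎
    where open ℕₚ.≤-Reasoning

  Δ≈0-count : ∑ pairs (ind ∘ Δ≈0?) ≤ n
  Δ≈0-count = columns≤n Δ≈0? λ b → ∑-ind≤1 (λ c → Δ≈0? (b , c)) (upTo n) (upTo! n) λ {c} {c′} c∈ c′∈ e e′ →
    residue-unique (∈-upTo⇒< c∈) (∈-upTo⇒< c′∈) (cancel-4 (≈-by₂ (+ 1) (ℤ.- + 1) e e′ (lemma (+ b) (+ c) (+ c′))))
    where
    lemma : ∀ b c c′ → + 4 ℤ.* c ≡ + 4 ℤ.* c′ ℤ.+ + 1 ℤ.* (b ℤ.* b ℤ.+ + 4 ℤ.* c ℤ.- + 0)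
      ℤ.+ ℤ.- + 1 ℤ.* (b ℤ.* b ℤ.+ + 4 ℤ.* c′ ℤ.- + 0)
    lemma = solve-∀

  c≡0-count : ∑ pairs (λ z → ind (proj₂ z ≟ 0)) ≤ n
  c≡0-count = columns≤n (λ z → proj₂ z ≟ 0) λ b → ∑-ind≤1 (_≟ 0) (upTo n) (upTo! n) λ _ _ e e′ → trans e (sym e′)

  -- One prime dividing n exactly once balances the signs of χ(Δ) χ(-c) on all of ℤ/n.
  same≡diff-n : ∀ {p L′} → L ≡ p ∷ L′ → Coprime p (product L′) →
    ∑ pairs (λ z → ind (ΧΧ z ℤ.≟ + 1)) ≡ ∑ pairs (λ z → ind (ΧΧ z ℤ.≟ -[1+ 0 ]))
  same≡diff-n {p} {L′} refl cop = begin
    ∑ pairs (λ z → ind (ΧΧ z ℤ.≟ + 1))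
      ≡⟨ ∑-cong pairs (λ {z} _ → trans (cong (λ x → ind (x ℤ.≟ + 1)) (regroup z)) (ind-*≡1 (trit-f z) (trit-g z))) ⟩
    ∑ pairs (λ z → F (+ 1) z * G (+ 1) z + F -[1+ 0 ] z * G -[1+ 0 ] z)
      ≡⟨ trans (∑-+ pairs _ _) (cong₂ _+_ (crt (+ 1) (+ 1)) (crt -[1+ 0 ] -[1+ 0 ])) ⟩
    ∑F (+ 1) * ∑G (+ 1) + ∑F -[1+ 0 ] * ∑G -[1+ 0 ]
      ≡⟨ cong₂ (λ a b → a * ∑G (+ 1) + b * ∑G -[1+ 0 ]) S≡D (sym S≡D) ⟩
    ∑F -[1+ 0 ] * ∑G (+ 1) + ∑F (+ 1) * ∑G -[1+ 0 ]
      ≡⟨ ℕₚ.+-comm (∑F -[1+ 0 ] * ∑G (+ 1)) _ ⟩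
    ∑F (+ 1) * ∑G -[1+ 0 ] + ∑F -[1+ 0 ] * ∑G (+ 1)
      ≡⟨ trans (∑-+ pairs _ _) (cong₂ _+_ (crt (+ 1) -[1+ 0 ]) (crt -[1+ 0 ] (+ 1))) ⟨
    ∑ pairs (λ z → F (+ 1) z * G -[1+ 0 ] z + F -[1+ 0 ] z * G (+ 1) z)
      ≡⟨ ∑-cong pairs (λ {z} _ → trans (cong (λ x → ind (x ℤ.≟ -[1+ 0 ])) (regroup z)) (ind-*≡-1 (trit-f z) (trit-g z))) ⟨
    ∑ pairs (λ z → ind (ΧΧ z ℤ.≟ -[1+ 0 ])) ∎
    where
    open ≡-Reasoning
    pp = All.head primes
    pps = All.tail primes
    instance
      _ = ℕ.prime⇒nonZero pp
      _ = ℕ.productOfPrimes≢0 pps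
    odd = prime∣odd⇒Odd n-odd (∈⇒∣n (here refl))
    open SameDiff p pp (proj₁ odd) (proj₂ odd)
    f g : ℕ × ℕ → ℤ
    f z = χ p (Δ z) ℤ.* χ p (ν z)
    g z = Χ L′ (Δ z) ℤ.* Χ L′ (ν z)
    F G : ℤ → ℕ × ℕ → ℕ
    F v z = ind (f z ℤ.≟ v)
    G v z = ind (g z ℤ.≟ v)
    ∑F ∑G : ℤ → ℕ
    ∑F v = ∑ (residuePairs p) (F v)
    ∑G v = ∑ (residuePairs (product L′)) (G v)
    S≡D : ∑F (+ 1) ≡ ∑F -[1+ 0 ]
    S≡D = same≡diff
    trit-f : ∀ z → Trit (f z)
    trit-f z = Trit-* (χ-0±1 pp (Δ z)) (χ-0±1 pp (ν z))
    trit-g : ∀ z → Trit (g z)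
    trit-g z = Trit-* (Χ-0±1 pps (Δ z)) (Χ-0±1 pps (ν z))
    regroup : ∀ z → ΧΧ z ≡ f z ℤ.* g z
    regroup z = lemma (χ p (Δ z)) (Χ L′ (Δ z)) (χ p (ν z)) (Χ L′ (ν z))
      where
      lemma : ∀ a b c d → a ℤ.* b ℤ.* (c ℤ.* d) ≡ a ℤ.* c ℤ.* (b ℤ.* d)
      lemma = solve-∀
    crt : ∀ v w → ∑ pairs (λ z → F v z * G w z) ≡ ∑F v * ∑G w
    crt v w = subst (λ m → ∑ (residuePairs m) (λ z → F v z * G w z) ≡ ∑F v * ∑G w) product≡n
      (crt-∑ cop {F v} {G w}
        (λ e → cong₂ (λ x y → ind (x ℤ.* y ℤ.≟ v)) (χ-cong p (Δ-cong e)) (χ-cong p (ν-cong e)))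
        (λ e → cong₂ (λ x y → ind (x ℤ.* y ℤ.≟ w)) (Χ-cong pps (Δ-cong e)) (Χ-cong pps (ν-cong e))))

  -- `cover` gives n² ≤ s + d + g + 2n, where s = d ≤ 2j. Since g ≥ n, three further copies of g pay
  -- for these 2n and for the additional n, which later makes the final inequality strict.
  n²+n≤4M : ∀ {p L′} → L ≡ p ∷ L′ → Coprime p (product L′) → p < n → n * n + n ≤ 4 * M n
  n²+n≤4M {p} {L′} refl cop p<n = begin
    n * n + n                                ≤⟨ ℕₚ.+-monoˡ-≤ n bound ⟩
    s + d + g + t₁ + t₂ + n                  ≤⟨ ℕₚ.+-monoˡ-≤ n (ℕₚ.+-mono-≤ (ℕₚ.+-mono-≤ (ℕₚ.≤-reflexive (cong (λ k → k + d + g) (same≡diff-n refl cop))) c≡0-count) Δ≈0-count) ⟩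
    d + d + g + n + n + n                    ≤⟨ ℕₚ.+-monoˡ-≤ n (ℕₚ.+-monoˡ-≤ n (ℕₚ.+-monoˡ-≤ n (ℕₚ.+-monoˡ-≤ g (ℕₚ.+-mono-≤ d≤2j d≤2j)))) ⟩
    j + j + (j + j) + g + n + n + n          ≤⟨ ℕₚ.+-mono-≤ (ℕₚ.+-mono-≤ (ℕₚ.+-monoʳ-≤ (j + j + (j + j) + g) n≤g) n≤g) n≤g ⟩
    j + j + (j + j) + g + g + g + g          ≡⟨ lemma j g ⟩
    4 * (j + g)                              ≤⟨ ℕₚ.*-monoʳ-≤ 4 J+Degenerate≤M ⟩
    4 * M n                                  ∎
    where
    open ℕₚ.≤-Reasoning
    s = ∑ pairs (λ z → ind (ΧΧ z ℤ.≟ + 1))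
    d = ∑ pairs (λ z → ind (ΧΧ z ℤ.≟ -[1+ 0 ]))
    g = ∑ pairs (ind ∘ degenerate?)
    t₁ = ∑ pairs (λ z → ind (proj₂ z ≟ 0))
    t₂ = ∑ pairs (ind ∘ Δ≈0?)
    j = ∑ pairs (ind ∘ J? L)
    n≤g : n ≤ g
    n≤g = n≤Degenerate (1<prime (All.head primes)) p<n (∈⇒∣n (here refl))
    d≤2j : d ≤ j + j
    d≤2j = ℕₚ.≤-trans (∑-mono pairs (λ {z} _ → diff≤J+J′ z))
      (ℕₚ.≤-trans (ℕₚ.≤-reflexive (∑-+ pairs _ _)) (ℕₚ.+-monoʳ-≤ j J′≤J))
    bound : n * n ≤ s + d + g + t₁ + t₂
    bound = begin
      n * n                 ≡⟨ trans (∑-const pairs 1) (trans (ℕₚ.*-identityʳ _) (length-residuePairs n)) ⟨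
      ∑ pairs (λ _ → 1)     ≤⟨ ∑-mono pairs cover ⟩
      _                     ≡⟨ trans (∑-+ pairs _ _) (cong (_+ t₂) (trans (∑-+ pairs _ _) (cong (_+ t₁)
                                 (trans (∑-+ pairs _ _) (cong (_+ g) (∑-+ pairs _ _)))))) ⟩
      s + d + g + t₁ + t₂   ∎
    lemma : ∀ j g → j + j + (j + j) + g + g + g + g ≡ 4 * (j + g)
    lemma = ℕ-Solver.solve-∀

-- Moduli with a square factor

Step4 : ℕ → ℕ × ℕ → Set
Step4 n z@(b , c) = Quadratic._↑_ n (+ b) (+ c) (+ 1 , + 0) (suc n) ≋ (+ 0 , ν z) [ n ]

-- The scalings x ↦ λ x with λ = 1 + (n/p) v, v < p, act on the parameters by (b , c) ↦ (λ b , λ² c)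
-- and preserve the Jacobi symbols.  If both x^(n+1) = -c and its scaled form hold then λ^(n-1) = 1,
-- whereas λ^(n-1) = 1 - (n/p) v: every orbit contains at most one passing pair.
module SquareFactor (n : ℕ) (1<n : 1 < n) (L : List ℕ) (L≡ : L ≡ factors n n) (n-odd : Odd n)
  (p : ℕ) (pp : Prime p) (p²∣n : p * p ∣ n) where
  open Modulus n 1<n L L≡
  open OddModulus n 1<n L L≡ n-odd using (Χ-square)

  private
    pairs = residuePairs n
    q = ℕ._∣_.quotient p²∣n
    e = p * q
    instance
      p≢0 : NonZero p
      p≢0 = ℕ.prime⇒nonZero pp

  n≡pe : n ≡ p * e
  n≡pe = trans (ℕ._∣_.equality p²∣n) (lemma p q)
    where
    lemma : ∀ p q → q * (p * p) ≡ p * (p * q)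
    lemma = ℕ-Solver.solve-∀

  p∣n : p ∣ n
  p∣n = ℕ.divides e (trans n≡pe (ℕₚ.*-comm p e))

  instance
    e≢0 : NonZero e
    e≢0 = ≢-nonZero λ e≡0 → ≢-nonZero⁻¹ n (trans n≡pe (trans (cong (p *_) e≡0) (ℕₚ.*-zeroʳ p)))

  e²≈0 : + e ℤ.* + e ≈ + 0 [ n ]
  e²≈0 = ∣⇒≈0 (subst (n ∣_) (sym (ℤₚ.abs-* (+ e) (+ e))) (ℕ.divides q (trans (lemma p q) (cong (q *_) (sym n≡pe)))))
    where
    lemma : ∀ p q → p * q * (p * q) ≡ q * (p * (p * q))
    lemma = ℕ-Solver.solve-∀

  scale : ℕ → ℤ
  scale v = + 1 ℤ.+ + e ℤ.* + v

  unscale : ℕ → ℤ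
  unscale v = + 1 ℤ.- + e ℤ.* + v

  scale-unscale : ∀ v → scale v ℤ.* unscale v ≈ + 1 [ n ]
  scale-unscale v = ≈-by₁ (ℤ.- (+ v ℤ.* + v)) e²≈0 (lemma (+ e) (+ v))
    where
    lemma : ∀ e v → (+ 1 ℤ.+ e ℤ.* v) ℤ.* (+ 1 ℤ.- e ℤ.* v) ≡ + 1 ℤ.+ ℤ.- (v ℤ.* v) ℤ.* (e ℤ.* e ℤ.- + 0)
    lemma = solve-∀

  -- With e = n / p the square e² vanishes modulo n, so the binomial expansion of (1 + e v)^k stops
  -- after its linear term.
  scale-^ : ∀ v k → scale v ℤ.^ k ≈ + 1 ℤ.+ + k ℤ.* (+ e ℤ.* + v) [ n ]
  scale-^ v zero    = ≈-reflexive (lemma (+ e) (+ v))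
    where
    lemma : ∀ e v → + 1 ≡ + 1 ℤ.+ + 0 ℤ.* (e ℤ.* v)
    lemma = solve-∀
  scale-^ v (suc k) = ≈-by₂ (scale v) (+ k ℤ.* + v ℤ.* + v) (scale-^ v k) e²≈0 (lemma (+ e) (+ v) (+ k) (scale v ℤ.^ k))
    where
    lemma : ∀ e v k s → (+ 1 ℤ.+ e ℤ.* v) ℤ.* s ≡ + 1 ℤ.+ (+ 1 ℤ.+ k) ℤ.* (e ℤ.* v)
      ℤ.+ (+ 1 ℤ.+ e ℤ.* v) ℤ.* (s ℤ.- (+ 1 ℤ.+ k ℤ.* (e ℤ.* v))) ℤ.+ k ℤ.* v ℤ.* v ℤ.* (e ℤ.* e ℤ.- + 0)
    lemma = solve-∀

  Scaled : ℕ → ℕ × ℕ → ℕ × ℕ → Set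
  Scaled v (b , c) (b′ , c′) = (+ b′ ≈ scale v ℤ.* + b [ n ]) × (+ c′ ≈ scale v ℤ.* scale v ℤ.* + c [ n ])

  Scaled-J : ∀ v z z′ → Scaled v z z′ → J L z → J L z′
  Scaled-J v z@(b , c) z′@(b′ , c′) (eb , ec) (e₁ , e₂) =
      trans (Χ-cong-n (≈-by₂ (+ b′ ℤ.+ scale v ℤ.* + b) (+ 4) eb ec (lemma₁ (scale v) (+ b) (+ c) (+ b′) (+ c′)))) (trans (Χ-square (scale v) (unscale v) (scale-unscale v) (Δ z)) e₁)
    , trans (Χ-cong-n (≈-by₁ (ℤ.- + 1) ec (lemma₂ (scale v) (+ c) (+ c′)))) (trans (Χ-square (scale v) (unscale v) (scale-unscale v) (ν z)) e₂)
    where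
    lemma₁ : ∀ s b c b′ c′ → b′ ℤ.* b′ ℤ.+ + 4 ℤ.* c′ ≡ s ℤ.* s ℤ.* (b ℤ.* b ℤ.+ + 4 ℤ.* c)
      ℤ.+ (b′ ℤ.+ s ℤ.* b) ℤ.* (b′ ℤ.- s ℤ.* b) ℤ.+ + 4 ℤ.* (c′ ℤ.- s ℤ.* s ℤ.* c)
    lemma₁ = solve-∀
    lemma₂ : ∀ s c c′ → ℤ.- c′ ≡ s ℤ.* s ℤ.* ℤ.- c ℤ.+ ℤ.- + 1 ℤ.* (c′ ℤ.- s ℤ.* s ℤ.* c)
    lemma₂ = solve-∀

  -- In the ring of z′ the element μ x, with μ the inverse of λ, is a root of the polynomial of z.
  -- Hence x^(n+1) = λ^(n+1) (μ x)^(n+1) = λ^(n+1) ν z, and ν z′ = λ² ν z absorbs two factors λ.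
  scaled-step4 : ∀ v z z′ → Scaled v z z′ → Step4 n z →
    Quadratic._↑_ n (+ proj₁ z′) (+ proj₂ z′) (+ 1 , + 0) (suc n) ≋ (+ 0 , scale v ℤ.^ (n ∸ 1) ℤ.* ν z′) [ n ]
  scaled-step4 v z@(b , c) z′@(b′ , c′) (eb , ec) step4 = begin
    gen ↑ suc n                                                ≈⟨ ·-identityˡ _ ⟨
    𝟙 · gen ↑ suc n                                            ≈⟨ ·-cong one ≋-refl ⟨
    const (s ℤ.^ suc n) · const μ ↑ suc n · gen ↑ suc n        ≈⟨ ·-assoc _ _ _ ⟩
    const (s ℤ.^ suc n) · (const μ ↑ suc n · gen ↑ suc n)      ≈⟨ ·-cong ≋-refl (^-distrib-* (const μ) gen (suc n)) ⟨
    const (s ℤ.^ suc n) · (const μ · gen) ↑ suc n              ≈⟨ ·-cong ≋-refl (^-congˡ (suc n) μ·gen) ⟩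
    const (s ℤ.^ suc n) · θ ↑ suc n                            ≈⟨ ·-cong ≋-refl (power-at-root (suc n) step4) ⟩
    const (s ℤ.^ suc n) · const (ν z)                          ≈⟨ const-* _ _ ⟩
    const (s ℤ.^ suc n ℤ.* ν z)                                ≡⟨ cong (λ k → const (s ℤ.^ suc k ℤ.* ν z)) (ℕₚ.suc-pred n) ⟨
    const (s ℤ.^ suc (suc (pred n)) ℤ.* ν z)                   ≈⟨ const-cong (≈-by₁ (s ℤ.^ pred n) ec (lemma s (s ℤ.^ pred n) (+ c) (+ c′))) ⟩
    const (s ℤ.^ (n ∸ 1) ℤ.* ν z′)                             ∎
    where
    s = scale v
    μ = unscale v
    θ : ℤ × ℤ
    θ = μ , + 0
    open Quadratic n (+ b′) (+ c′)
    open import Relation.Binary.Reasoning.Setoid ≋-setoid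
    μ·gen : const μ · gen ≋ θ [ n ]
    μ·gen = subst (_≋ θ [ n ]) (sym (mul-def (+ b′) (+ c′) (+ 0) μ (+ 1) (+ 0))) (≋-reflexive (lemma₁ (+ b′) μ) (lemma₂ (+ c′) μ))
      where
      lemma₁ : ∀ b m → + 0 ℤ.* + 1 ℤ.* b ℤ.+ + 0 ℤ.* + 0 ℤ.+ + 1 ℤ.* m ≡ m
      lemma₁ = solve-∀
      lemma₂ : ∀ c m → + 0 ℤ.* + 1 ℤ.* c ℤ.+ m ℤ.* + 0 ≡ + 0
      lemma₂ = solve-∀
    θ-root : mul (+ b′) (+ c′) θ θ ≋ (+ b ℤ.* μ , + b ℤ.* + 0 ℤ.+ + c) [ n ]
    θ-root = subst (_≋ (+ b ℤ.* μ , + b ℤ.* + 0 ℤ.+ + c) [ n ]) (sym (mul-def (+ b′) (+ c′) μ (+ 0) μ (+ 0)))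
      ( ≈-by₂ (μ ℤ.* μ) (+ b ℤ.* μ) eb (scale-unscale v) (lemma₁ s μ (+ b) (+ b′))
      ∙ ≈-by₂ (μ ℤ.* μ) (+ c ℤ.* (s ℤ.* μ ℤ.+ + 1)) ec (scale-unscale v) (lemma₂ s μ (+ b) (+ c) (+ c′)))
      where
      lemma₁ : ∀ s m b b′ → m ℤ.* m ℤ.* b′ ℤ.+ m ℤ.* + 0 ℤ.+ m ℤ.* + 0 ≡ b ℤ.* m
        ℤ.+ m ℤ.* m ℤ.* (b′ ℤ.- s ℤ.* b) ℤ.+ b ℤ.* m ℤ.* (s ℤ.* m ℤ.- + 1)
      lemma₁ = solve-∀
      lemma₂ : ∀ s m b c c′ → m ℤ.* m ℤ.* c′ ℤ.+ + 0 ℤ.* + 0 ≡ b ℤ.* + 0 ℤ.+ c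
        ℤ.+ m ℤ.* m ℤ.* (c′ ℤ.- s ℤ.* s ℤ.* c) ℤ.+ c ℤ.* (s ℤ.* m ℤ.+ + 1) ℤ.* (s ℤ.* m ℤ.- + 1)
      lemma₂ = solve-∀
    open Evaluation n (+ b) (+ c) n (+ b′) (+ c′) ℕ.∣-refl θ θ-root using (power-at-root)
    one : const (s ℤ.^ suc n) · const μ ↑ suc n ≋ 𝟙 [ n ]
    one = begin
      const (s ℤ.^ suc n) · const μ ↑ suc n   ≈⟨ ·-cong (const-↑ s (suc n)) ≋-refl ⟨
      const s ↑ suc n · const μ ↑ suc n       ≈⟨ ^-distrib-* (const s) (const μ) (suc n) ⟨
      (const s · const μ) ↑ suc n             ≈⟨ ^-congˡ (suc n) (≋-trans (const-* s μ) (const-cong (scale-unscale v))) ⟩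
      𝟙 ↑ suc n                               ≈⟨ 1↑ (suc n) ⟩
      𝟙                                       ∎
    lemma : ∀ s t c c′ → s ℤ.* (s ℤ.* t) ℤ.* ℤ.- c ≡ t ℤ.* ℤ.- c′ ℤ.+ t ℤ.* (c′ ℤ.- s ℤ.* s ℤ.* c)
    lemma = solve-∀

  -- By `scale-^` the two sides differ by (n / p) (n - 1) (v - w) ν, so p divides (n - 1) (v - w) ν.
  -- Here ν is a unit and n - 1 is -1 modulo p.
  scale-unique : ∀ {v w z} → v < p → w < p → J L z →
    scale v ℤ.^ (n ∸ 1) ℤ.* ν z ≈ scale w ℤ.^ (n ∸ 1) ℤ.* ν z [ n ] → v ≡ w
  scale-unique {v} {w} {z} v<p w<p (_ , χν≡1) eq = residue-unique v<p w<p (≈-by₂ (ℤ.- + 1) (+ v ℤ.- + w) [n-1][v-w]≈0 n≈0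
      (subst (λ k → + v ≡ + w ℤ.+ ℤ.- + 1 ℤ.* (+ (n ∸ 1) ℤ.* (+ v ℤ.- + w) ℤ.- + 0) ℤ.+ (+ v ℤ.- + w) ℤ.* (k ℤ.- + 0))
        1+[n-1]≡n (lemma₂ (+ v) (+ w) (+ (n ∸ 1)))))
    where
    1+[n-1]≡n : + 1 ℤ.+ + (n ∸ 1) ≡ + n
    1+[n-1]≡n = trans (sym (ℤₚ.pos-+ 1 (n ∸ 1))) (cong +_ (ℕₚ.m+[n∸m]≡n (>-nonZero⁻¹ n)))
    lemma₂ : ∀ v w k → v ≡ w ℤ.+ ℤ.- + 1 ℤ.* (k ℤ.* (v ℤ.- w) ℤ.- + 0) ℤ.+ (v ℤ.- w) ℤ.* (+ 1 ℤ.+ k ℤ.- + 0)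
    lemma₂ = solve-∀
    n≈0 : + n ≈ + 0 [ p ]
    n≈0 = ∣⇒≈0 p∣n
    X = + (n ∸ 1) ℤ.* (+ v ℤ.- + w) ℤ.* ν z
    eX≈0 : + e ℤ.* X ≈ + 0 [ n ]
    eX≈0 = ≈-by₃ (+ 1) (ℤ.- ν z) (ν z) eq (scale-^ v (n ∸ 1)) (scale-^ w (n ∸ 1))
      (lemma (+ e) (+ v) (+ w) (+ (n ∸ 1)) (ν z) (scale v ℤ.^ (n ∸ 1)) (scale w ℤ.^ (n ∸ 1)))
      where
      lemma : ∀ e v w k x s t → e ℤ.* (k ℤ.* (v ℤ.- w) ℤ.* x) ≡ + 0 ℤ.+ + 1 ℤ.* (s ℤ.* x ℤ.- t ℤ.* x)
        ℤ.+ ℤ.- x ℤ.* (s ℤ.- (+ 1 ℤ.+ k ℤ.* (e ℤ.* v))) ℤ.+ x ℤ.* (t ℤ.- (+ 1 ℤ.+ k ℤ.* (e ℤ.* w)))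
      lemma = solve-∀
    X≈0 : X ≈ + 0 [ p ]
    X≈0 = ∣⇒≈0 (ℕ.*-cancelˡ-∣ {p} {ℤ.∣ X ∣} e (subst₂ _∣_ (trans n≡pe (ℕₚ.*-comm p e)) (ℤₚ.abs-* (+ e) X) (≈0⇒∣ eX≈0)))
    ν≉0 : ¬ ν z ≈ + 0 [ p ]
    ν≉0 = Χ≢0⇒≉0 primes (ν z) (prime∣n⇒∈ pp p∣n) (λ e → case trans (sym χν≡1) e of λ ())
    [n-1][v-w]≈0 : + (n ∸ 1) ℤ.* (+ v ℤ.- + w) ≈ + 0 [ p ]
    [n-1][v-w]≈0 = [ id , (λ e → contradiction e ν≉0) ]′ (≈-prime pp X≈0)

  Scaled-unique : ∀ v {z₁ z₂} z′ → z₁ ∈ pairs → z₂ ∈ pairs → Scaled v z₁ z′ → Scaled v z₂ z′ → z₁ ≡ z₂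
  Scaled-unique v {b₁ , c₁} {b₂ , c₂} z′ z₁∈ z₂∈ (eb₁ , ec₁) (eb₂ , ec₂) =
    let b₁< , c₁< = ∈-residuePairs⇒< z₁∈ ; b₂< , c₂< = ∈-residuePairs⇒< z₂∈ in
    cong₂ _,_ (residue-unique b₁< b₂< (unscaled (+ b₁) (+ b₂) (≈-trans (≈-sym eb₁) eb₂)))
              (residue-unique c₁< c₂< (unscaled (+ c₁) (+ c₂) (unscaled (s ℤ.* + c₁) (s ℤ.* + c₂)
                (≈-trans (≈-reflexive (sym (ℤₚ.*-assoc s s (+ c₁)))) (≈-trans (≈-sym ec₁) (≈-trans ec₂ (≈-reflexive (ℤₚ.*-assoc s s (+ c₂)))))))))
    where
    s = scale v
    unscaled : ∀ x y → s ℤ.* x ≈ s ℤ.* y [ n ] → x ≈ y [ n ]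
    unscaled x y e = ≈-by₂ (unscale v) (y ℤ.- x) e (scale-unscale v) (lemma s (unscale v) x y)
      where
      lemma : ∀ s m x y → x ≡ y ℤ.+ m ℤ.* (s ℤ.* x ℤ.- s ℤ.* y) ℤ.+ (y ℤ.- x) ℤ.* (s ℤ.* m ℤ.- + 1)
      lemma = solve-∀

  passing? : ∀ z → Dec (J L z × Step4 n z)
  passing? z = J? L z ×-dec (_ ≋? _)

  -- The couples (z , v) with z passing and v < p are sent to the scaled pair. This lands in `J` and
  -- is injective.
  square-factor-bound : p * ∑ pairs (ind ∘ passing?) ≤ ∑ pairs (ind ∘ J? L)
  square-factor-bound = begin
    p * ∑ pairs (ind ∘ passing?)                         ≡⟨ ∑-*ˡ pairs p (ind ∘ passing?) ⟨
    ∑ pairs (λ z → p * ind (passing? z))                 ≡⟨ ∑-cong pairs (λ {z} _ → ∑-upTo-const p (ind (passing? z))) ⟨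
    ∑ pairs (λ z → ∑ (upTo p) (λ _ → ind (passing? z)))  ≡⟨ ∑-cartesian pairs (upTo p) (λ (z , _) → ind (passing? z)) ⟨
    ∑ scalings (λ (z , _) → ind (passing? z))            ≡⟨ ℕₚ.*-identityˡ _ ⟨
    1 * ∑ scalings (λ (z , _) → ind (passing? z))        ≤⟨ double-count-≤ scalings pairs (λ zv z′ → ind (r? zv z′)) 1 (λ {zv} _ → lower zv) (λ {z′} _ → upper z′) ⟩
    ∑ pairs (ind ∘ J? L)                                 ∎
    where
    open ℕₚ.≤-Reasoning
    scalings = cartesianProduct pairs (upTo p)
    scaled? : ∀ v z z′ → Dec (Scaled v z z′)
    scaled? v z z′ = (_ ≈? _) ×-dec (_ ≈? _)
    r? : ∀ zv z′ → Dec ((J L (proj₁ zv) × Step4 n (proj₁ zv)) × Scaled (proj₂ zv) (proj₁ zv) z′)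
    r? (z , v) z′ = passing? z ×-dec scaled? v z z′
    lower : ∀ zv → 1 * ind (passing? (proj₁ zv)) ≤ ∑ pairs (λ z′ → ind (r? zv z′))
    lower (z@(b , c) , v) = *-ind-bound 1 (passing? z) λ P →
      ℕₚ.≤-trans (ℕₚ.≤-reflexive (sym (ind-true (r? (z , v) z′) (P , residue≈ n (s ℤ.* + b) , residue≈ n (s ℤ.* s ℤ.* + c)))))
        (∈⇒≤∑ (λ z′ → ind (r? (z , v) z′)) (∈-residuePairs (residue< n (s ℤ.* + b)) (residue< n (s ℤ.* s ℤ.* + c))))
      where
      s = scale v
      z′ = residue n (s ℤ.* + b) , residue n (s ℤ.* s ℤ.* + c)
    unique : ∀ z′ {zv zw} → zv ∈ scalings → zw ∈ scalings →
      (J L (proj₁ zv) × Step4 n (proj₁ zv)) × Scaled (proj₂ zv) (proj₁ zv) z′ →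
      (J L (proj₁ zw) × Step4 n (proj₁ zw)) × Scaled (proj₂ zw) (proj₁ zw) z′ → zv ≡ zw
    unique z′ {z , v} {y , w} zv∈ yw∈ ((jz , sz) , rz) ((jy , sy) , ry) =
      let z∈ , v∈ = ∈ₚ.∈-cartesianProduct⁻ pairs (upTo p) zv∈
          y∈ , w∈ = ∈ₚ.∈-cartesianProduct⁻ pairs (upTo p) yw∈
          -- Both couples prescribe the value of x^(n+1) in the ring of their common image z′.
          -- Comparing the two values gives v = w, and then z is recovered by unscaling.
          v≡w = scale-unique {v} {w} {z′} (∈-upTo⇒< v∈) (∈-upTo⇒< w∈) (Scaled-J v z z′ rz jz)
            (1-part (≋-trans′ (scaled-step4 v z z′ rz sz) (scaled-step4 w y z′ ry sy)))
      in cong₂ _,_ (Scaled-unique v z′ z∈ y∈ rz (subst (λ u → Scaled u y z′) (sym v≡w) ry)) v≡w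
      where
      ≋-trans′ : ∀ {x y y′} → x ≋ y [ n ] → x ≋ y′ [ n ] → y ≋ y′ [ n ]
      ≋-trans′ (a ∙ b) (a′ ∙ b′) = ≈-trans (≈-sym a) a′ ∙ ≈-trans (≈-sym b) b′
    upper : ∀ z′ → ∑ scalings (λ zv → ind (r? zv z′)) ≤ ind (J? L z′)
    upper z′ = ∑-bound-by-witness scalings (λ zv → ind (r? zv z′)) λ {zv} _ 1≤ →
      let P , s = ind-pos (r? zv z′) 1≤ in
      subst (∑ scalings (λ zv → ind (r? zv z′)) ≤_) (sym (ind-true (J? L z′) (Scaled-J (proj₂ zv) (proj₁ zv) z′ s (proj₁ P))))
        (∑-ind≤1 (λ zv → r? zv z′) scalings (Uniqueₚ.cartesianProduct⁺ (residuePairs! n) (upTo! p)) (unique z′))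

-- Passing parameters

record Passes (n B : ℕ) (L : List ℕ) (z : ℕ × ℕ) : Set where
  open Quadratic n (+ proj₁ z) (+ proj₂ z) using (gen; _↑_; const)
  s : ℕ
  s = proj₂ (split2 (n * n ∸ 1))
  field
    params : J L z
    step1  : ¬ T (step1Composite B n)
    step3  : ∃ λ w → gen ↑ ((n + 1) div 2) ≋ const w [ n ]
    step4  : Step4 n z
    step5  : gen ↑ s ≋ const (+ 1) [ n ] ⊎ (∃ λ j → gen ↑ (2 ^ j * s) ≋ const -[1+ 0 ] [ n ])

T-not : ∀ {b} → T (not b) → ¬ T b
T-not {true} ()
T-not {false} _ ()

module Unpack (n : ℕ) (1<n : 1 < n) (L : List ℕ) (L≡ : L ≡ factors n n) where
  open Modulus n 1<n L L≡

  module _ (z : ℕ × ℕ) where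
    private
      b = proj₁ z
      c = proj₂ z
    open Ring n b c
    open Quadratic n (+ b) (+ c)
    open import Relation.Binary.Reasoning.Setoid ≋-setoid

    mulR≋ : ∀ x y → embed (mulR x y) ≋ embed x · embed y [ n ]
    mulR≋ (u , v) (u′ , v′) = subst (embed (mulR (u , v) (u′ , v′)) ≋_[ n ]) (sym (mul-def (+ b) (+ c) (+ u) (+ v) (+ u′) (+ v′)))
      ( ≈-trans (mod≈ _ n) (≈-reflexive (trans (ℤₚ.pos-+ (u * u′ * b + u * v′) (u′ * v)) (cong₂ ℤ._+_
          (trans (ℤₚ.pos-+ (u * u′ * b) (u * v′)) (cong₂ ℤ._+_ (pos-*³ u u′ b) (ℤₚ.pos-* u v′))) (ℤₚ.pos-* u′ v))))
      ∙ ≈-trans (mod≈ _ n) (≈-reflexive (trans (ℤₚ.pos-+ (u * u′ * c) (v * v′)) (cong₂ ℤ._+_ (pos-*³ u u′ c) (ℤₚ.pos-* v v′)))))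
      where
      pos-*³ : ∀ a b c → + (a * b * c) ≡ + a ℤ.* + b ℤ.* + c
      pos-*³ a b c = trans (ℤₚ.pos-* (a * b) c) (cong (ℤ._* + c) (ℤₚ.pos-* a b))

    powR≋ : ∀ k → embed (powR xR k) ≋ gen ↑ k [ n ]
    powR≋ zero    = ≈-refl ∙ mod≈ 1 n
    powR≋ (suc k) = ≋-trans (mulR≋ xR (powR xR k)) (·-cong (mod≈ 1 n ∙ ≈-refl) (powR≋ k))

    ≟R⇒≋ : ∀ x y → T (x ≟R y) → embed x ≋ embed y [ n ]
    ≟R⇒≋ x y t = let t₁ , t₂ = T-∧⁻ {proj₁ (red x) ≡ᵇ proj₁ (red y)} t in
      mod≡⇒≈ (ℕₚ.≡ᵇ⇒≡ _ _ t₁) ∙ mod≡⇒≈ (ℕₚ.≡ᵇ⇒≡ _ _ t₂)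

    power≋ : ∀ k y → T (powR xR k ≟R y) → gen ↑ k ≋ embed y [ n ]
    power≋ k y t = ≋-trans (≋-sym (powR≋ k)) (≟R⇒≋ (powR xR k) y t)

    negOne≋ : embed negOne ≋ const -[1+ 0 ] [ n ]
    negOne≋ = ≈-refl ∙ ≈-trans (mod≈ (n ∸ 1) n) (≈-trans (≈-reflexive (trans (sym (ℤₚ.⊖-≥ (>-nonZero⁻¹ n))) (sym (ℤₚ.m-n≡m⊖n n 1))))
      (≈-by₁ (+ 1) n≈0 (lemma (+ n))))
      where
      n≈0 : + n ≈ + 0 [ n ]
      n≈0 = ∣⇒≈0 ℕ.∣-refl
      lemma : ∀ n → n ℤ.- + 1 ≡ -[1+ 0 ] ℤ.+ + 1 ℤ.* (n ℤ.- + 0)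
      lemma = solve-∀

    unpack : ∀ B → T (passesQFT B n b c) → Passes n B L z
    unpack B t = let
      q , t₁ = T-∧⁻ {qftParams n b c} t
      s₁ , t₂ = T-∧⁻ {not (step1Composite B n)} t₁
      s₂ , t₃ = T-∧⁻ {not (step2Composite n)} t₂
      s₃ , t₄ = T-∧⁻ {proj₁ (powR xR ((n + 1) div 2)) ≡ᵇ 0} t₃
      s₄ , s₅ = T-∧⁻ {powR xR (n + 1) ≟R negC} t₄
      in record
        { params = qftParams⇒J z q
        ; step1  = T-not s₁
        ; step3  = + proj₂ (powR xR ((n + 1) div 2))
                 , ≋-trans (≋-sym (powR≋ ((n + 1) div 2))) (≈-reflexive (cong +_ (ℕₚ.≡ᵇ⇒≡ _ 0 s₃)) ∙ ≈-refl)
        ; step4  = subst (λ k → gen ↑ k ≋ const (ν z) [ n ]) (ℕₚ.+-comm n 1)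
                     (≋-trans (power≋ (n + 1) negC s₄) (≈-refl ∙ complement≈ n c))
        ; step5  = [ (λ t → inj₁ (≋-trans (power≋ s oneR t) (≈-refl ∙ mod≈ 1 n)))
                   , (λ t → let j , tj = Any.satisfied (Anyₚ.any⁻ _ (upTo (r ∸ 1)) t)
                            in inj₂ (j , ≋-trans (power≋ (2 ^ j * s) negOne tj) negOne≋)) ]′
                   (T-∨⁻ {powR xR s ≟R oneR} s₅) }
      where
      r = proj₁ (split2 (n * n ∸ 1))
      s = proj₂ (split2 (n * n ∸ 1))

-- Trial division sees only primes up to √n. If a prime factor q ≤ B lies above √n, the cofactor n /
-- q exceeds 1, as n is composite, and lies below q. Its least prime factor is then one that the
-- trial division does see.
step1⇒prime-factors> : ∀ {B n} → Composite n → ¬ T (step1Composite B n) → ∀ {q} → Prime q → q ∣ n → B < q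
step1⇒prime-factors> {B} {n} comp no-small {q} qp q∣n with q ≤? B
... | no  q≰B = ℕₚ.≰⇒> q≰B
... | yes q≤B = ⊥-elim (small q qp q∣n q≤B square≤)
  where
  instance _ = ℕ.composite⇒nonZero comp
  small : ∀ q → Prime q → q ∣ n → q ≤ B → ∃ (λ q′ → Prime q′ × q′ ∣ n × q′ ≤ q × q′ * q′ ≤ n) → ⊥
  small q qp q∣n q≤B (q′ , qp′ , q′∣n , q′≤q , q′²≤n) = no-small (Anyₚ.any⁺ (λ p → does (prime? p) ∧ ((p * p) ≤ᵇ n) ∧ (p divides? n)) (lose (∈-upTo (s≤s (ℕₚ.≤-trans q′≤q q≤B)))
    (T-∧⁺ {does (prime? q′)} (T-does⁺ (prime? q′) qp′ , T-∧⁺ {q′ * q′ ≤ᵇ n} (ℕₚ.≤⇒≤ᵇ q′²≤n , divides-true)))))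
    where
    instance _ = ℕ.prime⇒nonZero qp′
    divides-true : T (q′ divides? n)
    divides-true = ℕₚ.≡⇒≡ᵇ _ 0 (trans (mod≡% n q′) (ℕ.n∣m⇒m%n≡0 n q′ q′∣n))
  square≤ : ∃ (λ q′ → Prime q′ × q′ ∣ n × q′ ≤ q × q′ * q′ ≤ n)
  square≤ with q * q ≤? n
  ... | yes q²≤n = q , qp , q∣n , ℕₚ.≤-refl , q²≤n
  ... | no  q²≰n = q′ , spf-prime 1<t , ℕ.∣-trans (spf∣ 1<t) (ℕ.divides q (trans n≡tq (ℕₚ.*-comm t q))) , q′≤q ,
                   ℕₚ.≤-trans (ℕₚ.*-mono-≤ q′≤t q′≤q) (ℕₚ.≤-reflexive (sym n≡tq))
    where
    t = ℕ._∣_.quotient q∣n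
    n≡tq : n ≡ t * q
    n≡tq = ℕ._∣_.equality q∣n
    t<q : t < q
    t<q = ℕₚ.*-cancelʳ-< q t q (subst (_< q * q) n≡tq (ℕₚ.≰⇒> q²≰n))
    1<t : 1 < t
    1<t with t | n≡tq
    ... | zero        | e = contradiction e (≢-nonZero⁻¹ n)
    ... | suc zero    | e = ⊥-elim (ℕ.prime⇒¬composite qp (subst Composite (trans e (ℕₚ.*-identityˡ q)) comp))
    ... | suc (suc _) | _ = s≤s (s≤s z≤n)
    q′ = spf t
    q′≤t : q′ ≤ t
    q′≤t = ℕ.∣⇒≤ {{>-nonZero (ℕₚ.<-trans (s≤s z≤n) 1<t)}} (spf∣ 1<t)
    q′≤q : q′ ≤ q
    q′≤q = ℕₚ.≤-trans q′≤t (ℕₚ.<⇒≤ t<q)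

-- Passing conditions at the prime factors

coprime-tail : ∀ {p L} → All Prime (p ∷ L) → Unique (p ∷ L) → Coprime p (product L)
coprime-tail (pp ∷ pps) (p∉ ∷ _) = Coprime.sym (prime∤⇒coprime pp λ p∣ → All.lookup p∉ (prime∣product pp pps p∣) refl)

embed-weaken : ∀ {d m z z′} → d ∣ m → embed z ≋ embed z′ [ m ] → embed z ≋ embed z′ [ d ]
embed-weaken d∣m (p ∙ q) = ≈-weaken d∣m p ∙ ≈-weaken d∣m q

-- Evaluation at x itself, with target modulus p.
weaken-power : ∀ {n p} b c k {a} → p ∣ n → Quadratic._↑_ n b c (+ 1 , + 0) k ≋ (+ 0 , a) [ n ] →
  Quadratic._↑_ p b c (+ 1 , + 0) k ≋ (+ 0 , a) [ p ]
weaken-power {n} {p} b c k p∣n e = Evaluation.power-at-root n b c p b c p∣n (+ 1 , + 0) root₁ k e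
  where
  root₁ : mul b c (+ 1 , + 0) (+ 1 , + 0) ≋ (b ℤ.* + 1 , b ℤ.* + 0 ℤ.+ c) [ p ]
  root₁ = subst (_≋ (b ℤ.* + 1 , b ℤ.* + 0 ℤ.+ c) [ p ]) (sym (mul-def b c (+ 1) (+ 0) (+ 1) (+ 0))) (≋-reflexive (lemma₁ b) (lemma₂ b c))
    where
    lemma₁ : ∀ b → + 1 ℤ.* + 1 ℤ.* b ℤ.+ + 1 ℤ.* + 0 ℤ.+ + 1 ℤ.* + 0 ≡ b ℤ.* + 1
    lemma₁ = solve-∀
    lemma₂ : ∀ b c → + 1 ℤ.* + 1 ℤ.* c ℤ.+ + 0 ℤ.* + 0 ≡ b ℤ.* + 0 ℤ.+ c
    lemma₂ = solve-∀

power-periodic : ∀ {p z z′} k {a a′} → embed z ≋ embed z′ [ p ] → a ≈ a′ [ p ] →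
  Quadratic._↑_ p (+ proj₁ z) (+ proj₂ z) (+ 1 , + 0) k ≋ (+ 0 , a) [ p ] →
  Quadratic._↑_ p (+ proj₁ z′) (+ proj₂ z′) (+ 1 , + 0) k ≋ (+ 0 , a′) [ p ]
power-periodic {p} {b , c} {b′ , c′} k {a} {a′} (eb ∙ ec) a≈a′ e =
  ≋-trans (Evaluation.power-at-root p (+ b) (+ c) p (+ b′) (+ c′) ℕ.∣-refl (+ 1 , + 0) root₁ k e) (≈-refl ∙ a≈a′)
  where
  open Quadratic p (+ b′) (+ c′) using (≋-trans)
  root₁ : mul (+ b′) (+ c′) (+ 1 , + 0) (+ 1 , + 0) ≋ (+ b ℤ.* + 1 , + b ℤ.* + 0 ℤ.+ + c) [ p ]
  root₁ = subst (_≋ (+ b ℤ.* + 1 , + b ℤ.* + 0 ℤ.+ + c) [ p ]) (sym (mul-def (+ b′) (+ c′) (+ 1) (+ 0) (+ 1) (+ 0)))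
    (≈-by₁ (ℤ.- + 1) eb (lemma₁ (+ b) (+ b′)) ∙ ≈-by₁ (ℤ.- + 1) ec (lemma₂ (+ b) (+ c) (+ c′)))
    where
    lemma₁ : ∀ b b′ → + 1 ℤ.* + 1 ℤ.* b′ ℤ.+ + 1 ℤ.* + 0 ℤ.+ + 1 ℤ.* + 0 ≡ b ℤ.* + 1 ℤ.+ ℤ.- + 1 ℤ.* (b ℤ.- b′)
    lemma₁ = solve-∀
    lemma₂ : ∀ b c c′ → + 1 ℤ.* + 1 ℤ.* c′ ℤ.+ + 0 ℤ.* + 0 ≡ b ℤ.* + 0 ℤ.+ c ℤ.+ ℤ.- + 1 ℤ.* (c ℤ.- c′)
    lemma₂ = solve-∀

embed-sym : ∀ {m z z′} → embed z ≋ embed z′ [ m ] → embed z′ ≋ embed z [ m ]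
embed-sym (p ∙ q) = ≈-sym p ∙ ≈-sym q

periodic-ind : ∀ {m} {P : ℕ × ℕ → Set} (P? : ∀ z → Dec (P z)) →
  (∀ {z z′} → embed z ≋ embed z′ [ m ] → P z → P z′) → Periodic m (ind ∘ P?)
periodic-ind P? h {z} {z′} e = ind-cong (P? z) (P? z′) (h e) (h (embed-sym e))

minus-periodic : ∀ {p} → Prime p → Periodic p (ind ∘ minus? p)
minus-periodic {p} pp = periodic-ind (minus? p) λ e χ≡ → trans (χ-cong p (≈-sym (Δ-cong e))) χ≡
  where instance _ = ℕ.prime⇒nonZero pp

plus-periodic : ∀ {p} → Prime p → ∀ N → Periodic p (ind ∘ plus? p N)
plus-periodic {p} pp N = periodic-ind (plus? p N) λ {z} e (χ≡ , ν≉0 , step4) →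
  trans (χ-cong p (≈-sym (Δ-cong e))) χ≡ , (λ ν≈0 → ν≉0 (≈-trans (ν-cong e) ν≈0)) , power-periodic {z = z} (suc N) e (ν-cong e) step4
  where instance _ = ℕ.prime⇒nonZero pp

frobenius-periodic : ∀ {p} → Prime p → ∀ N → Periodic p (ind ∘ frobenius? p N)
frobenius-periodic {p} pp N = periodic-ind (frobenius? p N) λ {z} e (χ≡ , step4) →
  trans (χ-cong p (≈-sym (Δ-cong e))) χ≡ , power-periodic {z = z} (suc N) e (ν-cong e) step4
  where instance _ = ℕ.prime⇒nonZero pp

power-periodic-ind : ∀ {p} → Prime p → ∀ d a → Periodic p (ind ∘ power? p d a)
power-periodic-ind {p} pp d a = periodic-ind (power? p d a) λ {z} e (χ≡ , xᵈ≋a) →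
  trans (χ-cong p (≈-sym (Δ-cong e))) χ≡ , power-periodic {z = z} d e ≈-refl xᵈ≋a
  where instance _ = ℕ.prime⇒nonZero pp

-- Products of local counts

Weight : Set
Weight = ℕ → ℕ × ℕ → ℕ

PeriodicWeight : Weight → Set
PeriodicWeight W = ∀ {p} → Prime p → Periodic p (W p)

local-sum : Weight → ℕ → ℕ
local-sum W p = ∑ (residuePairs p) (W p)

product-weight : Weight → List ℕ → ℕ × ℕ → ℕ
product-weight W []      z = 1
product-weight W (p ∷ L) z = W p z * product-weight W L z

product-weight-periodic : ∀ {W} → PeriodicWeight W → ∀ {L} → All Prime L → Periodic (product L) (product-weight W L)
product-weight-periodic per []                 e = refl
product-weight-periodic per {p ∷ L} (pp ∷ pps) e =
  cong₂ _*_ (per pp (embed-weaken (ℕ.m∣m*n (product L)) e)) (product-weight-periodic per pps (embed-weaken (ℕ.n∣m*n p) e))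

∑-product-weight : ∀ {W} → PeriodicWeight W → ∀ {L} → All Prime L → Unique L →
  ∑ (residuePairs (product L)) (product-weight W L) ≡ product (map (local-sum W) L)
∑-product-weight per []                 _ = refl
∑-product-weight {W} per {p ∷ L} (pp ∷ pps) L! = trans
  (crt-∑ {{ℕ.prime⇒nonZero pp}} {{ℕ.productOfPrimes≢0 pps}} (coprime-tail (pp ∷ pps) L!) {W p} {product-weight W L} (per pp) (product-weight-periodic per pps))
  (cong (local-sum W p *_) (∑-product-weight per pps (AllPairs.tail L!)))

product-weight-ind : ∀ {P : ℕ → ℕ × ℕ → Set} (P? : ∀ p z → Dec (P p z)) {L z} →
  All (λ p → P p z) L → 1 ≤ product-weight (λ p → ind ∘ P? p) L z
product-weight-ind P? []                 = ℕₚ.≤-refl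
product-weight-ind P? {p ∷ L} {z} (P ∷ Ps) = ℕₚ.*-mono-≤ (ℕₚ.≤-reflexive (sym (ind-true (P? p z) P))) (product-weight-ind P? Ps)

minus-weight : Weight
minus-weight p = ind ∘ minus? p

plus-weight : ℕ → Weight
plus-weight N p = ind ∘ plus? p N

-- Bounds the indicator of "at least i primes of L are of plus type, all others of minus type".
at-least : ℕ → ℕ → List ℕ → ℕ × ℕ → ℕ
at-least N zero    []      z = 1
at-least N (suc i) []      z = 0
at-least N i       (p ∷ L) z = plus-weight N p z * at-least N (pred i) L z + minus-weight p z * at-least N i L z

-- Not definitional for a variable i, because the clauses of `at-least` split on i as well as on the
-- list.
at-least-∷ : ∀ N i p L z → at-least N i (p ∷ L) z ≡ plus-weight N p z * at-least N (pred i) L z + minus-weight p z * at-least N i L z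
at-least-∷ N zero    p L z = refl
at-least-∷ N (suc i) p L z = refl

at-least-periodic : ∀ N i {L} → All Prime L → Periodic (product L) (at-least N i L)
at-least-periodic N zero    []                 e = refl
at-least-periodic N (suc i) []                 e = refl
at-least-periodic N i       {p ∷ L} (pp ∷ pps) {z} {z′} e = trans (at-least-∷ N i p L z) (trans
  (cong₂ _+_ (cong₂ _*_ (plus-periodic pp N e₁) (at-least-periodic N (pred i) pps e₂))
             (cong₂ _*_ (minus-periodic pp e₁) (at-least-periodic N i pps e₂)))
  (sym (at-least-∷ N i p L z′)))
  where
  e₁ = embed-weaken (ℕ.m∣m*n (product L)) e
  e₂ = embed-weaken (ℕ.n∣m*n p) e

module _ (β : ℕ) (1≤β : 1 ≤ β) (N : ℕ) where

  -- There are at most p / 2 plus pairs and p² / 2 minus pairs, and β ≤ p raises the former to at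
  -- most p² / 2.
  plus+minus≤p² : ∀ {p} → Prime p → Odd p → β ≤ p → β * local-sum (plus-weight N) p + local-sum minus-weight p ≤ p * p
  plus+minus≤p² {p} pp (h , p≡) β≤p = ℕₚ.*-cancelˡ-≤ 2 (begin
    2 * (β * g + m)           ≡⟨ lemma β g m ⟩
    β * (2 * g) + 2 * m       ≤⟨ ℕₚ.+-mono-≤ (ℕₚ.*-mono-≤ β≤p (ParameterCounts.2plus≤p p pp h p≡ N)) (OddPrime.2minus≤p² p pp h p≡) ⟩
    p * p + p * p             ≡⟨ cong (λ k → p * p + k) (ℕₚ.+-identityʳ (p * p)) ⟨
    2 * (p * p)               ∎)
    where
    open ℕₚ.≤-Reasoning
    g = local-sum (plus-weight N) p
    m = local-sum minus-weight p
    lemma : ∀ β g m → 2 * (β * g + m) ≡ β * (2 * g) + 2 * m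
    lemma = ℕ-Solver.solve-∀

  -- Each of the i required plus primes gains a factor β. In the induction a plus prime takes one β
  -- out of β^i and leaves β^(i-1) to the tail. A minus prime leaves all of β^i to it, and
  -- `plus+minus≤p²` adds up both contributions.
  at-least-bound : ∀ i {L} → All Prime L → Unique L → All Odd L → All (β ≤_) L →
    β ^ i * ∑ (residuePairs (product L)) (at-least N i L) ≤ product L * product L
  at-least-bound zero    []                 _ _ _ = ℕₚ.≤-refl
  at-least-bound (suc i) []                 _ _ _ = ℕₚ.≤-trans (ℕₚ.≤-reflexive (ℕₚ.*-zeroʳ (β ^ suc i))) z≤n
  at-least-bound i       {p ∷ L} (pp ∷ pps) L! (o ∷ os) (β≤ ∷ βs) = begin
    β ^ i * ∑ (residuePairs (product (p ∷ L))) (at-least N i (p ∷ L)) ≡⟨ cong (β ^ i *_) split ⟩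
    β ^ i * (g * a + m * b)                                           ≤⟨ step i refl refl ⟩
    (β * g + m) * (P * P)                                             ≤⟨ ℕₚ.*-monoˡ-≤ (P * P) (plus+minus≤p² pp o β≤) ⟩
    p * p * (P * P)                                                   ≡⟨ lemma p P ⟩
    product (p ∷ L) * product (p ∷ L)                                 ∎
    where
    open ℕₚ.≤-Reasoning
    P = product L
    E : ℕ → ℕ
    E i = ∑ (residuePairs P) (at-least N i L)
    g = local-sum (plus-weight N) p
    m = local-sum minus-weight p
    a = E (pred i)
    b = E i
    instance
      _ = ℕ.prime⇒nonZero pp
      _ = ℕ.productOfPrimes≢0 pps
    cop = coprime-tail (pp ∷ pps) L!
    split : ∑ (residuePairs (product (p ∷ L))) (at-least N i (p ∷ L)) ≡ g * a + m * b
    split = trans (∑-cong (residuePairs (p * P)) (λ {z} _ → at-least-∷ N i p L z)) (trans (∑-+ (residuePairs (p * P)) _ _)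
      (cong₂ _+_ (crt-∑ cop {plus-weight N p} {at-least N (pred i) L} (plus-periodic pp N) (at-least-periodic N (pred i) pps))
                 (crt-∑ cop {minus-weight p} {at-least N i L} (minus-periodic pp) (at-least-periodic N i pps))))
    bound : ∀ i → β ^ i * E i ≤ P * P
    bound i = at-least-bound i pps (AllPairs.tail L!) os βs
    step : ∀ i {a b} → a ≡ E (pred i) → b ≡ E i → β ^ i * (g * a + m * b) ≤ (β * g + m) * (P * P)
    step zero    {a} {b} refl refl = begin
      1 * (g * E 0 + m * E 0)         ≡⟨ lemma₀ g m (E 0) ⟩
      (g + m) * (1 * E 0)             ≤⟨ ℕₚ.*-mono-≤ (ℕₚ.+-monoˡ-≤ m (ℕₚ.m≤n*m g β {{>-nonZero 1≤β}})) (bound 0) ⟩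
      (β * g + m) * (P * P)           ∎
      where
      lemma₀ : ∀ g m e → 1 * (g * e + m * e) ≡ (g + m) * (1 * e)
      lemma₀ = ℕ-Solver.solve-∀
    step (suc i) {a} {b} refl refl = begin
      β * β ^ i * (g * E i + m * E (suc i))              ≡⟨ lemma₁ β (β ^ i) g m (E i) (E (suc i)) ⟩
      β * g * (β ^ i * E i) + m * (β * β ^ i * E (suc i)) ≤⟨ ℕₚ.+-mono-≤ (ℕₚ.*-monoʳ-≤ (β * g) (bound i)) (ℕₚ.*-monoʳ-≤ m (bound (suc i))) ⟩
      β * g * (P * P) + m * (P * P)                      ≡⟨ ℕₚ.*-distribʳ-+ (P * P) (β * g) m ⟨
      (β * g + m) * (P * P)                              ∎
      where
      lemma₁ : ∀ β x g m e f → β * x * (g * e + m * f) ≡ β * g * (x * e) + m * (β * x * f)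
      lemma₁ = ℕ-Solver.solve-∀
    lemma : ∀ p P → p * p * (P * P) ≡ p * P * (p * P)
    lemma = ℕ-Solver.solve-∀

-- Signs and the number of plus primes

sgn : List ℕ → ℤ
sgn []      = + 1
sgn (p ∷ L) = -[1+ 0 ] ℤ.* sgn L

sgn-±1 : ∀ L → (sgn L ≡ + 1) ⊎ (sgn L ≡ -[1+ 0 ])
sgn-±1 []      = inj₁ refl
sgn-±1 (p ∷ L) with sgn L | sgn-±1 L
... | _ | inj₁ refl = inj₂ refl
... | _ | inj₂ refl = inj₁ refl

module Signs (N : ℕ) (z : ℕ × ℕ) where

  AllMinus : List ℕ → Set
  AllMinus = All (λ p → Minus p z)

  Signed : List ℕ → Set
  Signed = All (λ p → Minus p z ⊎ Plus p N z)

  Χ-all-minus : ∀ {L} → AllMinus L → Χ L (Δ z) ≡ sgn L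
  Χ-all-minus []       = refl
  Χ-all-minus (m ∷ ms) = cong₂ ℤ._*_ m (Χ-all-minus ms)

  extend-minus : ∀ i p L → Minus p z → 1 ≤ at-least N i L z → 1 ≤ at-least N i (p ∷ L) z
  extend-minus i p L m h = subst (1 ≤_) (sym (at-least-∷ N i p L z))
    (ℕₚ.≤-trans (ℕₚ.*-mono-≤ (ℕₚ.≤-reflexive (sym (ind-true (minus? p z) m))) h) (ℕₚ.m≤n+m _ _))

  extend-plus : ∀ i p L → Plus p N z → 1 ≤ at-least N (pred i) L z → 1 ≤ at-least N i (p ∷ L) z
  extend-plus i p L g h = subst (1 ≤_) (sym (at-least-∷ N i p L z))
    (ℕₚ.≤-trans (ℕₚ.*-mono-≤ (ℕₚ.≤-reflexive (sym (ind-true (plus? p N z) g))) h) (ℕₚ.m≤m+n _ _))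

  at-least-0 : ∀ {L} → Signed L → 1 ≤ at-least N 0 L z
  at-least-0 []            = ℕₚ.≤-refl
  at-least-0 {p ∷ L} (inj₁ m ∷ ss) = extend-minus 0 p L m (at-least-0 ss)
  at-least-0 {p ∷ L} (inj₂ g ∷ ss) = extend-plus 0 p L g (at-least-0 ss)

  at-least-1 : ∀ {L} → Signed L → AllMinus L ⊎ 1 ≤ at-least N 1 L z
  at-least-1 []            = inj₁ []
  at-least-1 {p ∷ L} (inj₂ g ∷ ss) = inj₂ (extend-plus 1 p L g (at-least-0 ss))
  at-least-1 {p ∷ L} (inj₁ m ∷ ss) = [ (λ ms → inj₁ (m ∷ ms)) , inj₂ ∘ extend-minus 1 p L m ]′ (at-least-1 ss)

  -- The middle alternative is the case of exactly one plus prime. The symbol of Δ is then opposite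
  -- to `sgn L`, which for an odd number of primes contradicts its value -1.
  at-least-2 : ∀ {L} → Signed L → AllMinus L ⊎ (Χ L (Δ z) ≡ -[1+ 0 ] ℤ.* sgn L) ⊎ 1 ≤ at-least N 2 L z
  at-least-2 [] = inj₁ []
  at-least-2 {p ∷ L} (inj₁ m ∷ ss) = [ (λ ms → inj₁ (m ∷ ms))
    , [ (λ e → inj₂ (inj₁ (cong₂ ℤ._*_ m e))) , inj₂ ∘ inj₂ ∘ extend-minus 2 p L m ]′ ]′ (at-least-2 ss)
  at-least-2 {p ∷ L} (inj₂ g ∷ ss) = [ (λ ms → inj₂ (inj₁ (trans (cong₂ ℤ._*_ (proj₁ g) (Χ-all-minus ms)) (lemma (sgn L)))))
    , inj₂ ∘ inj₂ ∘ extend-plus 2 p L g ]′ (at-least-1 ss)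
    where
    lemma : ∀ s → + 1 ℤ.* s ≡ -[1+ 0 ] ℤ.* (-[1+ 0 ] ℤ.* s)
    lemma = solve-∀

argmin : ∀ (f : ℕ → ℕ) x L → ∃ λ q → q ∈ x ∷ L × All (λ p → f q ≤ f p) (x ∷ L)
argmin f x []      = x , here refl , ℕₚ.≤-refl ∷ []
argmin f x (y ∷ L) with argmin f y L
... | q , q∈ , q≤ with f x ≤? f q
...   | yes fx≤fq = x , here refl , ℕₚ.≤-refl ∷ All.map (ℕₚ.≤-trans fx≤fq) q≤
...   | no  fx≰fq = q , there q∈ , ℕₚ.<⇒≤ (ℕₚ.≰⇒> fx≰fq) ∷ q≤

product-bound : ∀ x y (f : ℕ → ℕ) {L} → All (λ p → x * f p ≤ y * (p * p)) L →
  x ^ length L * product (map f L) ≤ y ^ length L * (product L * product L)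
product-bound x y f []           = ℕₚ.≤-refl
product-bound x y f {p ∷ L} (h ∷ hs) = begin
  x * X * (f p * F)              ≡⟨ lemma₁ x X (f p) F ⟩
  x * f p * (X * F)              ≤⟨ ℕₚ.*-mono-≤ h (product-bound x y f hs) ⟩
  y * (p * p) * (Y * (P * P))    ≡⟨ lemma₂ y p Y P ⟩
  y * Y * (p * P * (p * P))      ∎
  where
  open ℕₚ.≤-Reasoning
  X = x ^ length L
  Y = y ^ length L
  F = product (map f L)
  P = product L
  lemma₁ : ∀ x X f F → x * X * (f * F) ≡ x * f * (X * F)
  lemma₁ = ℕ-Solver.solve-∀
  lemma₂ : ∀ y p Y P → y * (p * p) * (Y * (P * P)) ≡ y * Y * (p * P * (p * P))
  lemma₂ = ℕ-Solver.solve-∀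

∑-upTo-suc : ∀ n f → ∑ (upTo (suc n)) f ≡ ∑ (upTo n) f + f n
∑-upTo-suc n f = trans (cong (λ l → ∑ l f) (sym (Listₚ.upTo-∷ʳ n)))
  (trans (∑-++ (upTo n) (n ∷ []) f) (cong (λ k → ∑ (upTo n) f + k) (ℕₚ.+-identityʳ (f n))))

-- With t = m - 3 this compares the sum over j ≤ m - 2 with its value at m = 3, where equality
-- holds.
geometric : ∀ Q → 2 ≤ Q → ∀ t → Q * (1 + ∑ (upTo (2 + t)) (Q ^_)) ≤ Q ^ (1 + t) * (Q + 2)
geometric Q 2≤Q zero = ℕₚ.≤-reflexive (lemma Q)
  where
  lemma : ∀ Q → Q * (1 + (1 + (Q * 1 + 0))) ≡ Q * 1 * (Q + 2)
  lemma = ℕ-Solver.solve-∀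
geometric Q 2≤Q (suc t) = begin
  Q * (1 + ∑ (upTo (3 + t)) (Q ^_))               ≡⟨ cong (λ k → Q * (1 + k)) (∑-upTo-suc (2 + t) (Q ^_)) ⟩
  Q * (1 + (∑ (upTo (2 + t)) (Q ^_) + Q ^ (2 + t))) ≡⟨ lemma₁ Q (∑ (upTo (2 + t)) (Q ^_)) (Q ^ (2 + t)) ⟩
  Q * (1 + ∑ (upTo (2 + t)) (Q ^_)) + Q * Q ^ (2 + t) ≤⟨ ℕₚ.+-monoˡ-≤ _ (geometric Q 2≤Q t) ⟩
  Q ^ (1 + t) * (Q + 2) + Q * Q ^ (2 + t)          ≤⟨ ℕₚ.+-monoˡ-≤ _ (ℕₚ.*-monoʳ-≤ (Q ^ (1 + t)) (ℕₚ.+-monoʳ-≤ Q 2≤Q)) ⟩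
  Q ^ (1 + t) * (Q + Q) + Q * Q ^ (2 + t)          ≡⟨ lemma₂ Q (Q ^ (1 + t)) ⟩
  Q ^ (2 + t) * (Q + 2)                            ∎
  where
  open ℕₚ.≤-Reasoning
  lemma₁ : ∀ Q s x → Q * (1 + (s + x)) ≡ Q * (1 + s) + Q * x
  lemma₁ = ℕ-Solver.solve-∀
  lemma₂ : ∀ Q x → x * (Q + Q) + Q * (Q * x) ≡ Q * x * (Q + 2)
  lemma₂ = ℕ-Solver.solve-∀

^-exchange : ∀ x a k → (x ^ a) ^ k ≡ (x ^ k) ^ a
^-exchange x a k = trans (ℕₚ.^-*-assoc x a k) (trans (cong (x ^_) (ℕₚ.*-comm a k)) (sym (ℕₚ.^-*-assoc x k a)))

-- Counting the passing pairs of a squarefree modulus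

module SquarefreeModulus (n : ℕ) (1<n : 1 < n) (L : List ℕ) (L≡ : L ≡ factors n n) (n-odd : Odd n)
  (L! : Unique L) (β : ℕ) (1≤β : 1 ≤ β) (β≤L : All (β ≤_) L) where
  open Modulus n 1<n L L≡
  open Unpack n 1<n L L≡
  open Signs n

  pairs : List (ℕ × ℕ)
  pairs = residuePairs n

  pass? : ∀ z → Dec (T (passesQFT β n (proj₁ z) (proj₂ z)))
  pass? z = T? _

  passCount≡∑ : passCount β n ≡ ∑ pairs (ind ∘ pass?)
  passCount≡∑ = length-filter-∑ pass? pairs

  odds : All Odd L
  odds = All.tabulate (prime∣odd⇒Odd n-odd ∘ ∈⇒∣n)

  transport : ∀ (W : ℕ × ℕ → ℕ) → ∑ (residuePairs (product L)) W ≡ ∑ pairs W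
  transport W = cong (λ m → ∑ (residuePairs m) W) product≡n

  signed : ∀ {z} → Passes n β L z → Signed z L
  signed {z} P = All.tabulate sign
    where
    open Passes P
    sign : ∀ {p} → p ∈ L → Minus p z ⊎ Plus p n z
    sign {p} p∈ = [ (λ e → contradiction e (Χ≢0⇒χ≢0 (Δ z) p∈ (λ e → case trans (sym (proj₁ params)) e of λ ())))
                  , [ (λ e → inj₂ (e , Χ≢0⇒≉0 primes (ν z) p∈ (λ e → case trans (sym (proj₂ params)) e of λ ())
                                     , weaken-power (+ proj₁ z) (+ proj₂ z) (suc n) (∈⇒∣n p∈) step4))
                    , inj₁ ]′ ]′ (χ-0±1 (All.lookup primes p∈) (Δ z))

  E-bound : ∀ i → β ^ i * ∑ pairs (at-least n i L) ≤ n * n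
  E-bound i = subst₂ (λ s m → β ^ i * s ≤ m * m) (transport (at-least n i L)) product≡n
    (at-least-bound β 1≤β n i primes L! odds β≤L)

  even-bound : sgn L ≡ + 1 → β * passCount β n ≤ n * n
  even-bound sgn≡1 = begin
    β * passCount β n                 ≡⟨ cong (β *_) passCount≡∑ ⟩
    β * ∑ pairs (ind ∘ pass?)         ≤⟨ ℕₚ.*-monoʳ-≤ β (∑-mono pairs (λ {z} _ → ind-bound (pass? z) (one-plus z))) ⟩
    β * ∑ pairs (at-least n 1 L)      ≡⟨ cong (_* ∑ pairs (at-least n 1 L)) (ℕₚ.*-identityʳ β) ⟨
    β ^ 1 * ∑ pairs (at-least n 1 L)  ≤⟨ E-bound 1 ⟩
    n * n                             ∎
    where
    open ℕₚ.≤-Reasoning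
    one-plus : ∀ z → T (passesQFT β n (proj₁ z) (proj₂ z)) → 1 ≤ at-least n 1 L z
    one-plus z t = let P = unpack z β t in
      [ (λ ms → case trans (sym (proj₁ (Passes.params P))) (trans (Χ-all-minus z ms) sgn≡1) of λ ()) , id ]′
      (at-least-1 z (signed {z} P))

  -- `A` is any majorant of the passing pairs for which all primes are minus: the Frobenius weight
  -- for three primes, the exponent weight for five or more.
  odd-bound : sgn L ≡ -[1+ 0 ] → (A : ℕ × ℕ → ℕ) → (∀ z → Passes n β L z → AllMinus z L → 1 ≤ A z) →
    passCount β n ≤ ∑ pairs A + ∑ pairs (at-least n 2 L)
  odd-bound sgn≡-1 A all-minus = begin
    passCount β n                          ≡⟨ passCount≡∑ ⟩
    ∑ pairs (ind ∘ pass?)                  ≤⟨ ∑-mono pairs (λ {z} _ → ind-bound (pass? z) (split z)) ⟩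
    ∑ pairs (λ z → A z + at-least n 2 L z) ≡⟨ ∑-+ pairs A (at-least n 2 L) ⟩
    ∑ pairs A + ∑ pairs (at-least n 2 L)   ∎
    where
    open ℕₚ.≤-Reasoning
    split : ∀ z → T (passesQFT β n (proj₁ z) (proj₂ z)) → 1 ≤ A z + at-least n 2 L z
    split z t = let P = unpack z β t in
      [ (λ ms → ℕₚ.≤-trans (all-minus z P ms) (ℕₚ.m≤m+n (A z) _))
      , [ (λ e → case trans (sym (proj₁ (Passes.params P))) (trans e (cong (-[1+ 0 ] ℤ.*_) sgn≡-1)) of λ ())
        , (λ h → ℕₚ.≤-trans h (ℕₚ.m≤n+m _ (A z))) ]′ ]′ (at-least-2 z (signed {z} P))

  two-plus-bound : β * β * ∑ pairs (at-least n 2 L) ≤ n * n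
  two-plus-bound = subst (λ b → b * ∑ pairs (at-least n 2 L) ≤ n * n) (cong (β *_) (ℕₚ.*-identityʳ β)) (E-bound 2)

  frobenius-weight : Weight
  frobenius-weight p = ind ∘ frobenius? p n

  frobenius-∑ : ∑ pairs (product-weight frobenius-weight L) ≡ product (map (local-sum frobenius-weight) L)
  frobenius-∑ = trans (sym (transport _)) (∑-product-weight (λ pp → frobenius-periodic pp n) primes L!)

  frobenius-all-minus : ∀ z → Passes n β L z → AllMinus z L → 1 ≤ product-weight frobenius-weight L z
  frobenius-all-minus z P ms = product-weight-ind (λ p → frobenius? p n) {L} {z} (All.tabulate λ p∈ →
    All.lookup ms p∈ , weaken-power (+ proj₁ z) (+ proj₂ z) (suc n) (∈⇒∣n p∈) (Passes.step4 P))

  module Exponents where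

    s : ℕ
    s = proj₂ (split2 (n * n ∸ 1))

    s-odd : Odd s
    s-odd = split2-odd (ℕₚ.m<n⇒0<n∸m (ℕₚ.<-≤-trans 1<n (ℕₚ.m≤m*n n n)))

    one-weight : Weight
    one-weight p = ind ∘ power? p s (+ 1)

    negated-weight : ℕ → Weight
    negated-weight j p = ind ∘ power? p (2 ^ j * s) -[1+ 0 ]

    -- `m` is the valuation at one chosen prime. There `negated-exponent` forces j ≤ m - 2, hence
    -- the range `upTo (m ∸ 1)`.
    exponent-weight : ℕ → ℕ × ℕ → ℕ
    exponent-weight m z = product-weight one-weight L z + ∑ (upTo (m ∸ 1)) (λ j → product-weight (negated-weight j) L z)

    exponent-all-minus : ∀ q → q ∈ L → ∀ z → Passes n β L z → AllMinus z L → 1 ≤ exponent-weight (val q) z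
    exponent-all-minus q q∈ z P ms = [ one , negated ]′ (Passes.step5 P)
      where
      open Passes P using (step3; step4)
      open Quadratic n (+ proj₁ z) (+ proj₂ z)
      local : ∀ {p} k a → p ∈ L → gen ↑ k ≋ const a [ n ] → Power p k a z
      local k a p∈ e = All.lookup ms p∈ , weaken-power (+ proj₁ z) (+ proj₂ z) k (∈⇒∣n p∈) e
      one : gen ↑ s ≋ const (+ 1) [ n ] → 1 ≤ exponent-weight (val q) z
      one e = ℕₚ.≤-trans (product-weight-ind (λ p → power? p s (+ 1)) {L} {z} (All.tabulate λ p∈ → local s (+ 1) p∈ e)) (ℕₚ.m≤m+n _ _)
      n+1≡2m : suc n ≡ 2 * ((n + 1) div 2)
      n+1≡2m = trans (ℕₚ.+-comm 1 n) (sym (ℕ.m*[n/m]≡n (ℕ.divides (suc (proj₁ n-odd))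
        (trans (ℕₚ.+-comm n 1) (trans (cong suc (proj₂ n-odd)) (lemma (proj₁ n-odd)))))))
        where
        lemma : ∀ h → suc (suc (2 * h)) ≡ suc h * 2
        lemma = ℕ-Solver.solve-∀
      negated : (∃ λ j → gen ↑ (2 ^ j * s) ≋ const -[1+ 0 ] [ n ]) → 1 ≤ exponent-weight (val q) z
      negated (j , e) = ℕₚ.≤-trans (ℕₚ.≤-trans
          (product-weight-ind (λ p → power? p (2 ^ j * s) -[1+ 0 ]) {L} {z} (All.tabulate λ p∈ → local (2 ^ j * s) -[1+ 0 ] p∈ e))
          (∈⇒≤∑ (λ j → product-weight (negated-weight j) L z) (∈-upTo j<)))
        (ℕₚ.m≤n+m _ _)
        where
        q-odd = All.lookup odds q∈
        open MinusBounds q (All.lookup primes q∈) (proj₁ q-odd) (proj₂ q-odd) using (negated-exponent)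
        j+2≤ : 2 + j ≤ val q
        j+2≤ = negated-exponent s-odd j ((n + 1) div 2) z (local (2 ^ j * s) -[1+ 0 ] q∈ e)
          (weaken-power (+ proj₁ z) (+ proj₂ z) ((n + 1) div 2) (∈⇒∣n q∈) (proj₂ step3))
          (weaken-power (+ proj₁ z) (+ proj₂ z) (2 * ((n + 1) div 2)) (∈⇒∣n q∈)
            (subst (λ k → gen ↑ k ≋ const (ν z) [ n ]) n+1≡2m step4))
        j< : j < val q ∸ 1
        j< = ℕₚ.∸-monoˡ-≤ 1 j+2≤

    exponent-∑ : ∀ m → ∑ pairs (exponent-weight m) ≡
      product (map (local-sum one-weight) L) + ∑ (upTo (m ∸ 1)) (λ j → product (map (local-sum (negated-weight j)) L))
    exponent-∑ m = trans (∑-+ pairs _ _) (cong₂ _+_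
      (trans (sym (transport _)) (∑-product-weight (λ pp → power-periodic-ind pp s (+ 1)) primes L!))
      (trans (∑-swap pairs (upTo (m ∸ 1)) _) (∑-cong (upTo (m ∸ 1)) λ {j} _ →
        trans (sym (transport _)) (∑-product-weight (λ pp → power-periodic-ind pp (2 ^ j * s) -[1+ 0 ]) primes L!))))

    module _ {m p : ℕ} (p∈ : p ∈ L) (m≤ : m ≤ val p) where
      private
        pp = All.lookup primes p∈
        p-odd = All.lookup odds p∈
      open MinusBounds p pp (proj₁ p-odd) (proj₂ p-odd)
      open ℕₚ.≤-Reasoning

      2^m*odd-part≤p² : 2 ^ m * odd-part p ≤ p * p
      2^m*odd-part≤p² = begin
        2 ^ m * odd-part p      ≤⟨ ℕₚ.*-monoˡ-≤ (odd-part p) (ℕₚ.^-monoʳ-≤ 2 m≤) ⟩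
        2 ^ val p * odd-part p  ≡⟨ p²-1≡ ⟨
        p * p ∸ 1               ≤⟨ ℕₚ.m∸n≤m (p * p) 1 ⟩
        p * p                   ∎

      -- The share is at most 2^-(m+1): the odd part is at most p² / 2^m, and a further half is lost
      -- because conjugate roots share a pair.
      one-local : 2 ^ suc m * local-sum one-weight p ≤ 1 * (p * p)
      one-local = begin
        2 * 2 ^ m * f           ≡⟨ lemma (2 ^ m) f ⟩
        2 ^ m * (2 * f)         ≤⟨ ℕₚ.*-monoʳ-≤ (2 ^ m) (one-bound s-odd) ⟩
        2 ^ m * odd-part p      ≤⟨ 2^m*odd-part≤p² ⟩
        p * p                   ≡⟨ ℕₚ.*-identityˡ (p * p) ⟨
        1 * (p * p)             ∎
        where
        f = local-sum one-weight p
        lemma : ∀ x f → 2 * x * f ≡ x * (2 * f)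
        lemma = ℕ-Solver.solve-∀

      negated-local : ∀ j → 2 ^ suc m * local-sum (negated-weight j) p ≤ 2 ^ j * (p * p)
      negated-local j = begin
        2 * 2 ^ m * f                 ≡⟨ lemma (2 ^ m) f ⟩
        2 ^ m * (2 * f)               ≤⟨ ℕₚ.*-monoʳ-≤ (2 ^ m) (negated-bound s-odd j) ⟩
        2 ^ m * (2 ^ j * odd-part p)  ≡⟨ lemma′ (2 ^ m) (2 ^ j) (odd-part p) ⟩
        2 ^ j * (2 ^ m * odd-part p)  ≤⟨ ℕₚ.*-monoʳ-≤ (2 ^ j) 2^m*odd-part≤p² ⟩
        2 ^ j * (p * p)               ∎
        where
        f = local-sum (negated-weight j) p
        lemma : ∀ x f → 2 * x * f ≡ x * (2 * f)
        lemma = ℕ-Solver.solve-∀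
        lemma′ : ∀ x y f → x * (y * f) ≡ y * (x * f)
        lemma′ = ℕ-Solver.solve-∀

    -- With K = 2^k this is the estimate (1 + Σ_{j ≤ m-2} K^j) / K^(m+1) ≤ (K + 2) / K^4, attained at m = 3.
    exponent-bound : ∀ m → 3 ≤ m → All (λ p → m ≤ val p) L → 1 ≤ length L →
      let K = 2 ^ length L in K ^ 4 * ∑ pairs (exponent-weight m) ≤ (K + 2) * (n * n)
    exponent-bound m@(suc (suc (suc t))) (s≤s (s≤s (s≤s _))) m≤val 1≤k =
      -- The factor K^(1+t) raises K^4 to K · K^(m+1), to which `total` and then `geometric` apply.
      ℕₚ.*-cancelˡ-≤ (K ^ (1 + t)) {{ℕₚ.m^n≢0 K (1 + t) {{ℕₚ.m^n≢0 2 k}}}} (begin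
        K ^ (1 + t) * (K ^ 4 * S)                       ≡⟨ ℕₚ.*-assoc (K ^ (1 + t)) (K ^ 4) S ⟨
        K ^ (1 + t) * K ^ 4 * S                         ≡⟨ cong (_* S) (trans (sym (ℕₚ.^-distribˡ-+-* K (1 + t) 4)) (cong (K ^_) (ℕₚ.+-comm (1 + t) 4))) ⟩
        K * K ^ suc m * S                               ≡⟨ ℕₚ.*-assoc K (K ^ suc m) S ⟩
        K * (K ^ suc m * S)                             ≤⟨ ℕₚ.*-monoʳ-≤ K total ⟩
        K * ((1 + ∑ (upTo (2 + t)) (K ^_)) * (n * n))   ≡⟨ ℕₚ.*-assoc K (1 + ∑ (upTo (2 + t)) (K ^_)) (n * n) ⟨
        K * (1 + ∑ (upTo (2 + t)) (K ^_)) * (n * n)     ≤⟨ ℕₚ.*-monoˡ-≤ (n * n) (geometric K 2≤K t) ⟩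
        K ^ (1 + t) * (K + 2) * (n * n)                 ≡⟨ ℕₚ.*-assoc (K ^ (1 + t)) (K + 2) (n * n) ⟩
        K ^ (1 + t) * ((K + 2) * (n * n))               ∎)
      where
      open ℕₚ.≤-Reasoning
      k = length L
      K = 2 ^ k
      S = ∑ pairs (exponent-weight m)
      2≤K : 2 ≤ K
      2≤K = ℕₚ.^-monoʳ-≤ 2 1≤k
      prime-squares : ∀ {x y f} → All (λ p → x * f p ≤ y * (p * p)) L → x ^ k * product (map f L) ≤ y ^ k * (n * n)
      prime-squares {x} {y} {f} h = subst (λ N → x ^ k * product (map f L) ≤ y ^ k * (N * N)) product≡n (product-bound x y f h)
      one-total : K ^ suc m * product (map (local-sum one-weight) L) ≤ n * n
      one-total = subst₂ (λ a b → a * product (map (local-sum one-weight) L) ≤ b) (^-exchange 2 (suc m) k)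
        (trans (cong (_* (n * n)) (ℕₚ.^-zeroˡ k)) (ℕₚ.*-identityˡ (n * n)))
        (prime-squares {2 ^ suc m} {1} {local-sum one-weight} (All.tabulate λ p∈ → one-local p∈ (All.lookup m≤val p∈)))
      negated-total : ∀ j → K ^ suc m * product (map (local-sum (negated-weight j)) L) ≤ K ^ j * (n * n)
      negated-total j = subst₂ (λ a b → a * product (map (local-sum (negated-weight j)) L) ≤ b * (n * n))
        (^-exchange 2 (suc m) k) (^-exchange 2 j k)
        (prime-squares {2 ^ suc m} {2 ^ j} {local-sum (negated-weight j)} (All.tabulate λ p∈ → negated-local p∈ (All.lookup m≤val p∈) j))
      total : K ^ suc m * S ≤ (1 + ∑ (upTo (2 + t)) (K ^_)) * (n * n)
      total = begin
        K ^ suc m * S                                         ≡⟨ cong (λ k → K ^ suc m * k) (exponent-∑ m) ⟩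
        K ^ suc m * (o + ∑ (upTo (2 + t)) g)                  ≡⟨ ℕₚ.*-distribˡ-+ (K ^ suc m) o _ ⟩
        K ^ suc m * o + K ^ suc m * ∑ (upTo (2 + t)) g        ≡⟨ cong (λ k → K ^ suc m * o + k) (∑-*ˡ (upTo (2 + t)) (K ^ suc m) g) ⟨
        K ^ suc m * o + ∑ (upTo (2 + t)) (λ j → K ^ suc m * g j) ≤⟨ ℕₚ.+-mono-≤ one-total (∑-mono (upTo (2 + t)) (λ {j} _ → negated-total j)) ⟩
        n * n + ∑ (upTo (2 + t)) (λ j → K ^ j * (n * n))      ≡⟨ cong₂ _+_ (sym (ℕₚ.*-identityˡ (n * n))) (∑-*ʳ (upTo (2 + t)) (n * n) (K ^_)) ⟩
        1 * (n * n) + ∑ (upTo (2 + t)) (K ^_) * (n * n)       ≡⟨ ℕₚ.*-distribʳ-+ (n * n) 1 (∑ (upTo (2 + t)) (K ^_)) ⟨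
        (1 + ∑ (upTo (2 + t)) (K ^_)) * (n * n)               ∎
        where
        o = product (map (local-sum one-weight) L)
        g : ℕ → ℕ
        g j = product (map (local-sum (negated-weight j)) L)

-- The final estimates

-- The shares r / w of A and 1 / β² of E must add up to at most 1 / κ. The fraction t / w is set
-- aside from 1 - κ r / w in order to cover κ / β².
combine : ∀ {w t r κ β² A E N pass} → 1 ≤ w → w * A ≤ r * N → β² * E ≤ N → pass ≤ A + E →
          κ * r + t ≤ w → w * κ ≤ t * β² → κ * pass ≤ N
combine {w} {t} {r} {κ} {β²} {A} {E} {N} {pass} 1≤w hA hE hp h₁ h₂ = ℕₚ.*-cancelˡ-≤ w {{>-nonZero 1≤w}} (begin
  w * (κ * pass)                 ≤⟨ ℕₚ.*-monoʳ-≤ w (ℕₚ.*-monoʳ-≤ κ hp) ⟩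
  w * (κ * (A + E))              ≡⟨ lemma₁ w κ A E ⟩
  κ * (w * A) + w * κ * E        ≤⟨ ℕₚ.+-mono-≤ (ℕₚ.*-monoʳ-≤ κ hA) (ℕₚ.*-monoˡ-≤ E h₂) ⟩
  κ * (r * N) + t * β² * E       ≡⟨ cong (λ x → κ * (r * N) + x) (ℕₚ.*-assoc t β² E) ⟩
  κ * (r * N) + t * (β² * E)     ≤⟨ ℕₚ.+-monoʳ-≤ (κ * (r * N)) (ℕₚ.*-monoʳ-≤ t hE) ⟩
  κ * (r * N) + t * N            ≡⟨ lemma₂ κ r t N ⟩
  (κ * r + t) * N                ≤⟨ ℕₚ.*-monoˡ-≤ N h₁ ⟩
  w * N                          ∎)
  where
  open ℕₚ.≤-Reasoning
  lemma₁ : ∀ w κ A E → w * (κ * (A + E)) ≡ κ * (w * A) + w * κ * E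
  lemma₁ = ℕ-Solver.solve-∀
  lemma₂ : ∀ κ r t N → κ * (r * N) + t * N ≡ (κ * r + t) * N
  lemma₂ = ℕ-Solver.solve-∀

-- (K + 2) / K^4 decreases in K, so a bound at K = a q implies the one at a. This reduces all k ≥ 5
-- to k = 5.
fourth-power-bound : ∀ a q S N → 1 ≤ q → (a * q) ^ 4 * S ≤ (a * q + 2) * N → a ^ 4 * S ≤ (a + 2) * N
fourth-power-bound a q S N 1≤q h = begin
  a ^ 4 * S                 ≤⟨ ℕₚ.*-monoʳ-≤ (a ^ 4) (ℕₚ.m≤n*m S (q * q * q) {{>-nonZero 1≤q³}}) ⟩
  a ^ 4 * (q * q * q * S)   ≤⟨ ℕₚ.*-cancelˡ-≤ q {{>-nonZero 1≤q}} cancelled ⟩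
  (a + 2) * N               ∎
  where
  open ℕₚ.≤-Reasoning
  1≤q³ : 1 ≤ q * q * q
  1≤q³ = ℕₚ.*-mono-≤ (ℕₚ.*-mono-≤ 1≤q 1≤q) 1≤q
  cancelled : q * (a ^ 4 * (q * q * q * S)) ≤ q * ((a + 2) * N)
  cancelled = begin
    q * (a ^ 4 * (q * q * q * S))  ≡⟨ lemma₁ a q S ⟩
    (a * q) ^ 4 * S                ≤⟨ h ⟩
    (a * q + 2) * N                ≤⟨ ℕₚ.*-monoˡ-≤ N (ℕₚ.+-monoʳ-≤ (a * q) (ℕₚ.*-monoʳ-≤ 2 1≤q)) ⟩
    (a * q + 2 * q) * N            ≡⟨ lemma₂ a q N ⟩
    q * ((a + 2) * N)              ∎
    where
    lemma₁ : ∀ a q S → q * (a * (a * (a * (a * 1))) * (q * q * q * S)) ≡ a * q * (a * q * (a * q * (a * q * 1))) * S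
    lemma₁ = ℕ-Solver.solve-∀
    lemma₂ : ∀ a q N → (a * q + 2 * q) * N ≡ q * ((a + 2) * N)
    lemma₂ = ℕ-Solver.solve-∀

-- Writing x and y for the two successors, (x y - 1)² - (x² - 1)(y² - 1) = (x - y)².
square-product-< : ∀ a b → a ≢ b → (suc a * suc a ∸ 1) * (suc b * suc b ∸ 1) < (suc a * suc b ∸ 1) * (suc a * suc b ∸ 1)
square-product-< a b a≢b = [ (λ a≤b → ordered a b (ℕₚ.≤∧≢⇒< a≤b a≢b))
  , (λ b≤a → subst₂ (λ x y → x < y * y) (ℕₚ.*-comm (suc b * suc b ∸ 1) (suc a * suc a ∸ 1))
      (cong (_∸ 1) (ℕₚ.*-comm (suc b) (suc a))) (ordered b a (ℕₚ.≤∧≢⇒< b≤a (a≢b ∘ sym)))) ]′ (ℕₚ.≤-total a b)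
  where
  identity : ∀ a d → let b = suc (a + d) in
    (b + a * suc b) * (b + a * suc b) ≡ suc ((a + a * suc a) * (b + b * suc b) + (d + d * suc d))
  identity = ℕ-Solver.solve-∀
  ordered : ∀ a b → a < b → (suc a * suc a ∸ 1) * (suc b * suc b ∸ 1) < (suc a * suc b ∸ 1) * (suc a * suc b ∸ 1)
  ordered a b a<b with ℕₚ.m≤n⇒∃[o]m+o≡n a<b
  ... | d , refl = ℕₚ.≤-trans (s≤s (ℕₚ.m≤m+n _ (d + d * suc d))) (ℕₚ.≤-reflexive (sym (identity a d)))

<-of-squares : ∀ {x y} → x * x < y * y → x < y
<-of-squares {x} {y} h = ℕₚ.≰⇒> (λ y≤x → ℕₚ.<⇒≱ h (ℕₚ.*-mono-≤ y≤x y≤x))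

divisor-of-both-≤ : ∀ {g x y} → g ∣ x → g ∣ y → x < y → g + x ≤ y
divisor-of-both-≤ {g} {x} {y} g∣x g∣y x<y = begin
  g + x       ≤⟨ ℕₚ.+-monoˡ-≤ x (ℕ.∣⇒≤ {{>-nonZero (ℕₚ.m<n⇒0<n∸m x<y)}} (ℕ.∣m+n∣m⇒∣n (subst (g ∣_) (sym (ℕₚ.m+[n∸m]≡n (ℕₚ.<⇒≤ x<y))) g∣y) g∣x)) ⟩
  y ∸ x + x   ≡⟨ ℕₚ.m∸n+n≡m (ℕₚ.<⇒≤ x<y) ⟩
  y           ∎
  where open ℕₚ.≤-Reasoning

-- Each gᵢ divides both pᵢ² - 1 and pⱼpₖ - 1, so g₁g₂g₃ divides both products of three such factors;
-- by (pq - 1)² > (p² - 1)(q² - 1) these differ, and their difference is small.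
three-gcds : ∀ p q r .{{_ : NonZero p}} .{{_ : NonZero q}} .{{_ : NonZero r}} → p ≢ q → p ≢ r → q ≢ r →
  ∀ {g₁ g₂ g₃} → g₁ ∣ p * p ∸ 1 → g₁ ∣ q * r ∸ 1 → g₂ ∣ q * q ∸ 1 → g₂ ∣ p * r ∸ 1 → g₃ ∣ r * r ∸ 1 → g₃ ∣ p * q ∸ 1 →
  g₁ * g₂ * g₃ ≤ p * p * (q * q) + q * q * (r * r) + p * p * (r * r)
three-gcds (suc a) (suc b) (suc c) p≢q p≢r q≢r {g₁} {g₂} {g₃} d₁ e₁ d₂ e₂ d₃ e₃ =
  ℕₚ.+-cancelʳ-≤ X _ _ (begin
    g₁ * g₂ * g₃ + X         ≤⟨ divisor-of-both-≤ (ℕ.*-pres-∣ (ℕ.*-pres-∣ d₁ d₂) d₃) (ℕ.*-pres-∣ (ℕ.*-pres-∣ e₁ e₂) e₃) (<-of-squares X²<Y²) ⟩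
    Y                        ≤⟨ ℕₚ.*-mono-≤ (ℕₚ.*-mono-≤ (ℕₚ.m∸n≤m (q * r) 1) (ℕₚ.m∸n≤m (p * r) 1)) (ℕₚ.m∸n≤m (p * q) 1) ⟩
    -- Expanding X = (p² - 1)(q² - 1)(r² - 1) shows that (p q r)² + (p² + q² + r² - 1) equals the
    -- right-hand side, and u + v + w + 2 is p² + q² + r² - 1.
    q * r * (p * r) * (p * q) ≤⟨ ℕₚ.≤-trans (ℕₚ.m≤m+n _ (u + v + w + 2)) (ℕₚ.≤-reflexive (lemma₁ a b c)) ⟩
    p * p * (q * q) + q * q * (r * r) + p * p * (r * r) + X ∎)
  where
  open ℕₚ.≤-Reasoning
  p = suc a
  q = suc b
  r = suc c
  u = p * p ∸ 1
  v = q * q ∸ 1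
  w = r * r ∸ 1
  X = u * v * w
  Y = (q * r ∸ 1) * (p * r ∸ 1) * (p * q ∸ 1)
  X²<Y² : X * X < Y * Y
  X²<Y² = subst₂ _<_ (lemma₂ u v w) (lemma₃ (q * r ∸ 1) (p * r ∸ 1) (p * q ∸ 1))
    (ℕₚ.*-mono-< (ℕₚ.*-mono-< (square-product-< b c (q≢r ∘ cong suc)) (square-product-< a c (p≢r ∘ cong suc)))
                 (square-product-< a b (p≢q ∘ cong suc)))
    where
    lemma₂ : ∀ u v w → v * w * (u * w) * (u * v) ≡ u * v * w * (u * v * w)
    lemma₂ = ℕ-Solver.solve-∀
    lemma₃ : ∀ x y z → x * x * (y * y) * (z * z) ≡ x * y * z * (x * y * z)
    lemma₃ = ℕ-Solver.solve-∀
  lemma₁ : ∀ a b c → let p = suc a; q = suc b; r = suc c; u = a + a * suc a; v = b + b * suc b; w = c + c * suc c in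
    q * r * (p * r) * (p * q) + (u + v + w + 2) ≡ p * p * (q * q) + q * q * (r * r) + p * p * (r * r) + u * v * w
  lemma₁ = ℕ-Solver.solve-∀

squarefree⇒Unique : ∀ L → (∀ {p} → p ∈ L → ¬ p * p ∣ product L) → Unique L
squarefree⇒Unique []      h = []
squarefree⇒Unique (p ∷ L) h =
  All.tabulate (λ { q∈ refl → h (here refl) (ℕ.*-monoʳ-∣ p (ListActionₚ.∈⇒∣product q∈)) })
  ∷ squarefree⇒Unique L (λ q∈ q²∣ → h (there q∈) (ℕ.∣-trans q²∣ (ℕ.n∣m*n p)))

-- Stands for c = 7710 and β = 50000, kept as variables so that the argument carries only the
-- inequalities it uses: `c<β` for square factors, `κ≤β` for an even number of primes, `three-small`
-- for three primes, and the last two for five or more.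
module Main (c β : ℕ) (c<β : c < β) (κ≤β : 4 * c ≤ β) (three-small : 4 * c * 3 + 8 * (4 * c) ≤ 8 * (β * β))
  (five-small : 4 * c * 34 + 16 ≤ 32 ^ 4) (five-large : 32 ^ 4 * (4 * c) ≤ 16 * (β * β)) where

  private
    -- The factor 4 is the one in `n²+n≤4M`.
    κ = 4 * c

  1≤β : 1 ≤ β
  1≤β = ℕₚ.≤-trans (s≤s z≤n) c<β

  conclude : ∀ n → 0 < n → κ * passCount β n ≤ n * n → n * n + n ≤ 4 * M n → c * passCount β n < M n
  conclude n 0<n h₁ h₂ = ℕₚ.*-cancelˡ-< 4 _ _ (begin-strict
    4 * (c * passCount β n)   ≡⟨ ℕₚ.*-assoc 4 c (passCount β n) ⟨
    κ * passCount β n         ≤⟨ h₁ ⟩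
    n * n                     <⟨ ℕₚ.m<m+n (n * n) 0<n ⟩
    n * n + n                 ≤⟨ h₂ ⟩
    4 * M n                   ∎)
    where open ℕₚ.≤-Reasoning

  module _ (n : ℕ) (comp : Composite n) (1<n : 1 < n) (n-odd : Odd n) where

    not-prime : ∀ {p} → Prime p → p ≢ n
    not-prime pp refl = ℕ.prime⇒¬composite pp comp

    module _ (L : List ℕ) (L≡ : L ≡ factors n n) (L! : Unique L) (β≤L : All (β ≤_) L) where
      open Modulus n 1<n L L≡
      open SquarefreeModulus n 1<n L L≡ n-odd L! β 1≤β β≤L

      even-case : sgn L ≡ + 1 → κ * passCount β n ≤ n * n
      even-case sgn≡1 = ℕₚ.≤-trans (ℕₚ.*-monoˡ-≤ (passCount β n) κ≤β) (even-bound sgn≡1)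

      frobenius-local : ∀ {p m} → p ∈ L → n ≡ p * m → 1 ≤ m → 2 * local-sum frobenius-weight p ≤ gcd (p * p ∸ 1) (m ∸ 1)
      frobenius-local {p} {suc k} p∈ refl (s≤s _) = MinusBounds.frobenius-bound p (All.lookup primes p∈) (proj₁ o) (proj₂ o) k
        where o = All.lookup odds p∈

      five-case : sgn L ≡ -[1+ 0 ] → 5 ≤ length L → κ * passCount β n ≤ n * n
      -- 34 / 32^4 is the share (K + 2) / K^4 at K = 2^5. For c = 7710 the number 16 is exactly 32^4
      -- - 4c · 34, all that remains for the pairs with two plus primes.
      five-case sgn≡-1 5≤k = combine {32 ^ 4} {16} {34} {κ} {β * β} (s≤s z≤n)
        (fourth-power-bound 32 (2 ^ (length L ∸ 5)) S (n * n) (ℕₚ.m^n>0 2 (length L ∸ 5))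
          (subst (λ K → K ^ 4 * S ≤ (K + 2) * (n * n)) 2^k≡ (exponent-bound m 3≤m m≤val (ℕₚ.≤-trans (s≤s z≤n) 5≤k))))
        two-plus-bound (odd-bound sgn≡-1 (exponent-weight m) (exponent-all-minus q q∈)) five-small five-large
        where
        open Exponents
        -- A prime q of least valuation lets m = val q serve twice: through q as a limit for j, and
        -- as a lower bound for the valuations at all primes.
        minimal : ∀ L′ → 5 ≤ length L′ → ∃ λ q → q ∈ L′ × All (λ p → val q ≤ val p) L′
        minimal (x ∷ L′) _ = argmin val x L′
        q = proj₁ (minimal L 5≤k)
        q∈ = proj₁ (proj₂ (minimal L 5≤k))
        m = val q
        m≤val = proj₂ (proj₂ (minimal L 5≤k))
        S = ∑ pairs (exponent-weight m)
        3≤m : 3 ≤ m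
        3≤m = MinusBounds.3≤val q (All.lookup primes q∈) (proj₁ (All.lookup odds q∈)) (proj₂ (All.lookup odds q∈))
        2^k≡ : 2 ^ length L ≡ 32 * 2 ^ (length L ∸ 5)
        2^k≡ = trans (cong (2 ^_) (sym (ℕₚ.m+[n∸m]≡n 5≤k))) (ℕₚ.^-distribˡ-+-* 2 5 (length L ∸ 5))

    three-case : ∀ p q r (L≡ : p ∷ q ∷ r ∷ [] ≡ factors n n) → Unique (p ∷ q ∷ r ∷ []) → All (β ≤_) (p ∷ q ∷ r ∷ []) →
      κ * passCount β n ≤ n * n
    three-case p q r L≡ L!@((p≢q ∷ p≢r ∷ []) ∷ (q≢r ∷ []) ∷ _) β≤L@(β≤p ∷ β≤q ∷ β≤r ∷ []) =
      -- The 8 collects the factor 2 in front of each of the three local counts. The 3 counts the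
      -- summands of `three-gcds`, each at most n² / β² after omitting one prime. The choice t = 8 κ
      -- turns the last condition into an equality.
      combine {8 * (β * β)} {8 * κ} {3} {κ} {β * β} (ℕₚ.*-mono-≤ {1} {8} (s≤s z≤n) (ℕₚ.*-mono-≤ 1≤β 1≤β))
        A-bound two-plus-bound (odd-bound refl (product-weight frobenius-weight L) frobenius-all-minus)
        three-small (ℕₚ.≤-reflexive (rearrange (β * β) κ))
      where
      L = p ∷ q ∷ r ∷ []
      open Modulus n 1<n L L≡
      open SquarefreeModulus n 1<n L L≡ n-odd L! β 1≤β β≤L
      open ℕₚ.≤-Reasoning
      rearrange : ∀ x k → 8 * x * k ≡ 8 * k * x
      rearrange = ℕ-Solver.solve-∀
      instance
        _ = ℕ.prime⇒nonZero (All.lookup primes (here refl))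
        q≢0 = ℕ.prime⇒nonZero (All.lookup primes (there (here refl)))
        r≢0 = ℕ.prime⇒nonZero (All.lookup primes (there (there (here refl))))
      n≡ : n ≡ p * (q * r)
      n≡ = trans (sym product≡n) (cong (λ x → p * (q * x)) (ℕₚ.*-identityʳ r))
      1≤* : ∀ x y .{{_ : NonZero x}} .{{_ : NonZero y}} → 1 ≤ x * y
      1≤* x y = ℕₚ.*-mono-≤ (>-nonZero⁻¹ x) (>-nonZero⁻¹ y)
      a₁ = local-sum frobenius-weight p
      a₂ = local-sum frobenius-weight q
      a₃ = local-sum frobenius-weight r
      local : ∀ {p m} → p ∈ L → n ≡ p * m → 1 ≤ m → 2 * local-sum frobenius-weight p ≤ gcd (p * p ∸ 1) (m ∸ 1)
      local = frobenius-local L L≡ L! β≤L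
      b₁ = local {p} {q * r} (here refl) n≡ (1≤* q r)
      b₂ = local {q} {p * r} (there (here refl)) (trans n≡ (lemma p q r)) (1≤* p r)
        where
        lemma : ∀ p q r → p * (q * r) ≡ q * (p * r)
        lemma = ℕ-Solver.solve-∀
      b₃ = local {r} {p * q} (there (there (here refl))) (trans n≡ (lemma p q r)) (1≤* p q)
        where
        lemma : ∀ p q r → p * (q * r) ≡ r * (p * q)
        lemma = ℕ-Solver.solve-∀
      G₁ = gcd (p * p ∸ 1) (q * r ∸ 1)
      G₂ = gcd (q * q ∸ 1) (p * r ∸ 1)
      G₃ = gcd (r * r ∸ 1) (p * q ∸ 1)
      G-bound : G₁ * G₂ * G₃ ≤ p * p * (q * q) + q * q * (r * r) + p * p * (r * r)
      G-bound = three-gcds p q r p≢q p≢r q≢r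
        (GCD.gcd[m,n]∣m (p * p ∸ 1) (q * r ∸ 1)) (GCD.gcd[m,n]∣n (p * p ∸ 1) (q * r ∸ 1))
        (GCD.gcd[m,n]∣m (q * q ∸ 1) (p * r ∸ 1)) (GCD.gcd[m,n]∣n (q * q ∸ 1) (p * r ∸ 1))
        (GCD.gcd[m,n]∣m (r * r ∸ 1) (p * q ∸ 1)) (GCD.gcd[m,n]∣n (r * r ∸ 1) (p * q ∸ 1))
      A-bound : 8 * (β * β) * ∑ pairs (product-weight frobenius-weight L) ≤ 3 * (n * n)
      A-bound = begin
        8 * (β * β) * ∑ pairs (product-weight frobenius-weight L) ≡⟨ cong (λ x → 8 * (β * β) * x) frobenius-∑ ⟩
        8 * (β * β) * (a₁ * (a₂ * (a₃ * 1)))    ≡⟨ lemma₁ (β * β) a₁ a₂ a₃ ⟩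
        β * β * (2 * a₁ * (2 * a₂) * (2 * a₃))  ≤⟨ ℕₚ.*-monoʳ-≤ (β * β) (ℕₚ.≤-trans (ℕₚ.*-mono-≤ (ℕₚ.*-mono-≤ b₁ b₂) b₃) G-bound) ⟩
        β * β * (p * p * (q * q) + q * q * (r * r) + p * p * (r * r)) ≡⟨ lemma₂ (β * β) (p * p) (q * q) (r * r) ⟩
        β * β * (p * p * (q * q)) + β * β * (q * q * (r * r)) + β * β * (p * p * (r * r))
          ≤⟨ ℕₚ.+-mono-≤ (ℕₚ.+-mono-≤ (ℕₚ.*-monoˡ-≤ (p * p * (q * q)) (ℕₚ.*-mono-≤ β≤r β≤r)) (ℕₚ.*-monoˡ-≤ (q * q * (r * r)) (ℕₚ.*-mono-≤ β≤p β≤p)))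
                         (ℕₚ.*-monoˡ-≤ (p * p * (r * r)) (ℕₚ.*-mono-≤ β≤q β≤q)) ⟩
        r * r * (p * p * (q * q)) + p * p * (q * q * (r * r)) + q * q * (p * p * (r * r)) ≡⟨ lemma₃ p q r ⟩
        3 * (p * (q * r) * (p * (q * r)))       ≡⟨ cong (λ x → 3 * (x * x)) n≡ ⟨
        3 * (n * n)                             ∎
        where
        lemma₁ : ∀ x a b c → 8 * x * (a * (b * (c * 1))) ≡ x * (2 * a * (2 * b) * (2 * c))
        lemma₁ = ℕ-Solver.solve-∀
        lemma₂ : ∀ x p q r → x * (p * q + q * r + p * r) ≡ x * (p * q) + x * (q * r) + x * (p * r)
        lemma₂ = ℕ-Solver.solve-∀
        lemma₃ : ∀ p q r → r * r * (p * p * (q * q)) + p * p * (q * q * (r * r)) + q * q * (p * p * (r * r)) ≡ 3 * (p * (q * r) * (p * (q * r)))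
        lemma₃ = ℕ-Solver.solve-∀

    squarefree-case : ∀ L → (L≡ : L ≡ factors n n) → Unique L → All (β ≤_) L → c * passCount β n < M n
    squarefree-case [] L≡ L! β≤L = contradiction (Modulus.product≡n n 1<n [] L≡) (ℕₚ.<⇒≢ 1<n)
    squarefree-case (p ∷ []) L≡ L! β≤L =
      contradiction (trans (sym (ℕₚ.*-identityʳ p)) (Modulus.product≡n n 1<n (p ∷ []) L≡)) (not-prime (All.head (Modulus.primes n 1<n (p ∷ []) L≡)))
    squarefree-case L@(p ∷ q ∷ L′) L≡ L! β≤L = conclude n (>-nonZero⁻¹ n) (bound L′ refl (sgn-±1 L))
      (OddModulus.n²+n≤4M n 1<n L L≡ n-odd refl (coprime-tail primes L!) (ℕₚ.≤∧≢⇒< (ℕ.∣⇒≤ (∈⇒∣n (here refl))) (not-prime (All.head primes))))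
      where
      open Modulus n 1<n L L≡
      bound : ∀ L″ → L″ ≡ L′ → (sgn L ≡ + 1) ⊎ (sgn L ≡ -[1+ 0 ]) → κ * passCount β n ≤ n * n
      bound _ _ (inj₁ sgn≡1) = even-case L L≡ L! β≤L sgn≡1
      bound [] refl (inj₂ ())
      bound (r ∷ []) refl (inj₂ _) = three-case p q r L≡ L! β≤L
      bound (_ ∷ _ ∷ []) refl (inj₂ ())
      bound (_ ∷ _ ∷ _ ∷ _) refl (inj₂ sgn≡-1) = five-case L L≡ L! β≤L sgn≡-1 (s≤s (s≤s (s≤s (s≤s (s≤s z≤n)))))

    square-factor-case : ∀ {p} → Prime p → p * p ∣ n → β < p → 1 ≤ passCount β n → c * passCount β n < M n
    square-factor-case {p} pp p²∣n β<p 1≤pass = begin-strict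
      -- Strictness comes from c < p and the existence of a passing pair.
      c * passCount β n                 <⟨ ℕₚ.*-monoˡ-< (passCount β n) {{>-nonZero 1≤pass}} (ℕₚ.<-trans c<β β<p) ⟩
      p * passCount β n                 ≤⟨ ℕₚ.*-monoʳ-≤ p pass≤ ⟩
      p * ∑ (residuePairs n) (ind ∘ passing?) ≤⟨ square-factor-bound ⟩
      ∑ (residuePairs n) (ind ∘ J? L)   ≤⟨ J≤M ⟩
      M n                               ∎
      where
      open ℕₚ.≤-Reasoning
      L = factors n n
      open Modulus n 1<n L refl
      open SquareFactor n 1<n L refl n-odd p pp p²∣n
      pass≤ : passCount β n ≤ ∑ (residuePairs n) (ind ∘ passing?)
      pass≤ = ℕₚ.≤-trans (ℕₚ.≤-reflexive (length-filter-∑ (λ z → T? (passesQFT β n (proj₁ z) (proj₂ z))) (residuePairs n)))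
        (∑-mono (residuePairs n) λ {z} _ → ind-mono (T? (passesQFT β n (proj₁ z) (proj₂ z))) (passing? z) λ t →
          let P = Unpack.unpack n 1<n L refl z β t in Passes.params P , Passes.step4 P)

    -- A single passing pair certifies that trial division found nothing, so every prime factor of n
    -- exceeds β.
    nonzero-case : 1 ≤ passCount β n → c * passCount β n < M n
    nonzero-case 1≤pass = case toSum (All.all? (λ p → ¬? (p * p ∣? n)) L) of λ where
        (inj₁ squarefree) → squarefree-case L refl
          (squarefree⇒Unique L (λ p∈ p²∣ → All.lookup squarefree p∈ (subst (_ ∣_) product≡n p²∣)))
          (All.tabulate (ℕₚ.<⇒≤ ∘ large))
        (inj₂ ¬squarefree) → let p , p∈ , ¬¬p²∣n = find (Allₚ.¬All⇒Any¬ (λ p → ¬? (p * p ∣? n)) L ¬squarefree) in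
          square-factor-case (All.lookup primes p∈) (decidable-stable (p * p ∣? n) ¬¬p²∣n) (large p∈) 1≤pass
      where
      L = factors n n
      open Modulus n 1<n L refl
      witness : ∃ λ z → T (passesQFT β n (proj₁ z) (proj₂ z))
      witness = let z , _ , 1≤ = ∑-witness (residuePairs n) (λ z → ind (T? (passesQFT β n (proj₁ z) (proj₂ z))))
                                  (subst (1 ≤_) (length-filter-∑ (λ z → T? (passesQFT β n (proj₁ z) (proj₂ z))) (residuePairs n)) 1≤pass)
                in z , ind-pos (T? (passesQFT β n (proj₁ z) (proj₂ z))) 1≤
      large : ∀ {p} → p ∈ L → β < p
      large p∈ = step1⇒prime-factors> comp (Passes.step1 (Unpack.unpack n 1<n L refl (proj₁ witness) β (proj₂ witness)))
        (All.lookup primes p∈) (∈⇒∣n p∈)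

  passCount-bound : ∀ n → ¬ (2 ∣ n) → Composite n → c * passCount β n < M n
  passCount-bound n 2∤n comp@(ℕ.composite {d} d<n d∣n) =
    [ nonzero-case n comp 1<n (∤2⇒Odd 2∤n)
    -- If no pair passes, the strict inequality rests on the degenerate pairs, which make M(n)
    -- positive.
    , (λ 1≰pass → subst (_< M n) (sym (trans (cong (c *_) (ℕₚ.n<1⇒n≡0 (ℕₚ.≰⇒> 1≰pass))) (ℕₚ.*-zeroʳ c)))
        (Modulus.0<M n 1<n (factors n n) refl 1<d d<n d∣n)) ]′
    (toSum (1 ≤? passCount β n))
    where
    1<d : 1 < d
    1<d = nonTrivial⇒n>1 d
    1<n : 1 < n
    1<n = ℕₚ.<-trans 1<d d<n

theorem2p6 : (n : ℕ) → ¬ (2 ∣ n) → Composite n →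
    7710 * passCount 50000 n < M n
theorem2p6 = Main.passCount-bound 7710 50000 (ℕₚ.<ᵇ⇒< _ _ tt) (ℕₚ.≤ᵇ⇒≤ _ _ tt) (ℕₚ.≤ᵇ⇒≤ _ _ tt) (ℕₚ.≤ᵇ⇒≤ _ _ tt) (ℕₚ.≤ᵇ⇒≤ _ _ tt)
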